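{- If $\mathsf{M}$ is a sparse paving matroid, then Speyer's polynomial $g_{\mathsf{M}}(t)$ has non-negative coefficients.
   Context: All matroids have finite ground sets contained in the positive integers. A matroid is paving if all its dependent sets have size at least its rank; it is sparse paving if both it and its dual are paving. Speyer's $g$-polynomial: the base polytope of a matroid $\mathsf{M}$ on $E$ with bases $\mathscr{B}$ is $\mathscr{P}(\mathsf{M})=\operatorname{conv}\{\sum_{i\in B}e_i : B\in\mathscr{B}\}\subseteq\mathbb{R}^E$, with indicator function $\mathbf{1}_{\mathscr{P}(\mathsf{M})}$. A map $f$ from matroids to an abelian group is a valuation if $\sum_i a_if(\mathsf{M}_i)=0$ whenever $\mathsf{M}_1,\dots,\mathsf{M}_s$ are matroids on a common ground set and $a_i\in\mathbb{Z}$ satisfy $\sum_i a_i\mathbf{1}_{\mathscr{P}(\mathsf{M}_i)}=0$. A map $f$ is a covaluation if $\mathsf{M}\mapsto(-1)^{c(\mathsf{M})}f(\mathsf{M})$ is a valuation, where $c(\mathsf{M})$ is the number of connected components of $\mathsf{M}$. Series-parallel matroids are the matroids obtained from the uniform matroid $\mathsf{U}_{1,2}$ by a sequence of series and parallel extensions, together with $\mathsf{U}_{0,1}$ and $\mathsf{U}_{1,1}$ (in particular they are connected). The map $\mathsf{M}\mapsto g_{\mathsf{M}}(t)\in\mathbb{Z}[t]$ is the unique isomorphism invariant of matroids such that (a) $g$ is covaluative; (b) $g_{\mathsf{M}}(t)=0$ if $\mathsf{M}$ has loops or coloops; (c) $g_{\mathsf{M}}(t)=t^m$ if $\mathsf{M}$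 is loopless and coloopless and is isomorphic to a direct sum of $m$ series-parallel matroids. -}

module Defs where

open import Level using (0ℓ; _⊔_) renaming (suc to lsuc)
open import Algebra.Bundles using (AbelianGroup)
import Algebra.Definitions.RawMonoid as RawMonoidDefinitions
open import Data.Bool.Base using (if_then_else_)
open import Data.Fin.Base as Fin using (Fin; zero; suc; _↑ˡ_; _↑ʳ_; splitAt)
import Data.Fin.Properties as Fin
open import Data.Fin.Permutation using (Permutation; _⟨$⟩ˡ_)
open import Data.Fin.Subset
open import Data.Fin.Subset.Properties
open import Data.Integer.Base as ℤ using (ℤ; 0ℤ; 1ℤ; -1ℤ; -[1+_])
import Data.Integer.Properties as ℤ
open import Data.List.Base as List using (List; []; _∷_; length; map; allFin; deduplicate)
open import Data.List.Relation.Unary.All using (All)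
open import Data.List.Relation.Unary.Linked using (Linked)
open import Data.Nat.Base as ℕ using (ℕ; zero; suc; z≤n; s≤s)
open import Data.Nat.ListAction using (sum)
open import Data.Nat.Induction using (<-wellFounded)
import Data.Nat.Properties as ℕ
open import Data.Product.Base using (∃; ∃₂; _×_; _,_; proj₁; proj₂)
open import Data.Rational.Base as ℚ using (ℚ; 0ℚ; 1ℚ)
import Data.Rational.Properties as ℚ
open import Data.Rational.Solver using (module +-*-Solver)
open import Data.Sum.Base using (_⊎_; inj₁; inj₂; [_,_]′)
open import Data.Vec.Base as Vec using (Vec; []; _∷_; lookup; tabulate; take; drop; here; there)
import Data.Vec.Functional as Vector
import Data.Vec.Properties as Vec
open import Function.Base using (_∘_)
open import Function.Bundles using (_⇔_)
open import Induction.WellFounded using (Acc; acc)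
open import Relation.Binary.PropositionalEquality
open import Relation.Nullary.Decidable using (Dec; yes; no; does; ¬?; _×-dec_; _⊎-dec_; map′; decidable-stable; dec-false)
open import Relation.Nullary.Negation using (¬_; contradiction)
open import Relation.Unary using (Pred; Decidable)

private
  variable
    m n : ℕ

-- The real numbers: Cauchy sequences of rationals, with equality and order as
-- defined relations.

record ℝ : Set where
  constructor mkℝ
  field
    seq    : ℕ → ℚ
    cauchy : ∀ ε → 0ℚ ℚ.< ε → ∃ λ N → ∀ i j → N ℕ.≤ i → N ℕ.≤ j →
             ℚ.∣ seq i ℚ.- seq j ∣ ℚ.≤ ε

open ℝ public

infix 4 _≈ᴿ_ _≤ᴿ_
infixl 6 _+ᴿ_
infixl 7 _*ᴿ_

_≈ᴿ_ : ℝ → ℝ → Set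
x ≈ᴿ y = ∀ ε → 0ℚ ℚ.< ε → ∃ λ N → ∀ i → N ℕ.≤ i → ℚ.∣ seq x i ℚ.- seq y i ∣ ℚ.≤ ε

_≤ᴿ_ : ℝ → ℝ → Set
x ≤ᴿ y = ∀ ε → 0ℚ ℚ.< ε → ∃ λ N → ∀ i → N ℕ.≤ i → seq x i ℚ.≤ seq y i ℚ.+ ε

fromℚ : ℚ → ℝ
fromℚ q = mkℝ (λ _ → q) λ ε 0<ε → 0 , λ _ _ _ _ →
  subst (ℚ._≤ ε) (cong ℚ.∣_∣ (sym (ℚ.+-inverseʳ q))) (ℚ.<⇒≤ 0<ε)

0ᴿ 1ᴿ : ℝ
0ᴿ = fromℚ 0ℚ
1ᴿ = fromℚ 1ℚ

0<½ : 0ℚ ℚ.< ℚ.½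
0<½ = ℚ.positive⁻¹ ℚ.½

half-pos : ∀ {ε} → 0ℚ ℚ.< ε → 0ℚ ℚ.< ℚ.½ ℚ.* ε
half-pos {ε} 0<ε = ℚ.positive⁻¹ (ℚ.½ ℚ.* ε)
  {{ℚ.pos*pos⇒pos ℚ.½ ε {{ℚ.positive 0<ε}}}}

halves : ∀ ε → ℚ.½ ℚ.* ε ℚ.+ ℚ.½ ℚ.* ε ≡ ε
halves ε = trans (sym (ℚ.*-distribʳ-+ ε ℚ.½ ℚ.½)) (ℚ.*-identityˡ ε)

+-difference : ∀ a b c d → (a ℚ.+ b) ℚ.- (c ℚ.+ d) ≡ (a ℚ.- c) ℚ.+ (b ℚ.- d)
+-difference = solve 4 (λ a b c d → (a :+ b) :- (c :+ d) := (a :- c) :+ (b :- d)) refl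
  where open +-*-Solver

*-difference : ∀ a b c d → (a ℚ.* b) ℚ.- (c ℚ.* d) ≡ a ℚ.* (b ℚ.- d) ℚ.+ d ℚ.* (a ℚ.- c)
*-difference = solve 4 (λ a b c d → (a :* b) :- (c :* d) := a :* (b :- d) :+ d :* (a :- c)) refl
  where open +-*-Solver

bounded : ∀ x → ∃₂ λ K N → 0ℚ ℚ.< K × (∀ i → N ℕ.≤ i → ℚ.∣ seq x i ∣ ℚ.≤ K)
bounded x with cauchy x 1ℚ (ℚ.positive⁻¹ 1ℚ)
... | N , close = 1ℚ ℚ.+ ℚ.∣ a ∣ , N ,
    ℚ.+-mono-<-≤ (ℚ.positive⁻¹ 1ℚ) (ℚ.0≤∣p∣ a) ,
    λ i N≤i → begin
      ℚ.∣ seq x i ∣                            ≡⟨ cong ℚ.∣_∣ (insert (seq x i) a) ⟩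
      ℚ.∣ (seq x i ℚ.- a) ℚ.+ a ∣              ≤⟨ ℚ.∣p+q∣≤∣p∣+∣q∣ (seq x i ℚ.- a) a ⟩
      ℚ.∣ seq x i ℚ.- a ∣ ℚ.+ ℚ.∣ a ∣          ≤⟨ ℚ.+-monoˡ-≤ ℚ.∣ a ∣ (close i N N≤i ℕ.≤-refl) ⟩
      1ℚ ℚ.+ ℚ.∣ a ∣                           ∎
  where
  open ℚ.≤-Reasoning
  a = seq x N
  insert : ∀ p q → p ≡ (p ℚ.- q) ℚ.+ q
  insert = solve 2 (λ p q → p := (p :- q) :+ q) refl
    where open +-*-Solver

*-mono-∣∣ : ∀ p q {K δ} → ℚ.∣ p ∣ ℚ.≤ K → ℚ.∣ q ∣ ℚ.≤ δ → 0ℚ ℚ.< δ → ℚ.∣ p ℚ.* q ∣ ℚ.≤ K ℚ.* δ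
*-mono-∣∣ p q {K} {δ} p≤K q≤δ 0<δ = begin
  ℚ.∣ p ℚ.* q ∣            ≡⟨ ℚ.∣p*q∣≡∣p∣*∣q∣ p q ⟩
  ℚ.∣ p ∣ ℚ.* ℚ.∣ q ∣      ≤⟨ ℚ.*-monoˡ-≤-nonNeg ℚ.∣ p ∣ {{ℚ.∣-∣-nonNeg p}} q≤δ ⟩
  ℚ.∣ p ∣ ℚ.* δ            ≤⟨ ℚ.*-monoʳ-≤-nonNeg δ {{ℚ.nonNegative (ℚ.<⇒≤ 0<δ)}} p≤K ⟩
  K ℚ.* δ                  ∎
  where open ℚ.≤-Reasoning

_+ᴿ_ : ℝ → ℝ → ℝ
seq    (x +ᴿ y) i = seq x i ℚ.+ seq y i
cauchy (x +ᴿ y) ε 0<ε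
  with cauchy x (ℚ.½ ℚ.* ε) (half-pos 0<ε) | cauchy y (ℚ.½ ℚ.* ε) (half-pos 0<ε)
... | N₁ , close₁ | N₂ , close₂ = N₁ ℕ.⊔ N₂ , λ i j N≤i N≤j →
  let open ℚ.≤-Reasoning
      a = seq x i ; b = seq y i ; c = seq x j ; d = seq y j
  in begin
    ℚ.∣ (a ℚ.+ b) ℚ.- (c ℚ.+ d) ∣              ≡⟨ cong ℚ.∣_∣ (+-difference a b c d) ⟩
    ℚ.∣ (a ℚ.- c) ℚ.+ (b ℚ.- d) ∣              ≤⟨ ℚ.∣p+q∣≤∣p∣+∣q∣ (a ℚ.- c) (b ℚ.- d) ⟩
    ℚ.∣ a ℚ.- c ∣ ℚ.+ ℚ.∣ b ℚ.- d ∣            ≤⟨ ℚ.+-mono-≤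
      (close₁ i j (ℕ.m⊔n≤o⇒m≤o N₁ N₂ N≤i) (ℕ.m⊔n≤o⇒m≤o N₁ N₂ N≤j))
      (close₂ i j (ℕ.m⊔n≤o⇒n≤o N₁ N₂ N≤i) (ℕ.m⊔n≤o⇒n≤o N₁ N₂ N≤j)) ⟩
    ℚ.½ ℚ.* ε ℚ.+ ℚ.½ ℚ.* ε                    ≡⟨ halves ε ⟩
    ε                                          ∎

divide : ∀ {K ε} → 0ℚ ℚ.< K → 0ℚ ℚ.< ε → ∃ λ δ → 0ℚ ℚ.< δ × K ℚ.* δ ≡ ε
divide {K} {ε} 0<K 0<ε = K⁻¹ ℚ.* ε ,
  ℚ.positive⁻¹ (K⁻¹ ℚ.* ε) {{ℚ.pos*pos⇒pos K⁻¹ {{ℚ.1/pos⇒pos K}} ε {{ℚ.positive 0<ε}}}} ,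
  (begin
    K ℚ.* (K⁻¹ ℚ.* ε)      ≡⟨ ℚ.*-assoc K K⁻¹ ε ⟨
    K ℚ.* K⁻¹ ℚ.* ε        ≡⟨ cong (ℚ._* ε) (ℚ.*-inverseʳ K) ⟩
    1ℚ ℚ.* ε               ≡⟨ ℚ.*-identityˡ ε ⟩
    ε                      ∎)
  where
  open ≡-Reasoning
  instance
    _ : ℚ.Positive K
    _ = ℚ.positive 0<K
    _ : ℚ.NonZero K
    _ = ℚ.pos⇒nonZero K
  K⁻¹ = ℚ.1/ K

*-close : ∀ {K L δ ε} a b c d → 0ℚ ℚ.< δ → (K ℚ.+ L) ℚ.* δ ≡ ε →
          ℚ.∣ a ∣ ℚ.≤ K → ℚ.∣ d ∣ ℚ.≤ L →
          ℚ.∣ a ℚ.- c ∣ ℚ.≤ δ → ℚ.∣ b ℚ.- d ∣ ℚ.≤ δ →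
          ℚ.∣ a ℚ.* b ℚ.- c ℚ.* d ∣ ℚ.≤ ε
*-close {K} {L} {δ} {ε} a b c d 0<δ eq a≤K d≤L ac bd = begin
  ℚ.∣ a ℚ.* b ℚ.- c ℚ.* d ∣                            ≡⟨ cong ℚ.∣_∣ (*-difference a b c d) ⟩
  ℚ.∣ a ℚ.* (b ℚ.- d) ℚ.+ d ℚ.* (a ℚ.- c) ∣            ≤⟨ ℚ.∣p+q∣≤∣p∣+∣q∣ (a ℚ.* (b ℚ.- d)) (d ℚ.* (a ℚ.- c)) ⟩
  ℚ.∣ a ℚ.* (b ℚ.- d) ∣ ℚ.+ ℚ.∣ d ℚ.* (a ℚ.- c) ∣      ≤⟨ ℚ.+-mono-≤
    (*-mono-∣∣ a (b ℚ.- d) a≤K bd 0<δ) (*-mono-∣∣ d (a ℚ.- c) d≤L ac 0<δ) ⟩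
  K ℚ.* δ ℚ.+ L ℚ.* δ                                  ≡⟨ ℚ.*-distribʳ-+ δ K L ⟨
  (K ℚ.+ L) ℚ.* δ                                      ≡⟨ eq ⟩
  ε                                                    ∎
  where open ℚ.≤-Reasoning

_*ᴿ_ : ℝ → ℝ → ℝ
seq    (x *ᴿ y) i = seq x i ℚ.* seq y i
cauchy (x *ᴿ y) ε 0<ε =
  let K , M₁ , 0<K , x≤K = bounded x
      L , M₂ , 0<L , y≤L = bounded y
      δ , 0<δ , eq = divide (ℚ.+-mono-< 0<K 0<L) 0<ε
      N₁ , cx = cauchy x δ 0<δ
      N₂ , cy = cauchy y δ 0<δ
      M = M₁ ℕ.⊔ M₂
      N = N₁ ℕ.⊔ N₂
  in M ℕ.⊔ N , λ i j ≤i ≤j →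
    *-close (seq x i) (seq y i) (seq x j) (seq y j) 0<δ eq
      (x≤K i (ℕ.m⊔n≤o⇒m≤o M₁ M₂ (ℕ.m⊔n≤o⇒m≤o M N ≤i)))
      (y≤L j (ℕ.m⊔n≤o⇒n≤o M₁ M₂ (ℕ.m⊔n≤o⇒m≤o M N ≤j)))
      (cx i j (ℕ.m⊔n≤o⇒m≤o N₁ N₂ (ℕ.m⊔n≤o⇒n≤o M N ≤i)) (ℕ.m⊔n≤o⇒m≤o N₁ N₂ (ℕ.m⊔n≤o⇒n≤o M N ≤j)))
      (cy i j (ℕ.m⊔n≤o⇒n≤o N₁ N₂ (ℕ.m⊔n≤o⇒n≤o M N ≤i)) (ℕ.m⊔n≤o⇒n≤o N₁ N₂ (ℕ.m⊔n≤o⇒n≤o M N ≤j)))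

∑ᴿ : ∀ {s} → (Fin s → ℝ) → ℝ
∑ᴿ = Vector.foldr _+ᴿ_ 0ᴿ

ℝ^ : ℕ → Set
ℝ^ n = Fin n → ℝ

-- Membership in the convex hull of the points v i, for i in I.

conv : {I : Set} → (I → ℝ^ n) → Pred (ℝ^ n) 0ℓ
conv {I = I} v x = ∃ λ s → ∃₂ λ (w : Fin s → ℝ) (c : Fin s → I) →
  (∀ j → 0ᴿ ≤ᴿ w j) × ∑ᴿ w ≈ᴿ 1ᴿ × (∀ e → x e ≈ᴿ ∑ᴿ λ j → w j *ᴿ v (c j) e)

-- Matroids with ground set Fin n.

exchange : Subset n → Fin n → Fin n → Subset n
exchange B x y = (B - x) ∪ ⁅ y ⁆

record Matroid (n : ℕ) : Set₁ where
  field
    Basis          : Pred (Subset n) 0ℓ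
    basis?         : Decidable Basis
    someBasis      : ∃ Basis
    basis-exchange : ∀ {B₁ B₂} → Basis B₁ → Basis B₂ → ∀ {x} → x ∈ B₁ → x ∉ B₂ →
                     ∃ λ y → y ∈ B₂ × y ∉ B₁ × Basis (exchange B₁ x y)

open Matroid public

infix 4 _∼_
_∼_ : Subset n → Subset n → Set
p ∼ q = p ⊆ q × q ⊆ p

∼⇒≡ : {p q : Subset n} → p ∼ q → p ≡ q
∼⇒≡ (p⊆q , q⊆p) = ⊆-antisym p⊆q q⊆p

∉─ : ∀ {p q : Subset n} {z} → z ∈ q → z ∉ p ─ q
∉─ {p = _ ∷ _} here ()
∉─ {p = _ ∷ _} {outside ∷ _} (there z∈q) (there z∈p─q) = ∉─ z∈q z∈p─q
∉─ {p = _ ∷ _} {inside  ∷ _} (there z∈q) (there z∈p─q) = ∉─ z∈q z∈p─q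

∈-⁻ : ∀ {p : Subset n} x {z} → z ∈ p - x → z ∈ p × z ≢ x
∈-⁻ {p = p} x z∈ = p─q⊆p p ⁅ x ⁆ z∈ , λ { refl → ∉─ {p = p} (x∈⁅x⁆ x) z∈ }

∈∪⁅⁆⁻ : ∀ (p : Subset n) x {z} → z ∈ p ∪ ⁅ x ⁆ → z ∈ p ⊎ z ≡ x
∈∪⁅⁆⁻ p x z∈ with x∈p∪q⁻ p ⁅ x ⁆ z∈
... | inj₁ z∈p = inj₁ z∈p
... | inj₂ z∈x = inj₂ (x∈⁅y⁆⇒x≡y x z∈x)

∈∪ˡ : ∀ {p : Subset n} x {z} → z ∈ p → z ∈ p ∪ ⁅ x ⁆
∈∪ˡ x z∈p = x∈p∪q⁺ (inj₁ z∈p)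

∈∪ʳ : ∀ {p : Subset n} x → x ∈ p ∪ ⁅ x ⁆
∈∪ʳ x = x∈p∪q⁺ (inj₂ (x∈⁅x⁆ x))

∈exchange⁻ : ∀ (p : Subset n) x y {z} → z ∈ exchange p x y → (z ∈ p × z ≢ x) ⊎ z ≡ y
∈exchange⁻ p x y z∈ with ∈∪⁅⁆⁻ (p - x) y z∈
... | inj₁ z∈p-x = inj₁ (∈-⁻ x z∈p-x)
... | inj₂ z≡y   = inj₂ z≡y

∈exchangeˡ : ∀ {p : Subset n} x y {z} → z ∈ p → z ≢ x → z ∈ exchange p x y
∈exchangeˡ x y z∈p z≢x = ∈∪ˡ y (x∈p∧x≢y⇒x∈p-y z∈p z≢x)

∈exchangeʳ : ∀ {p : Subset n} x y → y ∈ exchange p x y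
∈exchangeʳ x y = ∈∪ʳ y

-- All bases have the same size, so the choice of basis is immaterial.

rank : Matroid n → ℕ
rank M = ∣ proj₁ (someBasis M) ∣

dual-exchange : (M : Matroid n) → ∀ {B₁ B₂} → Basis M B₁ → Basis M B₂ →
                ∀ {y} → y ∈ B₂ → y ∉ B₁ →
                ∃ λ x → x ∈ B₁ × x ∉ B₂ × Basis M (exchange B₁ x y)
dual-exchange {n} M {B₁} {B₂₀} b₁ b₂₀ {y} = go B₂₀ (<-wellFounded ∣ B₂₀ ─ B₁ ∣) b₂₀
  where
  ∈─⁻ : ∀ {p q : Subset n} {z} → z ∈ p ─ q → z ∈ p × z ∉ q
  ∈─⁻ {p} {q} z∈ = p─q⊆p p q z∈ , λ z∈q → ∉─ z∈q z∈

  go : ∀ B₂ → Acc ℕ._<_ ∣ B₂ ─ B₁ ∣ → Basis M B₂ → y ∈ B₂ → y ∉ B₁ →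
       ∃ λ x → x ∈ B₁ × x ∉ B₂ × Basis M (exchange B₁ x y)
  go B₂ (acc rec) b₂ y∈ y∉ with nonempty? ((B₂ ─ B₁) - y)
  ... | yes (z , z∈) =
    let z∈₂₁ , z≢y = ∈-⁻ y z∈
        z∈₂ , z∉₁ = ∈─⁻ {B₂} {B₁} z∈₂₁
        w , w∈₁ , w∉₂ , b₃ = basis-exchange M b₂ b₁ z∈₂ z∉₁
        B₃ = exchange B₂ z w
        ⊆₂ : B₃ ─ B₁ ⊆ B₂ ─ B₁
        ⊆₂ = λ u∈ → let u∈₃ , u∉₁ = ∈─⁻ {B₃} {B₁} u∈ in
          [ (λ (u∈₂ , _) → x∈p∧x∉q⇒x∈p─q u∈₂ u∉₁)
          , (λ u≡w → contradiction (subst (_∈ B₁) (sym u≡w) w∈₁) u∉₁) ]′ (∈exchange⁻ B₂ z w u∈₃)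
        z∉₃ : z ∉ B₃ ─ B₁
        z∉₃ = λ z∈ → [ (λ (_ , z≢z) → z≢z refl)
                     , (λ z≡w → w∉₂ (subst (_∈ B₂) z≡w z∈₂)) ]′
                     (∈exchange⁻ B₂ z w (proj₁ (∈─⁻ {B₃} {B₁} z∈)))
        x , x∈₁ , x∉₃ , b = go B₃ (rec (p⊂q⇒∣p∣<∣q∣ (⊆₂ , z , z∈₂₁ , z∉₃))) b₃
                              (∈exchangeˡ z w y∈ (z≢y ∘ sym)) y∉
    in x , x∈₁ , (λ x∈₂ → x∉₃ (∈exchangeˡ z w x∈₂ (λ x≡z → z∉₁ (subst (_∈ B₁) x≡z x∈₁)))) , b
  ... | no ∄z =
    let x , x∈₁ , x∉₂ , _ = basis-exchange M b₂ b₁ y∈ y∉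
        w , w∈₂ , w∉₁ , b = basis-exchange M b₁ b₂ x∈₁ x∉₂
        w≡y = decidable-stable (w Fin.≟ y) λ w≢y →
                ∄z (w , x∈p∧x≢y⇒x∈p-y (x∈p∧x∉q⇒x∈p─q w∈₂ w∉₁) w≢y)
    in x , x∈₁ , x∉₂ , subst (Basis M ∘ exchange B₁ x) w≡y b

dual : Matroid n → Matroid n
dual M .Basis B  = Basis M (∁ B)
dual M .basis? B = basis? M (∁ B)
dual M .someBasis =
  let B , b = someBasis M in ∁ B , subst (Basis M) (sym (∁-involutive B)) b
  where
  ∁-involutive : ∀ {n} (p : Subset n) → ∁ (∁ p) ≡ p
  ∁-involutive p = ∼⇒≡
    ( (λ x∈ → x∉∁p⇒x∈p (x∈∁p⇒x∉p x∈))
    , (λ x∈ → x∉p⇒x∈∁p (λ x∈∁p → x∈∁p⇒x∉p x∈∁p x∈)) )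
dual M .basis-exchange {B₁} {B₂} b₁ b₂ {x} x∈₁ x∉₂ =
  let y , y∈ , y∉ , b = dual-exchange M b₁ b₂ (x∉p⇒x∈∁p x∉₂) (λ x∈∁ → x∈∁p⇒x∉p x∈∁ x∈₁)
      x≢y : x ≢ y
      x≢y = λ x≡y → x∈∁p⇒x∉p y∈ (subst (_∈ B₁) x≡y x∈₁)
      ⇒ : exchange (∁ B₁) y x ⊆ ∁ (exchange B₁ x y)
      ⇒ = λ {z} z∈ → x∉p⇒x∈∁p λ z∈′ →
        [ (λ (z∈∁ , z≢y) → [ (λ (z∈₁ , _) → x∈∁p⇒x∉p z∈∁ z∈₁) , z≢y ]′ (∈exchange⁻ B₁ x y z∈′))
        , (λ z≡x → [ (λ (_ , z≢x) → z≢x z≡x) , (λ z≡y → x≢y (trans (sym z≡x) z≡y)) ]′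
                   (∈exchange⁻ B₁ x y z∈′)) ]′
        (∈exchange⁻ (∁ B₁) y x z∈)
      ⇐ : ∁ (exchange B₁ x y) ⊆ exchange (∁ B₁) y x
      ⇐ = λ {z} z∈ → outside⇒ (x∈∁p⇒x∉p z∈)
  in y , x∉∁p⇒x∈p y∉ , x∈∁p⇒x∉p y∈ , subst (Basis M) (∼⇒≡ (⇒ , ⇐)) b
  where
  outside⇒ : ∀ {y z} → z ∉ exchange B₁ x y → z ∈ exchange (∁ B₁) y x
  outside⇒ {y} {z} z∉ with z Fin.≟ x
  ... | yes refl = ∈exchangeʳ y x
  ... | no z≢x = ∈exchangeˡ y x
    (x∉p⇒x∈∁p (λ z∈₁ → z∉ (∈exchangeˡ x y z∈₁ z≢x)))
    (λ z≡y → z∉ (subst (_∈ exchange B₁ x y) (sym z≡y) (∈exchangeʳ x y)))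

∣p∪⁅x⁆∣ : ∀ (p : Subset n) x → x ∉ p → ∣ p ∪ ⁅ x ⁆ ∣ ≡ suc ∣ p ∣
∣p∪⁅x⁆∣ (inside  ∷ p) zero    x∉ = contradiction here x∉
∣p∪⁅x⁆∣ (outside ∷ p) zero    x∉ = cong (suc ∘ ∣_∣) (∪-identityʳ p)
∣p∪⁅x⁆∣ (inside  ∷ p) (suc x) x∉ = cong suc (∣p∪⁅x⁆∣ p x (x∉ ∘ there))
∣p∪⁅x⁆∣ (outside ∷ p) (suc x) x∉ = ∣p∪⁅x⁆∣ p x (x∉ ∘ there)

suc∣p-x∣ : ∀ (p : Subset n) x → x ∈ p → suc ∣ p - x ∣ ≡ ∣ p ∣
suc∣p-x∣ (inside  ∷ p) zero    x∈ = cong (suc ∘ ∣_∣) (p─⊥≡p p)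
suc∣p-x∣ (inside  ∷ p) (suc x) (there x∈) = cong suc (suc∣p-x∣ p x x∈)
suc∣p-x∣ (outside ∷ p) (suc x) (there x∈) = suc∣p-x∣ p x x∈

U : ∀ k n → k ℕ.≤ n → Matroid n
U k n k≤n .Basis B  = ∣ B ∣ ≡ k
U k n k≤n .basis? B = ∣ B ∣ ℕ.≟ k
U k n k≤n .someBasis = initial k≤n
  where
  initial : ∀ {k n} → k ℕ.≤ n → ∃ λ (B : Subset n) → ∣ B ∣ ≡ k
  initial {n = n} z≤n = ⊥ , ∣⊥∣≡0 n
  initial (s≤s k≤n) = let B , eq = initial k≤n in inside ∷ B , cong suc eq
U k n k≤n .basis-exchange {B₁} {B₂} b₁ b₂ {x} x∈ x∉ with nonempty? (B₂ ─ B₁)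
... | yes (y , y∈) = y , p─q⊆p B₂ B₁ y∈ , y∉₁ ,
      trans (∣p∪⁅x⁆∣ (B₁ - x) y (y∉₁ ∘ p─q⊆p B₁ ⁅ x ⁆)) (trans (suc∣p-x∣ B₁ x x∈) b₁)
  where
  y∉₁ : y ∉ B₁
  y∉₁ y∈₁ = ∉─ y∈₁ y∈
... | no ∄y = contradiction (p⊂q⇒∣p∣<∣q∣ (B₂⊆B₁ , x , x∈ , x∉))
                            (ℕ.≤⇒≯ (ℕ.≤-reflexive (trans b₁ (sym b₂))))
  where
  B₂⊆B₁ : B₂ ⊆ B₁
  B₂⊆B₁ {z} z∈ = decidable-stable (z ∈? B₁) λ z∉ → ∄y (z , x∈p∧x∉q⇒x∈p─q z∈ z∉)

take-++ : ∀ (p : Subset m) (q : Subset n) → take m (p Vec.++ q) ≡ p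
take-++ {m = m} p q = Vec.++-injectiveˡ _ p (Vec.take++drop≡id m (p Vec.++ q))

drop-++ : ∀ (p : Subset m) (q : Subset n) → drop m (p Vec.++ q) ≡ q
drop-++ {m = m} p q = Vec.++-injectiveʳ _ p (Vec.take++drop≡id m (p Vec.++ q))

∈take⁺ : ∀ (p : Subset (m ℕ.+ n)) {x} → x ↑ˡ n ∈ p → x ∈ take m p
∈take⁺ (_ ∷ p) {zero}  here       = here
∈take⁺ (_ ∷ p) {suc x} (there x∈) = there (∈take⁺ p x∈)

∈take⁻ : ∀ (p : Subset (m ℕ.+ n)) {x} → x ∈ take m p → x ↑ˡ n ∈ p
∈take⁻ (_ ∷ p) {zero}  here       = here
∈take⁻ (_ ∷ p) {suc x} (there x∈) = there (∈take⁻ p x∈)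

∈drop⁺ : ∀ (p : Subset (m ℕ.+ n)) {x} → m ↑ʳ x ∈ p → x ∈ drop m p
∈drop⁺ {m = zero}  p       x∈         = x∈
∈drop⁺ {m = suc m} (_ ∷ p) (there x∈) = ∈drop⁺ p x∈

∈drop⁻ : ∀ (p : Subset (m ℕ.+ n)) {x} → x ∈ drop m p → m ↑ʳ x ∈ p
∈drop⁻ {m = zero}  p       x∈ = x∈
∈drop⁻ {m = suc m} (_ ∷ p) x∈ = there (∈drop⁻ p x∈)

↑ˡ≢↑ʳ : ∀ {x : Fin m} {y : Fin n} → x ↑ˡ n ≢ m ↑ʳ y
↑ˡ≢↑ʳ {x = suc x} eq = ↑ˡ≢↑ʳ (Fin.suc-injective eq)

take-exchangeˡ : ∀ (B : Subset (m ℕ.+ n)) x y →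
                 take m (exchange B (x ↑ˡ n) (y ↑ˡ n)) ≡ exchange (take m B) x y
take-exchangeˡ {m} {n} B x y = ∼⇒≡
  ( (λ z∈ → [ (λ (z∈B , z≢x) → ∈exchangeˡ x y (∈take⁺ B z∈B) (z≢x ∘ cong (_↑ˡ n)))
            , (λ z≡y → subst (_∈ exchange (take m B) x y) (sym (Fin.↑ˡ-injective n _ _ z≡y)) (∈exchangeʳ x y)) ]′
            (∈exchange⁻ B _ _ (∈take⁻ _ z∈)))
  , (λ z∈ → ∈take⁺ _ ([ (λ (z∈B , z≢x) → ∈exchangeˡ _ _ (∈take⁻ B z∈B) (z≢x ∘ Fin.↑ˡ-injective n _ _))
            , (λ z≡y → subst (λ z → z ↑ˡ n ∈ exchange B (x ↑ˡ n) (y ↑ˡ n)) (sym z≡y) (∈exchangeʳ _ _)) ]′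
            (∈exchange⁻ (take m B) x y z∈))) )

drop-exchangeˡ : ∀ (B : Subset (m ℕ.+ n)) x y →
                 drop m (exchange B (x ↑ˡ n) (y ↑ˡ n)) ≡ drop m B
drop-exchangeˡ {m} {n} B x y = ∼⇒≡
  ( (λ z∈ → [ (λ (z∈B , _) → ∈drop⁺ B z∈B) , (λ z≡y → contradiction (sym z≡y) ↑ˡ≢↑ʳ) ]′
            (∈exchange⁻ B _ _ (∈drop⁻ {m = m} _ z∈)))
  , (λ z∈ → ∈drop⁺ {m = m} _ (∈exchangeˡ _ _ (∈drop⁻ B z∈) (↑ˡ≢↑ʳ ∘ sym))) )

take-exchangeʳ : ∀ (B : Subset (m ℕ.+ n)) x y →
                 take m (exchange B (m ↑ʳ x) (m ↑ʳ y)) ≡ take m B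
take-exchangeʳ B x y = ∼⇒≡
  ( (λ z∈ → [ (λ (z∈B , _) → ∈take⁺ B z∈B) , (λ z≡y → contradiction z≡y ↑ˡ≢↑ʳ) ]′
            (∈exchange⁻ B _ _ (∈take⁻ _ z∈)))
  , (λ z∈ → ∈take⁺ _ (∈exchangeˡ _ _ (∈take⁻ B z∈) ↑ˡ≢↑ʳ)) )

drop-exchangeʳ : ∀ (B : Subset (m ℕ.+ n)) x y →
                 drop m (exchange B (m ↑ʳ x) (m ↑ʳ y)) ≡ exchange (drop m B) x y
drop-exchangeʳ {m} B x y = ∼⇒≡
  ( (λ z∈ → [ (λ (z∈B , z≢x) → ∈exchangeˡ x y (∈drop⁺ B z∈B) (z≢x ∘ cong (m ↑ʳ_)))
            , (λ z≡y → subst (_∈ exchange (drop m B) x y) (sym (Fin.↑ʳ-injective m _ _ z≡y)) (∈exchangeʳ x y)) ]′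
            (∈exchange⁻ B _ _ (∈drop⁻ {m = m} _ z∈)))
  , (λ z∈ → ∈drop⁺ {m = m} _ ([ (λ (z∈B , z≢x) → ∈exchangeˡ _ _ (∈drop⁻ B z∈B) (z≢x ∘ Fin.↑ʳ-injective m _ _))
            , (λ z≡y → subst (λ z → m ↑ʳ z ∈ exchange B (m ↑ʳ x) (m ↑ʳ y)) (sym z≡y) (∈exchangeʳ _ _)) ]′
            (∈exchange⁻ (drop m B) x y z∈))) )

-- The ground set of M ⊕ N is that of M followed by that of N.

infixr 6 _⊕_

_⊕_ : Matroid m → Matroid n → Matroid (m ℕ.+ n)
_⊕_ {m} M N .Basis B  = Basis M (take m B) × Basis N (drop m B)
_⊕_ {m} M N .basis? B = basis? M (take m B) ×-dec basis? N (drop m B)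
_⊕_ {m} M N .someBasis =
  let B , b = someBasis M
      C , c = someBasis N
  in B Vec.++ C , subst (Basis M) (sym (take-++ B C)) b , subst (Basis N) (sym (drop-++ B C)) c
_⊕_ {m} {n} M N .basis-exchange {B₁} {B₂} (b₁ , c₁) (b₂ , c₂) {x} x∈ x∉
  with splitAt m x in eq
... | inj₁ x′ with refl ← Fin.splitAt⁻¹-↑ˡ {i = x} eq =
  let y , y∈ , y∉ , b = basis-exchange M b₁ b₂ (∈take⁺ B₁ x∈) (x∉ ∘ ∈take⁻ B₂)
  in y ↑ˡ n , ∈take⁻ B₂ y∈ , y∉ ∘ ∈take⁺ B₁ ,
     subst (Basis M) (sym (take-exchangeˡ B₁ x′ y)) b ,
     subst (Basis N) (sym (drop-exchangeˡ B₁ x′ y)) c₁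
... | inj₂ x′ with refl ← Fin.splitAt⁻¹-↑ʳ {i = x} eq =
  let y , y∈ , y∉ , c = basis-exchange N c₁ c₂ (∈drop⁺ B₁ x∈) (x∉ ∘ ∈drop⁻ B₂)
  in m ↑ʳ y , ∈drop⁻ B₂ y∈ , y∉ ∘ ∈drop⁺ B₁ ,
     subst (Basis M) (sym (take-exchangeʳ B₁ x′ y)) b₁ ,
     subst (Basis N) (sym (drop-exchangeʳ B₁ x′ y)) c

⨁ : (Ms : List (∃ Matroid)) → Matroid (sum (map proj₁ Ms))
⨁ []             = U 0 0 z≤n
⨁ ((_ , M) ∷ Ms) = M ⊕ ⨁ Ms

-- Extensions add the new element 0 and shift the old elements up by one.  The
-- bases containing the new element of the parallel extension at e arise from
-- the bases of M containing e by replacing e.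

ParallelBasis : Matroid n → Fin n → Pred (Subset (suc n)) 0ℓ
ParallelBasis M e (outside ∷ B) = Basis M B
ParallelBasis M e (inside  ∷ B) = e ∉ B × Basis M (B ∪ ⁅ e ⁆)

parallel-exchange : (M : Matroid n) (e : Fin n) → ∀ {B₁ B₂} → ParallelBasis M e B₁ → ParallelBasis M e B₂ →
                    ∀ {x} → x ∈ B₁ → x ∉ B₂ →
                    ∃ λ y → y ∈ B₂ × y ∉ B₁ × ParallelBasis M e (exchange B₁ x y)
parallel-exchange M e = go _ _
  where
  new-old : ∀ B₁ B₂ → e ∉ B₁ → Basis M (B₁ ∪ ⁅ e ⁆) → Basis M B₂ →
            ∃ λ y → y ∈ B₂ × y ∉ B₁ × Basis M (B₁ ∪ ⁅ y ⁆)
  new-old B₁ B₂ e∉ b₁ b₂ with e ∈? B₂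
  ... | yes e∈₂ = e , e∈₂ , e∉ , b₁
  ... | no e∉₂ =
    let y , y∈ , y∉ , b = basis-exchange M b₁ b₂ (∈∪ʳ e) e∉₂
    in y , y∈ , y∉ ∘ ∈∪ˡ e , subst (Basis M) (∼⇒≡
      ( (λ z∈ → [ (λ (z∈ , z≢e) → [ ∈∪ˡ y , (λ z≡e → contradiction z≡e z≢e) ]′ (∈∪⁅⁆⁻ B₁ e z∈))
                , (λ { refl → ∈∪ʳ y }) ]′ (∈exchange⁻ (B₁ ∪ ⁅ e ⁆) e y z∈))
      , (λ z∈ → [ (λ z∈ → ∈exchangeˡ e y (∈∪ˡ e z∈) (λ { refl → e∉ z∈ }))
                , (λ { refl → ∈exchangeʳ e y }) ]′ (∈∪⁅⁆⁻ B₁ y z∈)) )) b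

  exchange-∪ : ∀ B x y → x ≢ e → exchange (B ∪ ⁅ e ⁆) x y ≡ exchange B x y ∪ ⁅ e ⁆
  exchange-∪ B x y x≢e = ∼⇒≡
    ( (λ z∈ → [ (λ (z∈ , z≢x) → [ (λ z∈ → ∈∪ˡ e (∈exchangeˡ x y z∈ z≢x)) , (λ { refl → ∈∪ʳ e }) ]′
                                (∈∪⁅⁆⁻ B e z∈))
              , (λ { refl → ∈∪ˡ e (∈exchangeʳ x y) }) ]′ (∈exchange⁻ (B ∪ ⁅ e ⁆) x y z∈))
    , (λ z∈ → [ (λ z∈ → [ (λ (z∈ , z≢x) → ∈exchangeˡ x y (∈∪ˡ e z∈) z≢x)
                        , (λ { refl → ∈exchangeʳ x y }) ]′ (∈exchange⁻ B x y z∈))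
              , (λ { refl → ∈exchangeˡ x y (∈∪ʳ e) (x≢e ∘ sym) }) ]′
              (∈∪⁅⁆⁻ (exchange B x y) e z∈)) )

  exchange-self : ∀ B → e ∈ B → exchange B e e ≡ B
  exchange-self B e∈ = ∼⇒≡
    ( (λ z∈ → [ proj₁ , (λ { refl → e∈ }) ]′ (∈exchange⁻ B e e z∈))
    , λ {z} → ⊇ z )
    where
    ⊇ : ∀ z → z ∈ B → z ∈ exchange B e e
    ⊇ z z∈ with z Fin.≟ e
    ... | yes refl = ∈exchangeʳ e e
    ... | no z≢e   = ∈exchangeˡ e e z∈ z≢e

  to-new : ∀ B₁ x → ¬ (e ∈ B₁ × e ≢ x) → Basis M (exchange B₁ x e) →
           ParallelBasis M e (exchange (outside ∷ B₁) (suc x) zero)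
  to-new B₁ x e∉ b = subst (λ B → e ∉ B × Basis M (B ∪ ⁅ e ⁆)) (sym (∪-identityʳ (B₁ - x)))
                           (e∉ ∘ ∈-⁻ x , b)

  go : ∀ B₁ B₂ → ParallelBasis M e B₁ → ParallelBasis M e B₂ → ∀ {x} → x ∈ B₁ → x ∉ B₂ →
       ∃ λ y → y ∈ B₂ × y ∉ B₁ × ParallelBasis M e (exchange B₁ x y)
  go (outside ∷ B₁) (outside ∷ B₂) b₁ b₂ {suc x} (there x∈) x∉ =
    let y , y∈ , y∉ , b = basis-exchange M b₁ b₂ x∈ (x∉ ∘ there)
    in suc y , there y∈ , (λ { (there y∈) → y∉ y∈ }) , b
  go (inside ∷ B₁) (outside ∷ B₂) (e∉ , b₁) b₂ {zero} here x∉ =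
    let y , y∈ , y∉ , b = new-old B₁ B₂ e∉ b₁ b₂
    in suc y , there y∈ , (λ { (there y∈) → y∉ y∈ }) ,
       subst (λ B → Basis M (B ∪ ⁅ y ⁆)) (sym (p─⊥≡p B₁)) b
  go (inside ∷ B₁) (outside ∷ B₂) (e∉ , b₁) b₂ {suc x} (there x∈) x∉ =
    let y , y∈ , y∉ , b = basis-exchange M b₁ b₂ (∈∪ˡ e x∈) (x∉ ∘ there)
    in suc y , there y∈ , (λ { (there y∈) → y∉ (∈∪ˡ e y∈) }) ,
       (λ e∈ → [ (λ (e∈ , _) → e∉ e∈) , (λ e≡y → y∉ (subst (_∈ B₁ ∪ ⁅ e ⁆) e≡y (∈∪ʳ e))) ]′ (∈exchange⁻ B₁ x y e∈)) ,
       subst (Basis M) (exchange-∪ B₁ x y (λ { refl → e∉ x∈ })) b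
  go (outside ∷ B₁) (inside ∷ B₂) b₁ (e∉ , b₂) {suc x} (there x∈) x∉ with x Fin.≟ e
  ... | yes refl = zero , here , (λ ()) ,
        to-new B₁ x (λ (_ , e≢e) → e≢e refl) (subst (Basis M) (sym (exchange-self B₁ x∈)) b₁)
  ... | no x≢e with basis-exchange M b₁ b₂ x∈ ([ x∉ ∘ there , x≢e ]′ ∘ ∈∪⁅⁆⁻ B₂ e)
  ...   | y , y∈ , y∉ , b with ∈∪⁅⁆⁻ B₂ e y∈
  ...     | inj₁ y∈₂  = suc y , there y∈₂ , (λ { (there y∈) → y∉ y∈ }) , b
  ...     | inj₂ refl = zero , here , (λ ()) , to-new B₁ x (y∉ ∘ proj₁) b
  go (inside ∷ B₁) (inside ∷ B₂) (e∉₁ , b₁) (e∉₂ , b₂) {zero} here x∉ = contradiction here x∉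
  go (inside ∷ B₁) (inside ∷ B₂) (e∉₁ , b₁) (e∉₂ , b₂) {suc x} (there x∈) x∉ =
    let x≢e = λ x≡e → e∉₁ (subst (_∈ B₁) x≡e x∈)
        y , y∈ , y∉ , b = basis-exchange M b₁ b₂ (∈∪ˡ e x∈) ([ x∉ ∘ there , x≢e ]′ ∘ ∈∪⁅⁆⁻ B₂ e)
        y≢e = λ y≡e → y∉ (subst (_∈ B₁ ∪ ⁅ e ⁆) (sym y≡e) (∈∪ʳ e))
    in suc y , [ there , (λ y≡e → contradiction y≡e y≢e) ]′ (∈∪⁅⁆⁻ B₂ e y∈) ,
       (λ { (there y∈) → y∉ (∈∪ˡ e y∈) }) ,
       (λ e∈ → [ (λ (e∈ , _) → e∉₁ e∈) , (λ e≡y → y≢e (sym e≡y)) ]′ (∈exchange⁻ B₁ x y e∈)) ,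
       subst (Basis M) (exchange-∪ B₁ x y x≢e) b

parallelExtension : Matroid n → Fin n → Matroid (suc n)
parallelExtension M e .Basis                = ParallelBasis M e
parallelExtension M e .basis? (outside ∷ B) = basis? M B
parallelExtension M e .basis? (inside  ∷ B) = ¬? (e ∈? B) ×-dec basis? M (B ∪ ⁅ e ⁆)
parallelExtension M e .someBasis            = let B , b = someBasis M in outside ∷ B , b
parallelExtension M e .basis-exchange       = parallel-exchange M e

seriesExtension : Matroid n → Fin n → Matroid (suc n)
seriesExtension M e = dual (parallelExtension (dual M) e)

image : Permutation m n → Subset m → Subset n
image π B = tabulate λ j → lookup B (π ⟨$⟩ˡ j)

infix 4 _≅_

_≅_ : Matroid m → Matroid n → Set
_≅_ {m} {n} M N = ∃ λ (π : Permutation m n) → ∀ B → Basis M B ⇔ Basis N (image π B)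

-- SP M: M is obtained from U₁,₂ by series and parallel extensions.

data SP : Matroid n → Set₁ where
  U₁,₂     : SP (U 1 2 (s≤s z≤n))
  parallel : ∀ {M : Matroid n} e → SP M → SP (parallelExtension M e)
  series   : ∀ {M : Matroid n} e → SP M → SP (seriesExtension M e)
  relabel  : ∀ {M : Matroid m} {N : Matroid n} → M ≅ N → SP M → SP N

SeriesParallel : Matroid n → Set₁
SeriesParallel M = SP M ⊎ M ≅ U 0 1 z≤n ⊎ M ≅ U 1 1 (s≤s z≤n)

Independent Dependent Circuit : Matroid n → Pred (Subset n) 0ℓ
Independent M I = ∃ λ B → Basis M B × I ⊆ B
Dependent   M D = ¬ Independent M D
Circuit     M C = Dependent M C × (∀ D → D ⊂ C → Independent M D)

Paving SparsePaving : Matroid n → Set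
Paving M       = ∀ D → Dependent M D → rank M ℕ.≤ ∣ D ∣
SparsePaving M = Paving M × Paving (dual M)

Loop Coloop : Matroid n → Pred (Fin n) 0ℓ
Loop   M e = ∀ B → Basis M B → e ∉ B
Coloop M e = ∀ B → Basis M B → e ∈ B

-- The connected components are the classes of this equivalence relation.

Connected : Matroid n → Fin n → Fin n → Set
Connected M e f = e ≡ f ⊎ ∃ λ C → Circuit M C × e ∈ C × f ∈ C

independent? : (M : Matroid n) → Decidable (Independent M)
independent? M I = anySubset? λ B → basis? M B ×-dec (I ⊆? B)

circuit? : (M : Matroid n) → Decidable (Circuit M)
circuit? M C = ¬? (independent? M C) ×-dec
  map′ (λ ∄D D D⊂C → decidable-stable (independent? M D) λ ¬i → ∄D (D , D⊂C , ¬i))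
       (λ ∀D (D , D⊂C , ¬i) → ¬i (∀D D D⊂C))
       (¬? (anySubset? λ D → (D ⊂? C) ×-dec ¬? (independent? M D)))

connected? : (M : Matroid n) → ∀ e f → Dec (Connected M e f)
connected? M e f = (e Fin.≟ f) ⊎-dec
  anySubset? λ C → circuit? M C ×-dec (e ∈? C) ×-dec (f ∈? C)

-- deduplicate keeps one element of each class.

components : Matroid n → ℕ
components {n} M = length (deduplicate (connected? M) (allFin n))

-- Ground sets are finite sets of positive integers.  A matroid on E is a
-- matroid on Fin ∣ E ∣, whose element i stands for the i-th smallest element
-- of E.

record GroundSet : Set where
  field
    elements   : List ℕ
    increasing : Linked ℕ._<_ elements
    positive   : All (0 ℕ.<_) elements

  size : ℕ
  size = length elements

open GroundSet public using (size)

MatroidOn : GroundSet → Set₁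
MatroidOn E = Matroid (size E)

indicator : Subset n → ℝ^ n
indicator B e = if lookup B e then 1ᴿ else 0ᴿ

𝓟 : Matroid n → Pred (ℝ^ n) 0ℓ
𝓟 M = conv λ ((B , _) : ∃ (Basis M)) → indicator B

-- ∑ᵢ aᵢ 1_{𝓟 (Mᵢ)} = 0.  Constructively, real points cannot be decided to lie
-- in 𝓟 (Mᵢ), so the value of the indicator function at x is read off any
-- decision of x ∈ 𝓟 (Mᵢ).

𝟙 : {P : Set} → Dec P → ℤ
𝟙 p? = if does p? then 1ℤ else 0ℤ

PolytopeRelation : ∀ {s} → (Fin s → ℤ) → (Fin s → Matroid n) → Set
PolytopeRelation {n} a M = (x : ℝ^ n) (x∈? : ∀ i → Dec (𝓟 (M i) x)) →
  ∑ (λ i → a i ℤ.* 𝟙 (x∈? i)) ≡ 0ℤ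
  where open RawMonoidDefinitions ℤ.+-0-rawMonoid renaming (sum to ∑)

module _ {c ℓ} (A : AbelianGroup c ℓ) where
  open AbelianGroup A renaming (_∙_ to _+_; ε to 0#; _⁻¹ to -_)
  open RawMonoidDefinitions rawMonoid using () renaming (_×_ to _·ℕ_; sum to ∑)

  infixr 8 _·_

  _·_ : ℤ → Carrier → Carrier
  (ℤ.+ k)  · x = k ·ℕ x
  -[1+ k ] · x = - (suc k ·ℕ x)

  MatroidMap : Set (lsuc 0ℓ ⊔ c)
  MatroidMap = (E : GroundSet) → MatroidOn E → Carrier

  IsInvariant : MatroidMap → Set (lsuc 0ℓ ⊔ ℓ)
  IsInvariant f = ∀ E E′ (M : MatroidOn E) (M′ : MatroidOn E′) → M ≅ M′ → f E M ≈ f E′ M′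

  IsValuation : MatroidMap → Set (lsuc 0ℓ ⊔ ℓ)
  IsValuation f = ∀ {s} E (a : Fin s → ℤ) (M : Fin s → MatroidOn E) →
    PolytopeRelation a M → ∑ (λ i → a i · f E (M i)) ≈ 0#

  IsCovaluation : MatroidMap → Set (lsuc 0ℓ ⊔ ℓ)
  IsCovaluation f = IsValuation λ E M → (-1ℤ ℤ.^ components M) · f E M

-- The additive group of ℤ[t]: finitely supported coefficient sequences.

record ℤ[t] : Set where
  field
    coeff  : ℕ → ℤ
    finite : ∃ λ d → ∀ i → d ℕ.≤ i → coeff i ≡ 0ℤ

open ℤ[t] public using (coeff)
open ℤ[t]

0ₜ : ℤ[t]
coeff  0ₜ _ = 0ℤ
finite 0ₜ   = 0 , λ _ _ → refl

t^_ : ℕ → ℤ[t]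
coeff  (t^ k) i = if does (i ℕ.≟ k) then 1ℤ else 0ℤ
finite (t^ k)   = suc k , λ i k<i → cong (if_then 1ℤ else 0ℤ) (dec-false (i ℕ.≟ k) (ℕ.>⇒≢ k<i))

_+ₜ_ : ℤ[t] → ℤ[t] → ℤ[t]
coeff  (p +ₜ q) i = coeff p i ℤ.+ coeff q i
finite (p +ₜ q)   =
  let d₁ , p≡0 = finite p
      d₂ , q≡0 = finite q
  in d₁ ℕ.⊔ d₂ , λ i d≤i → cong₂ ℤ._+_ (p≡0 i (ℕ.m⊔n≤o⇒m≤o d₁ d₂ d≤i)) (q≡0 i (ℕ.m⊔n≤o⇒n≤o d₁ d₂ d≤i))

-ₜ_ : ℤ[t] → ℤ[t]
coeff  (-ₜ p) i = ℤ.- coeff p i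
finite (-ₜ p)   = let d , p≡0 = finite p in d , λ i d≤i → cong ℤ.-_ (p≡0 i d≤i)

ℤ[t]-abelianGroup : AbelianGroup 0ℓ 0ℓ
ℤ[t]-abelianGroup = record
  { Carrier = ℤ[t]
  ; _≈_     = λ p q → ∀ i → coeff p i ≡ coeff q i
  ; _∙_     = _+ₜ_
  ; ε       = 0ₜ
  ; _⁻¹     = -ₜ_
  ; isAbelianGroup = record
    { isGroup = record
      { isMonoid = record
        { isSemigroup = record
          { isMagma = record
            { isEquivalence = record
              { refl  = λ _ → refl
              ; sym   = λ p≈q i → sym (p≈q i)
              ; trans = λ p≈q q≈r i → trans (p≈q i) (q≈r i)
              }
            ; ∙-cong = λ p≈q r≈s i → cong₂ ℤ._+_ (p≈q i) (r≈s i)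
            }
          ; assoc = λ p q r i → ℤ.+-assoc (coeff p i) (coeff q i) (coeff r i)
          }
        ; identity = (λ p i → ℤ.+-identityˡ (coeff p i)) , (λ p i → ℤ.+-identityʳ (coeff p i))
        }
      ; inverse = (λ p i → ℤ.+-inverseˡ (coeff p i)) , (λ p i → ℤ.+-inverseʳ (coeff p i))
      ; ⁻¹-cong = λ p≈q i → cong ℤ.-_ (p≈q i)
      }
    ; comm = λ p q i → ℤ.+-comm (coeff p i) (coeff q i)
    }
  }

open AbelianGroup ℤ[t]-abelianGroup using () renaming (_≈_ to _≈ₜ_)

-- The properties that determine g uniquely.

record IsSpeyerPolynomial (g : MatroidMap ℤ[t]-abelianGroup) : Set₁ where
  field
    invariant       : IsInvariant ℤ[t]-abelianGroup g
    covaluative     : IsCovaluation ℤ[t]-abelianGroup g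
    loop-or-coloop  : ∀ E (M : MatroidOn E) → ∃ (Loop M) ⊎ ∃ (Coloop M) → g E M ≈ₜ 0ₜ
    series-parallel : ∀ E (M : MatroidOn E) → ¬ ∃ (Loop M) → ¬ ∃ (Coloop M) →
                      ∀ (Ms : List (∃ Matroid)) → All (SeriesParallel ∘ proj₂) Ms →
                      M ≅ ⨁ Ms → g E M ≈ₜ (t^ length Ms)

NonNegativeCoefficients : ℤ[t] → Set
NonNegativeCoefficients p = ∀ i → 0ℤ ℤ.≤ coeff p i

{-# OPTIONS --safe #-}
module Submission where

-- The map v(M) = (-1)^c(M) g_M is a valuation.  Relaxing a circuit-hyperplane H of
-- a sparse paving matroid M of rank k on n elements gives a matroid M′ with
-- 𝓟 M′ = 𝓟 M ∪ 𝓟 T and 𝓟 M ∩ 𝓟 T = 𝓟 S, where the bases of S are the neighbours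
-- H − h + b of H and those of T are H and its neighbours.  As T is series-parallel
-- and S is isomorphic to U₁,ₙ₋ₖ ⊕ Uₖ₋₁,ₖ, this yields v(M) = v(M′) + t + t², so that
-- v(M) = v(Uₖ,ₙ) + l (t + t²) if M has l circuit-hyperplanes.
--
-- Cutting the hypersimplex along the hyperplanes on which the coordinates of a final
-- segment have a prescribed integral sum subdivides it into the polytopes of lattice
-- path matroids that are sums of series-parallel matroids, whence the coefficients of
-- −v(Uₖ,ₙ) count certain words by their number of cuts.  Deleting and contracting an
-- element shows that l is subject to the recursion that these numbers satisfy, and so
-- −v(M) has non-negative coefficients.  Finally g_M = −v(M), because M is connected
-- unless it has a loop or a coloop or is isomorphic to U₁,₂ ⊕ U₁,₂.

open import Defs
open import Algebra.Bundles using (AbelianGroup)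
import Algebra.Definitions.RawMonoid as RawMonoidDefinitions
open import Data.Bool.Base using (Bool; true; false; if_then_else_; not)
import Data.Bool.Properties as Bool
open import Data.Empty using () renaming (⊥ to Void)
open import Data.Fin.Base as Fin using (Fin; zero; suc; _↑ˡ_; _↑ʳ_; splitAt)
open import Data.Fin.Permutation as Perm using (Permutation; _⟨$⟩ʳ_; _⟨$⟩ˡ_; permutation)
import Data.Fin.Properties as Fin
open import Data.Fin.Subset using (Subset; ∣_∣; _∈_; _∉_; _⊆_; _⊂_; inside; outside; ⁅_⁆; _∪_; _∩_; _-_; ∁; ⊥; ⊤; ⋃)
open import Data.Fin.Subset.Properties using (_∈?_; p─⊥≡p; ∪-identityʳ; ∉⊥; ∈⊤; ∣p∣≤n; ∣⊥∣≡0; ∣⊤∣≡n; ∣∁p∣≡n∸∣p∣; ∣p∣≡n⇒p≡⊤; ∣p∩q∣≤∣q∣; drop-∷-⊆; p⊆q⇒∣p∣≤∣q∣; p⊂q⇒∣p∣<∣q∣; p∩q⊆p; p∩q⊆q; x∈p∩q⁺; x∈p∩q⁻; x∈p∪q⁻; x∉p⇒x∈∁p; x∈∁p⇒x∉p; x∉∁p⇒x∈p; x∈p⇒x∉∁p; ⊆-antisym)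
open import Data.Integer.Base as ℤ using (ℤ; +_; -1ℤ; 0ℤ; 1ℤ)
import Data.Integer.Properties as ℤ
open import Data.Integer.Solver using () renaming (module +-*-Solver to ℤS)
open import Data.List.Base as List using (List; []; _∷_; length; map; allFin; deduplicate; upTo; _++_)
import Data.List.Membership.DecPropositional as DecMembership
open import Data.List.Membership.Propositional using (lose) renaming (_∈_ to _∈ᴸ_; _∉_ to _∉ᴸ_)
import Data.List.Membership.Propositional.Properties as List∈
open import Data.List.Membership.Propositional.Properties.WithK using (unique∧set⇒bag)
import Data.List.Properties as List
open import Data.List.Relation.Binary.BagAndSetEquality using (∼bag⇒↭)
open import Data.List.Relation.Binary.Permutation.Propositional.Properties using (↭-length)
open import Data.List.Relation.Unary.All as All using (All; []; _∷_)
import Data.List.Relation.Unary.All.Properties as All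
open import Data.List.Relation.Unary.AllPairs as AllPairs using (AllPairs; []; _∷_)
import Data.List.Relation.Unary.AllPairs.Properties as AllPairs
open import Data.List.Relation.Unary.Any using (here; there)
import Data.List.Relation.Unary.Any.Properties as Any
open import Data.List.Relation.Unary.Unique.Propositional using (Unique)
import Data.List.Relation.Unary.Unique.Propositional.Properties as Unique
open import Data.Nat.Base as ℕ using (ℕ; zero; suc; z≤n; s≤s; _≤_; _<_)
open import Data.Nat.ListAction using (sum)
import Data.Nat.Properties as ℕ
open import Data.Product.Base using (∃; ∃₂; _×_; _,_; proj₁; proj₂)
open import Data.Rational.Base as ℚ using (ℚ; 0ℚ; 1ℚ)
import Data.Rational.Properties as ℚ
open import Data.Rational.Solver using (module +-*-Solver)
open import Data.Sum.Base as Sum using (_⊎_; inj₁; inj₂; [_,_]′)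
open import Data.Unit.Base using (tt) renaming (⊤ to Unit)
open import Data.Vec.Base as Vec using (Vec; []; _∷_; lookup; tabulate; _[_]≔_; here; there; take; drop) renaming (_++_ to _++ᵛ_)
import Data.Vec.Functional as Vector
import Data.Vec.Properties as Vec
open import Function.Base using (_∘_; id)
open import Function.Bundles using (mk⇔; _⇔_; Equivalence)
open import Relation.Binary.Definitions using (tri<; tri≈; tri>)
open import Relation.Binary.PropositionalEquality hiding (_≗_)
open import Relation.Nullary.Decidable using (Dec; yes; no; does; _×-dec_; _⊎-dec_; ¬?; decidable-stable; dec-true; dec-false)
open import Relation.Nullary.Negation using (¬_; contradiction)

-- A cut adds a component, so the sign (-1)^c cancels the sign with which inclusion-exclusion
-- subtracts the common face. All words therefore count positively, and the value on a uniform
-- matroid involves no cancellation. The two kinds of subdivision are reached differently. Lattice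
-- path polytopes are given by bounds on sums over final segments, and their subdivisions are read
-- off these bounds. A relaxation is treated without inequalities for the polytope: points are
-- rewritten by the identity e_H + e_B = e_(H-h+b) + e_(B-b+h), which moves weight from H to its
-- neighbours. The term t + t² is -v(T) + v(S), as T has one component and S has two.
-- Circuit-hyperplanes thus lower g only in degrees 1 and 2, and non-negativity amounts to bounding
-- their number by the number of words without cuts and of words with one cut. The second bound
-- fails for two disjoint pairs in a set of four elements, which is why U₁,₂ ⊕ U₁,₂ stands apart.

-- Order and linear arithmetic of real numbers

module Reals where

  open +-*-Solver

  -- A real number behind a constructor, so that Agda compares terms by their shape
  -- instead of unfolding Cauchy sequences.

  record R : Set where
    no-eta-equality
    constructor ⌊_⌋
    field val : ℝ
  open R

  app : R → ℕ → ℚ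
  app x = seq (val x)

  infixl 6 _⊞_ _⊟_

  _⊞_ : R → R → R
  val (x ⊞ y) = val x +ᴿ val y

  𝟎 : R
  val 𝟎 = 0ᴿ

  _⊟_ : R → R → R
  seq    (val (x ⊟ y)) i = app x i ℚ.- app y i
  cauchy (val (x ⊟ y)) ε 0<ε = let N , p = cauchy (val x +ᴿ y′) ε 0<ε in N , p
    where
    y′ : ℝ
    seq    y′ i = ℚ.- app y i
    cauchy y′ ε 0<ε = let N , p = cauchy (val y) ε 0<ε in N , λ i j N≤i N≤j →
      subst (ℚ._≤ ε) (cong ℚ.∣_∣ (solve 2 (λ p q → p :- q := (:- q) :- (:- p)) refl (app y j) (app y i)))
        (p j i N≤j N≤i)

  private variable
    m n : ℕ
    a b c d u v w x y z : R

  -- Wrapping the order and the equality in records lets Agda infer the two sides.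

  infix 4 _≼_ _≋_

  record _≼_ (x y : R) : Set where
    constructor ≼-intro
    field ≼-elim : val x ≤ᴿ val y
  open _≼_

  record _≋_ (x y : R) : Set where
    constructor ≋-intro
    field ≋-elim : val x ≈ᴿ val y
  open _≋_

  diff : R → R → ℕ → ℚ
  diff x y i = app x i ℚ.- app y i

  -- Each linear (in)equality below is a sum of known ones, up to moving terms
  -- across; the solver checks this on the rational approximations.

  ≼-by : a ≼ b → (∀ i → diff d c i ≡ diff b a i) → c ≼ d
  ≼-by {a} {b} {d} {c} (≼-intro a≤b) eq = ≼-intro λ ε 0<ε →
    let N , p = a≤b ε 0<ε in N , λ i N≤i → begin
    app c i                                       ≡⟨ solve 2 (λ c d → c := d :- (d :- c)) refl (app c i) (app d i) ⟩
    app d i ℚ.- (app d i ℚ.- app c i)             ≡⟨ cong (λ δ → app d i ℚ.- δ) (eq i) ⟩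
    app d i ℚ.- (app b i ℚ.- app a i)             ≡⟨ solve 3 (λ d b a → d :- (b :- a) := a :+ (d :- b)) refl (app d i) (app b i) (app a i) ⟩
    app a i ℚ.+ (app d i ℚ.- app b i)             ≤⟨ ℚ.+-monoˡ-≤ (app d i ℚ.- app b i) (p i N≤i) ⟩
    (app b i ℚ.+ ε) ℚ.+ (app d i ℚ.- app b i)     ≡⟨ solve 3 (λ d b ε → (b :+ ε) :+ (d :- b) := d :+ ε) refl (app d i) (app b i) ε ⟩
    app d i ℚ.+ ε                                 ∎
    where open ℚ.≤-Reasoning

  ≼-+ : a ≼ b → c ≼ d → a ⊞ c ≼ b ⊞ d
  ≼-+ {a} {b} {c} {d} (≼-intro a≤b) (≼-intro c≤d) = ≼-intro λ ε 0<ε →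
    let N₁ , p = a≤b (ℚ.½ ℚ.* ε) (half-pos 0<ε)
        N₂ , q = c≤d (ℚ.½ ℚ.* ε) (half-pos 0<ε)
        open ℚ.≤-Reasoning
    in N₁ ℕ.⊔ N₂ , λ i N≤i → begin
      app a i ℚ.+ app c i                              ≤⟨ ℚ.+-mono-≤ (p i (ℕ.m⊔n≤o⇒m≤o N₁ N₂ N≤i)) (q i (ℕ.m⊔n≤o⇒n≤o N₁ N₂ N≤i)) ⟩
      (app b i ℚ.+ ℚ.½ ℚ.* ε) ℚ.+ (app d i ℚ.+ ℚ.½ ℚ.* ε)
        ≡⟨ solve 3 (λ q s h → (q :+ h) :+ (s :+ h) := (q :+ s) :+ (h :+ h)) refl (app b i) (app d i) (ℚ.½ ℚ.* ε) ⟩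
      (app b i ℚ.+ app d i) ℚ.+ (ℚ.½ ℚ.* ε ℚ.+ ℚ.½ ℚ.* ε) ≡⟨ cong ((app b i ℚ.+ app d i) ℚ.+_) (halves ε) ⟩
      (app b i ℚ.+ app d i) ℚ.+ ε                      ∎

  ≼-pw : (∀ i → app x i ≡ app y i) → x ≼ y
  ≼-pw {x} {y} eq = ≼-intro λ ε 0<ε → 0 , λ i _ → begin
    app x i          ≡⟨ eq i ⟩
    app y i          ≡⟨ ℚ.+-identityʳ (app y i) ⟨
    app y i ℚ.+ 0ℚ   ≤⟨ ℚ.+-monoʳ-≤ (app y i) (ℚ.<⇒≤ 0<ε) ⟩
    app y i ℚ.+ ε    ∎
    where open ℚ.≤-Reasoning

  ≼-refl : x ≼ x
  ≼-refl = ≼-pw λ _ → refl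

  ≼-trans : x ≼ y → y ≼ z → x ≼ z
  ≼-trans {x} {y} {z} x≤y y≤z = ≼-by (≼-+ x≤y y≤z) λ i →
    solve 3 (λ x y z → z :- x := (y :+ z) :- (x :+ y)) refl (app x i) (app y i) (app z i)

  ≼-antisym : x ≼ y → y ≼ x → x ≋ y
  ≼-antisym {x} {y} (≼-intro x≤y) (≼-intro y≤x) = ≋-intro λ ε 0<ε →
    let N₁ , p = x≤y ε 0<ε
        N₂ , q = y≤x ε 0<ε
    in N₁ ℕ.⊔ N₂ , λ i N≤i →
       abs ε (app x i) (app y i) (p i (ℕ.m⊔n≤o⇒m≤o N₁ N₂ N≤i)) (q i (ℕ.m⊔n≤o⇒n≤o N₁ N₂ N≤i))
    where
    shift : ∀ ε p q → p ℚ.≤ q ℚ.+ ε → p ℚ.- q ℚ.≤ ε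
    shift ε p q p≤ = ℚ.≤-trans (ℚ.+-monoˡ-≤ (ℚ.- q) p≤)
      (ℚ.≤-reflexive (solve 2 (λ q ε → (q :+ ε) :- q := ε) refl q ε))
    abs : ∀ ε p q → p ℚ.≤ q ℚ.+ ε → q ℚ.≤ p ℚ.+ ε → ℚ.∣ p ℚ.- q ∣ ℚ.≤ ε
    abs ε p q p≤ q≤ with ℚ.∣p∣≡p∨∣p∣≡-p (p ℚ.- q)
    ... | inj₁ eq = subst (ℚ._≤ ε) (sym eq) (shift ε p q p≤)
    ... | inj₂ eq = subst (ℚ._≤ ε) (sym (trans eq (solve 2 (λ p q → :- (p :- q) := q :- p) refl p q))) (shift ε q p q≤)

  ≋-sym : x ≋ y → y ≋ x
  ≋-sym {x} {y} (≋-intro x≈y) = ≋-intro λ ε 0<ε → let N , p = x≈y ε 0<ε in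
    N , λ i N≤i → subst (ℚ._≤ ε)
      (trans (sym (ℚ.∣-p∣≡∣p∣ (app x i ℚ.- app y i)))
        (cong ℚ.∣_∣ (solve 2 (λ p q → :- (p :- q) := q :- p) refl (app x i) (app y i))))
      (p i N≤i)

  ∣p-q∣≤⇒p≤q+ : ∀ p q {ε} → ℚ.∣ p ℚ.- q ∣ ℚ.≤ ε → p ℚ.≤ q ℚ.+ ε
  ∣p-q∣≤⇒p≤q+ p q {ε} p-q≤ε = begin
    p                          ≡⟨ solve 2 (λ x y → x := y :+ (x :- y)) refl p q ⟩
    q ℚ.+ (p ℚ.- q)            ≤⟨ ℚ.+-monoʳ-≤ q (p≤∣p∣ (p ℚ.- q)) ⟩
    q ℚ.+ ℚ.∣ p ℚ.- q ∣        ≤⟨ ℚ.+-monoʳ-≤ q p-q≤ε ⟩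
    q ℚ.+ ε                    ∎
    where
    open ℚ.≤-Reasoning
    p≤∣p∣ : ∀ p → p ℚ.≤ ℚ.∣ p ∣
    p≤∣p∣ p with ℚ.≤-total 0ℚ p
    ... | inj₁ 0≤p = ℚ.≤-reflexive (sym (ℚ.0≤p⇒∣p∣≡p 0≤p))
    ... | inj₂ p≤0 = ℚ.≤-trans p≤0 (ℚ.0≤∣p∣ p)

  ≋⇒≼ : x ≋ y → x ≼ y
  ≋⇒≼ {x} {y} (≋-intro x≈y) = ≼-intro λ ε 0<ε → let N , p = x≈y ε 0<ε in
    N , λ i N≤i → ∣p-q∣≤⇒p≤q+ (app x i) (app y i) (p i N≤i)

  ≋⇒≽ : x ≋ y → y ≼ x
  ≋⇒≽ = ≋⇒≼ ∘ ≋-sym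

  ≋-pw : (∀ i → app x i ≡ app y i) → x ≋ y
  ≋-pw eq = ≼-antisym (≼-pw eq) (≼-pw (sym ∘ eq))

  ≋-by : a ≋ b → (∀ i → diff d c i ≡ diff b a i) → c ≋ d
  ≋-by {a} {b} {d} {c} a≈b eq = ≼-antisym (≼-by (≋⇒≼ a≈b) eq) (≼-by (≋⇒≽ a≈b) λ i → begin
      app c i ℚ.- app d i          ≡⟨ swap (app c i) (app d i) ⟩
      ℚ.- (app d i ℚ.- app c i)    ≡⟨ cong ℚ.-_ (eq i) ⟩
      ℚ.- (app b i ℚ.- app a i)    ≡⟨ swap (app a i) (app b i) ⟨
      app a i ℚ.- app b i          ∎)
    where
    open ≡-Reasoning
    swap : ∀ p q → p ℚ.- q ≡ ℚ.- (q ℚ.- p)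
    swap = solve 2 (λ p q → p :- q := :- (q :- p)) refl

  ≋-refl : x ≋ x
  ≋-refl = ≋-pw λ _ → refl

  ≋-trans : x ≋ y → y ≋ z → x ≋ z
  ≋-trans p q = ≼-antisym (≼-trans (≋⇒≼ p) (≋⇒≼ q)) (≼-trans (≋⇒≽ q) (≋⇒≽ p))

  ≋-+ : a ≋ b → c ≋ d → a ⊞ c ≋ b ⊞ d
  ≋-+ p q = ≼-antisym (≼-+ (≋⇒≼ p) (≋⇒≼ q)) (≼-+ (≋⇒≽ p) (≋⇒≽ q))

  -- At precision ε, compare the approximations at a late index N.
  ≼-total : ¬ (y ≼ x) → x ≼ y
  ≼-total {y} {x} ¬y≤x = ≼-intro λ ε 0<ε →
    -- `η` is a quarter of `ε`. If the values at `N` differ by at most `η + η`, moving both to the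
    -- index `i` costs another `η + η`, in all `ε`. Otherwise the gap `η + η` pays for both moves,
    -- and `y ≼ x` results without any error.
    let η = ℚ.½ ℚ.* (ℚ.½ ℚ.* ε)
        0<η = half-pos (half-pos 0<ε)
        N₁ , p = cauchy (val x) η 0<η
        N₂ , q = cauchy (val y) η 0<η
        N = N₁ ℕ.⊔ N₂
        fx = λ i N≤i → p i N (ℕ.m⊔n≤o⇒m≤o N₁ N₂ N≤i) (ℕ.m≤m⊔n N₁ N₂)
        fx′ = λ i N≤i → p N i (ℕ.m≤m⊔n N₁ N₂) (ℕ.m⊔n≤o⇒m≤o N₁ N₂ N≤i)
        fy = λ i N≤i → q i N (ℕ.m⊔n≤o⇒n≤o N₁ N₂ N≤i) (ℕ.m≤n⊔m N₁ N₂)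
        fy′ = λ i N≤i → q N i (ℕ.m≤n⊔m N₁ N₂) (ℕ.m⊔n≤o⇒n≤o N₁ N₂ N≤i)
        ε≡ : η ℚ.+ η ℚ.+ (η ℚ.+ η) ≡ ε
        ε≡ = trans (cong₂ ℚ._+_ (halves (ℚ.½ ℚ.* ε)) (halves (ℚ.½ ℚ.* ε))) (halves ε)
        open ℚ.≤-Reasoning
    in N , λ i N≤i → [ (λ xN≤ → begin
        app x i                                       ≤⟨ ∣p-q∣≤⇒p≤q+ (app x i) (app x N) (fx i N≤i) ⟩
        app x N ℚ.+ η                                 ≤⟨ ℚ.+-monoˡ-≤ η xN≤ ⟩
        app y N ℚ.+ (η ℚ.+ η) ℚ.+ η                   ≤⟨ ℚ.+-monoˡ-≤ η (ℚ.+-monoˡ-≤ (η ℚ.+ η) (∣p-q∣≤⇒p≤q+ (app y N) (app y i) (fy′ i N≤i))) ⟩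
        app y i ℚ.+ η ℚ.+ (η ℚ.+ η) ℚ.+ η             ≡⟨ solve 2 (λ y η → y :+ η :+ (η :+ η) :+ η := y :+ (η :+ η :+ (η :+ η))) refl (app y i) η ⟩
        app y i ℚ.+ (η ℚ.+ η ℚ.+ (η ℚ.+ η))           ≡⟨ cong (app y i ℚ.+_) ε≡ ⟩
        app y i ℚ.+ ε                                 ∎)
      , (λ ≤xN → contradiction (≼-intro λ δ 0<δ → N , λ j N≤j → begin
        app y j                                       ≤⟨ ∣p-q∣≤⇒p≤q+ (app y j) (app y N) (fy j N≤j) ⟩
        app y N ℚ.+ η                                 ≡⟨ solve 2 (λ y η → y :+ η := (y :+ (η :+ η)) :- η) refl (app y N) η ⟩
        app y N ℚ.+ (η ℚ.+ η) ℚ.- η                   ≤⟨ ℚ.+-monoˡ-≤ (ℚ.- η) ≤xN ⟩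
        app x N ℚ.- η                                 ≤⟨ ℚ.+-monoˡ-≤ (ℚ.- η) (∣p-q∣≤⇒p≤q+ (app x N) (app x j) (fx′ j N≤j)) ⟩
        app x j ℚ.+ η ℚ.- η                           ≡⟨ solve 2 (λ x η → x :+ η :- η := x :+ con 0ℚ) refl (app x j) η ⟩
        app x j ℚ.+ 0ℚ                                ≤⟨ ℚ.+-monoʳ-≤ (app x j) (ℚ.<⇒≤ 0<δ) ⟩
        app x j ℚ.+ δ                                 ∎) ¬y≤x)
      ]′ (ℚ.≤-total (app x N) (app y N ℚ.+ (η ℚ.+ η)))

  -- Real numbers cannot be compared constructively, but since PolytopeRelation supplies
  -- decisions, points need only be located up to double negation.
  ¬¬_ : Set → Set
  ¬¬ A = ¬ ¬ A

  _>>=_ : {A B : Set} → ¬¬ A → (A → ¬¬ B) → ¬¬ B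
  (m >>= f) k = m λ a → f a k

  pure : {A : Set} → A → ¬¬ A
  pure a k = k a

  compare : ∀ x y → ¬¬ (x ≼ y ⊎ y ≼ x)
  compare x y k = k (inj₁ (≼-total (k ∘ inj₂)))

  infixr 7 _⊠_
  _⊠_ : ℕ → R → R
  zero  ⊠ x = 𝟎
  suc m ⊠ x = x ⊞ m ⊠ x

  R^ : ℕ → Set
  R^ n = Fin n → R

open Reals

-- Cones over indicator vectors; at weight one, base polytopes

module Cones where

  open +-*-Solver

  private variable
    n : ℕ
    a b u w w′ : R
    x x′ y z : R^ n
    Q Q′ : Subset n → Set

  #0 : ∀ {k} → Polynomial k
  #0 = con 0ℚ

  infix 4 _≗_
  _≗_ : R^ n → R^ n → Set
  x ≗ y = ∀ e → x e ≋ y e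

  infixl 6 _+ⁿ_
  _+ⁿ_ : R^ n → R^ n → R^ n
  (x +ⁿ y) e = x e ⊞ y e

  0ⁿ : R^ n
  0ⁿ _ = 𝟎

  χ : R → Subset n → R^ n
  χ u B e = if lookup B e then u else 𝟎

  -- Cone Q w x: x is a non-negative combination, of total weight w, of indicator
  -- vectors of members of Q.

  data Cone {n} (Q : Subset n → Set) : R → R^ n → Set where
    nil  : ∀ {w x} → w ≋ 𝟎 → x ≗ 0ⁿ → Cone Q w x
    cons : ∀ {w x u w′ x′} B → 𝟎 ≼ u → Q B → w ≋ u ⊞ w′ → x ≗ χ u B +ⁿ x′ →
           Cone Q w′ x′ → Cone Q w x

  cone-≋ : w ≋ w′ → x ≗ x′ → Cone Q w x → Cone Q w′ x′
  cone-≋ w≋ x≋ (nil w≋0 x≋0) = nil (≋-trans (≋-sym w≋) w≋0) λ e → ≋-trans (≋-sym (x≋ e)) (x≋0 e)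
  cone-≋ w≋ x≋ (cons B 0≤u q eq eqs C) =
    cons B 0≤u q (≋-trans (≋-sym w≋) eq) (λ e → ≋-trans (≋-sym (x≋ e)) (eqs e)) C

  cone-map : (∀ {B} → Q B → Q′ B) → Cone Q w x → Cone Q′ w x
  cone-map f (nil w≋0 x≋0)         = nil w≋0 x≋0
  cone-map f (cons B 0≤u q eq eqs C) = cons B 0≤u (f q) eq eqs (cone-map f C)

  assoc : ∀ {p q r s t} → p ≋ q ⊞ r → s ≋ r ⊞ t → p ⊞ t ≋ q ⊞ s
  assoc {p} {q} {r} {s} {t} eq eq′ = ≋-by (≋-+ eq (≋-sym eq′)) λ i →
    solve 5 (λ p q r s t → (q :+ s) :- (p :+ t) := ((q :+ r) :+ s) :- (p :+ (r :+ t))) refl (app p i) (app q i) (app r i) (app s i) (app t i)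

  zero-+ : ∀ {p q} → p ≋ 𝟎 → q ≋ p ⊞ q
  zero-+ {p} {q} eq = ≋-by (≋-sym eq) λ i →
    solve 2 (λ p q → (p :+ q) :- q := p :- #0) refl (app p i) (app q i)

  cone-+ : Cone Q a x → Cone Q b y → Cone Q (a ⊞ b) (x +ⁿ y)
  cone-+ (nil w≋0 x≋0) D = cone-≋ (zero-+ w≋0) (λ e → zero-+ (x≋0 e)) D
  cone-+ (cons B 0≤u q eq eqs C) D =
    cons B 0≤u q (assoc eq ≋-refl) (λ e → assoc (eqs e) ≋-refl) (cone-+ C D)

  cone-single : ∀ {B} → 𝟎 ≼ w → Q B → Cone Q w (χ w B)
  cone-single {w = w} {B = B} 0≤w q =
    cons B 0≤w q (right w) (λ e → right (χ w B e)) (nil (≋-refl {𝟎}) λ e → ≋-refl {𝟎})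
    where
    right : ∀ p → p ≋ p ⊞ 𝟎
    right p = ≋-pw λ i → solve 1 (λ p → p := p :+ #0) refl (app p i)

  χ-bounds : ∀ (B : Subset n) → 𝟎 ≼ u → ∀ e → 𝟎 ≼ χ u B e × χ u B e ≼ u
  χ-bounds B 0≤u e with lookup B e
  ... | true  = 0≤u , ≼-refl
  ... | false = ≼-refl , 0≤u

  0≼+ : ∀ {p q} → 𝟎 ≼ p → 𝟎 ≼ q → 𝟎 ≼ p ⊞ q
  0≼+ {p} {q} 0≤p 0≤q = ≼-by (≼-+ 0≤p 0≤q) λ i →
    solve 2 (λ p q → (p :+ q) :- #0 := (p :+ q) :- (#0 :+ #0)) refl (app p i) (app q i)

  cone-0≤ : Cone Q w x → 𝟎 ≼ w
  cone-0≤ (nil w≋0 _)           = ≋⇒≽ w≋0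
  cone-0≤ (cons B 0≤u q eq _ C) = ≼-trans (0≼+ 0≤u (cone-0≤ C)) (≋⇒≽ eq)

  cone-bounds : Cone Q w x → ∀ e → 𝟎 ≼ x e × x e ≼ w
  cone-bounds (nil w≋0 x≋0) e = ≋⇒≽ (x≋0 e) , ≋⇒≼ (≋-trans (x≋0 e) (≋-sym w≋0))
  cone-bounds (cons B 0≤u q eq eqs C) e =
    let 0≤χ , χ≤u = χ-bounds B 0≤u e
        0≤x , x≤w = cone-bounds C e
    in ≼-trans (0≼+ 0≤χ 0≤x) (≋⇒≽ (eqs e)) ,
       ≼-trans (≋⇒≼ (eqs e)) (≼-trans (≼-+ χ≤u x≤w) (≋⇒≽ eq))

  -- Non-negative terms of total weight at most zero all vanish, so the set they come from is
  -- immaterial. This is how sets that violate a bound are discarded.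
  cone-null : w ≼ 𝟎 → Cone Q w x → Cone Q′ w x
  cone-null w≤0 C = nil (≼-antisym w≤0 (cone-0≤ C)) λ e →
    let 0≤x , x≤w = cone-bounds C e in ≼-antisym (≼-trans x≤w w≤0) 0≤x

  cone-∷ : ∀ {x : R^ n} {y : R^ (suc n)} {Q′ : Subset (suc n) → Set} s → (∀ {B} → Q B → Q′ (s ∷ B)) →
           y zero ≋ (if s then w else 𝟎) → (∀ e → y (suc e) ≋ x e) → Cone Q w x → Cone Q′ w y
  cone-∷ s f eq eqs (nil w≋0 x≋0) = nil w≋0
    λ { zero → ≋-trans eq (bit s w≋0) ; (suc e) → ≋-trans (eqs e) (x≋0 e) }
    where
    bit : ∀ s {p} → p ≋ 𝟎 → (if s then p else 𝟎) ≋ 𝟎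
    bit true  p≋0 = p≋0
    bit false p≋0 = ≋-refl
  cone-∷ s f eq eqs (cons {w} {x} {u} {w′} {x′} B 0≤u q eq′ eqs′ C) =
    cons (s ∷ B) 0≤u (f q) eq′ split
      (cone-∷ {y = λ { zero → if s then w′ else 𝟎 ; (suc e) → x′ e }} s f ≋-refl (λ e → ≋-refl) C)
    where
    bit : ∀ s → (if s then w else 𝟎) ≋ (if s then u else 𝟎) ⊞ (if s then w′ else 𝟎)
    bit true  = eq′
    bit false = ≋-pw λ i → refl
    split : ∀ e → _
    split zero    = ≋-trans eq (bit s)
    split (suc e) = ≋-trans (eqs e) (eqs′ e)

  ≼⇒0≼- : ∀ {p q} → p ≼ q → 𝟎 ≼ q ⊟ p
  ≼⇒0≼- {p} {q} p≤q = ≼-by p≤q λ i →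
    solve 2 (λ p q → (q :- p) :- #0 := q :- p) refl (app p i) (app q i)

  χ-+ : ∀ (B : Subset n) → u ≋ a ⊞ b → χ u B ≗ χ a B +ⁿ χ b B
  χ-+ B eq e with lookup B e
  ... | true  = eq
  ... | false = ≋-pw λ _ → refl

  record Split {n} (Q : Subset n → Set) (a b : R) (x : R^ n) : Set where
    constructor split-into
    field
      {left right} : R^ n
      sum≋  : x ≗ left +ⁿ right
      coneˡ : Cone Q a left
      coneʳ : Cone Q b right

  -- Terms are moved to the left part until its weight is exhausted.
  cone-split : 𝟎 ≼ a → 𝟎 ≼ b → w ≋ a ⊞ b → Cone Q w x → ¬¬ Split Q a b x
  cone-split {a = a} {b} {w} 0≤a 0≤b w≋ (nil w≋0 x≋0) =
    pure (split-into {left = 0ⁿ} {0ⁿ} (λ e → ≋-trans (x≋0 e) (≋-pw λ _ → refl))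
      (nil (≼-antisym (≼-by (≼-+ (≋⇒≼ (≋-trans (≋-sym w≋) w≋0)) 0≤b) λ i → solve 2 (λ a b → #0 :- a := (#0 :+ b) :- (a :+ b :+ #0)) refl (app a i) (app b i)) 0≤a) λ e → ≋-refl)
      (nil (≼-antisym (≼-by (≼-+ (≋⇒≼ (≋-trans (≋-sym w≋) w≋0)) 0≤a) λ i → solve 2 (λ a b → #0 :- b := (#0 :+ a) :- (a :+ b :+ #0)) refl (app a i) (app b i)) 0≤b) λ e → ≋-refl))
  cone-split {a = a} {b} {w} 0≤a 0≤b w≋ (cons {w} {x} {u} {w′} {x′} B 0≤u q eq eqs C) = compare a u >>= λ
    -- The term at which the weight `a` runs out is itself divided into `a` and `u ⊟ a`.
    { (inj₁ a≤u) → pure (split-into {left = χ a B} {χ (u ⊟ a) B +ⁿ x′}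
      (λ e → ≋-trans (eqs e) (shift (χ-+ B (minus u a) e)))
      (cone-single 0≤a q)
      (cons B (≼⇒0≼- a≤u) q (≋-by (≋-+ eq (≋-sym w≋)) λ i →
          solve 5 (λ a b u w w′ → ((u :- a) :+ w′) :- b := ((u :+ w′) :+ w) :- (w :+ (a :+ b))) refl
            (app a i) (app b i) (app u i) (app w i) (app w′ i))
        (λ e → ≋-refl) C))
    ; (inj₂ u≤a) → cone-split {a = a ⊟ u} {b} (≼⇒0≼- u≤a) 0≤b
      (≋-by (≋-+ (≋-sym eq) w≋) λ i →
          solve 5 (λ a b u w w′ → ((a :- u) :+ b) :- w′ := (w :+ (a :+ b)) :- ((u :+ w′) :+ w)) refl
            (app a i) (app b i) (app u i) (app w i) (app w′ i)) C >>= λ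
      { (split-into {y} {z} sum D E) → pure (split-into {left = χ u B +ⁿ y} {z}
        (λ e → ≋-trans (eqs e) (shift′ (sum e)))
        (cons B 0≤u q (minus a u) (λ e → ≋-refl) D) E) } }
    where
    minus : ∀ p q → p ≋ q ⊞ (p ⊟ q)
    minus p q = ≋-pw λ i → solve 2 (λ p q → p := q :+ (p :- q)) refl (app p i) (app q i)
    shift : ∀ {p q r s} → p ≋ q ⊞ r → p ⊞ s ≋ q ⊞ (r ⊞ s)
    shift {p} {q} {r} {s} eq = ≋-by eq λ i →
      solve 4 (λ p q r s → (q :+ (r :+ s)) :- (p :+ s) := (q :+ r) :- p) refl (app p i) (app q i) (app r i) (app s i)
    shift′ : ∀ {p q r s} → p ≋ q ⊞ r → s ⊞ p ≋ s ⊞ q ⊞ r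
    shift′ {p} {q} {r} {s} eq = ≋-by eq λ i →
      solve 4 (λ p q r s → (s :+ q :+ r) :- (s :+ p) := (q :+ r) :- p) refl (app p i) (app q i) (app r i) (app s i)

  ∑ : ∀ {s} → (Fin s → R) → R
  ∑ {zero}  v = 𝟎
  ∑ {suc s} v = v zero ⊞ ∑ (v ∘ suc)

  seq-∑ : ∀ {s} (w : Fin s → ℝ) (v : Fin s → R) i → (∀ j → seq (w j) i ≡ app (v j) i) →
          seq (∑ᴿ w) i ≡ app (∑ v) i
  seq-∑ {zero}  w v i eq = refl
  seq-∑ {suc s} w v i eq = cong₂ ℚ._+_ (eq zero) (seq-∑ (w ∘ suc) (v ∘ suc) i (eq ∘ suc))

  seq-indicator : ∀ (B : Subset n) e w u i → seq w i ≡ app u i → seq (w *ᴿ indicator B e) i ≡ app (χ u B e) i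
  seq-indicator B e w u i eq with lookup B e
  ... | true  = trans (ℚ.*-identityʳ (seq w i)) eq
  ... | false = ℚ.*-zeroʳ (seq w i)

  combination⇒cone : ∀ {s} (v : Fin s → R) (c : Fin s → ∃ Q) → (∀ j → 𝟎 ≼ v j) →
                     Cone Q (∑ v) (λ e → ∑ λ j → χ (v j) (proj₁ (c j)) e)
  combination⇒cone {s = zero}  v c 0≤v = nil ≋-refl λ e → ≋-refl
  combination⇒cone {s = suc s} v c 0≤v =
    cons (proj₁ (c zero)) (0≤v zero) (proj₂ (c zero)) ≋-refl (λ e → ≋-refl)
      (combination⇒cone (v ∘ suc) (c ∘ suc) (0≤v ∘ suc))

  cone⇒combination : Cone Q w x → ∃ λ s → ∃₂ λ (v : Fin s → R) (c : Fin s → ∃ Q) →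
                     (∀ j → 𝟎 ≼ v j) × ∑ v ≋ w × (∀ e → x e ≋ ∑ λ j → χ (v j) (proj₁ (c j)) e)
  cone⇒combination (nil w≋0 x≋0) = 0 , (λ ()) , (λ ()) , (λ ()) , ≋-sym w≋0 , x≋0
  cone⇒combination (cons {u = u} B 0≤u q eq eqs C) =
    let s , v , c , 0≤v , ∑v , x≋ = cone⇒combination C in
    suc s , u Vector.∷ v , (B , q) Vector.∷ c ,
    (λ { zero → 0≤u ; (suc j) → 0≤v j }) ,
    ≋-trans (≋-+ ≋-refl ∑v) (≋-sym eq) ,
    λ e → ≋-trans (eqs e) (≋-+ ≋-refl (x≋ e))

  𝟏 : R
  R.val 𝟏 = 1ᴿ

  𝓟⇒cone : ∀ (M : Matroid n) x → 𝓟 M x → Cone (Basis M) 𝟏 (⌊_⌋ ∘ x)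
  𝓟⇒cone M x (s , w , c , 0≤w , ∑w , x≈) =
    cone-≋ (≋-trans (≋-pw λ i → sym (seq-∑ w υ i λ j → refl)) (≋-intro {⌊ ∑ᴿ w ⌋} {𝟏} ∑w))
      (λ e → ≋-trans (≋-pw λ i → sym (seq-∑ (λ j → w j *ᴿ indicator (proj₁ (c j)) e) (λ j → χ (υ j) (proj₁ (c j)) e) i
                                        λ j → seq-indicator (proj₁ (c j)) e (w j) (υ j) i refl))
                     (≋-sym (≋-intro {⌊ x e ⌋} {⌊ ∑ᴿ (λ j → w j *ᴿ indicator (proj₁ (c j)) e) ⌋} (x≈ e))))
      (combination⇒cone υ c (λ j → ≼-intro {𝟎} {υ j} (0≤w j)))
    where
    υ : Fin s → R
    υ j = ⌊ w j ⌋

  ∑-cong : ∀ {s} {p q : Fin s → R} → (∀ j → p j ≋ q j) → ∑ p ≋ ∑ q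
  ∑-cong {zero}  eq = ≋-refl
  ∑-cong {suc s} eq = ≋-+ (eq zero) (∑-cong (eq ∘ suc))

  χ-cong : ∀ {u v} (B : Subset n) → u ≋ v → ∀ e → χ u B e ≋ χ v B e
  χ-cong B eq e with lookup B e
  ... | true  = eq
  ... | false = ≋-refl

  combination⇒𝓟 : ∀ (M : Matroid n) x {s} (ω : Fin s → ℝ) (c : Fin s → ∃ (Basis M)) → (∀ j → 𝟎 ≼ ⌊ ω j ⌋) →
                  ∑ (⌊_⌋ ∘ ω) ≋ 𝟏 → (∀ e → ⌊ x e ⌋ ≋ ∑ λ j → χ ⌊ ω j ⌋ (proj₁ (c j)) e) → 𝓟 M x
  combination⇒𝓟 {n} M x {s} ω c 0≤ω ∑ω x≋ = s , ω , c , 0≤ , ∑≈ , x≈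
    where
    0≤ : ∀ j → 0ᴿ ≤ᴿ ω j
    0≤ j = _≼_.≼-elim (0≤ω j)
    ∑≈ : ∑ᴿ ω ≈ᴿ 1ᴿ
    ∑≈ = _≋_.≋-elim {⌊ ∑ᴿ ω ⌋} {𝟏} (≋-trans (≋-pw λ i → seq-∑ ω (⌊_⌋ ∘ ω) i λ j → refl) ∑ω)
    x≈ : ∀ e → x e ≈ᴿ ∑ᴿ (λ j → ω j *ᴿ indicator (proj₁ (c j)) e)
    x≈ e = _≋_.≋-elim {⌊ x e ⌋} {⌊ ∑ᴿ (λ j → ω j *ᴿ indicator (proj₁ (c j)) e) ⌋}
      (≋-trans (x≋ e) (≋-pw λ i → sym (seq-∑ (λ j → ω j *ᴿ indicator (proj₁ (c j)) e) (λ j → χ ⌊ ω j ⌋ (proj₁ (c j)) e) i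
                                        λ j → seq-indicator (proj₁ (c j)) e (ω j) ⌊ ω j ⌋ i refl)))

  cone⇒𝓟 : ∀ (M : Matroid n) x → Cone (Basis M) 𝟏 (⌊_⌋ ∘ x) → 𝓟 M x
  cone⇒𝓟 M x C = let s , v , c , 0≤v , ∑v , x≋ = cone⇒combination C in
    combination⇒𝓟 M x (λ j → R.val (v j)) c
    (λ j → ≼-trans (0≤v j) (≋⇒≽ (⌊val⌋ (v j))))
    (≋-trans (∑-cong (λ j → ⌊val⌋ (v j))) ∑v)
    (λ e → ≋-trans (x≋ e) (∑-cong λ j → χ-cong (proj₁ (c j)) (≋-sym (⌊val⌋ (v j))) e))
    where
    ⌊val⌋ : ∀ u → ⌊ R.val u ⌋ ≋ u
    ⌊val⌋ u = ≋-pw λ _ → refl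

open Cones

-- Lattice path matroids and basis exchange

module LatticePaths where

  open +-*-Solver

  private variable
    m n k l : ℕ

  infixl 8 _+′_ _-′_
  _+′_ _-′_ : Subset n → Fin n → Subset n
  B +′ y = B [ y ]≔ inside
  B -′ x = B [ x ]≔ outside

  ∪⁅⁆≡ : ∀ (B : Subset n) y → B ∪ ⁅ y ⁆ ≡ B +′ y
  ∪⁅⁆≡ (true  ∷ B) zero    = cong (inside ∷_) (∪-identityʳ B)
  ∪⁅⁆≡ (false ∷ B) zero    = cong (inside ∷_) (∪-identityʳ B)
  ∪⁅⁆≡ (true  ∷ B) (suc y) = cong (inside ∷_) (∪⁅⁆≡ B y)
  ∪⁅⁆≡ (false ∷ B) (suc y) = cong (outside ∷_) (∪⁅⁆≡ B y)

  -≡ : ∀ (B : Subset n) x → B - x ≡ B -′ x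
  -≡ (true  ∷ B) zero    = cong (outside ∷_) (p─⊥≡p B)
  -≡ (false ∷ B) zero    = cong (outside ∷_) (p─⊥≡p B)
  -≡ (true  ∷ B) (suc x) = cong (inside ∷_) (-≡ B x)
  -≡ (false ∷ B) (suc x) = cong (outside ∷_) (-≡ B x)

  exchange≡ : ∀ (B : Subset n) x y → exchange B x y ≡ B -′ x +′ y
  exchange≡ B x y = trans (∪⁅⁆≡ (B - x) y) (cong (_+′ y) (-≡ B x))

  ∣+′∣ : ∀ {B : Subset n} {y} → y ∉ B → ∣ B +′ y ∣ ≡ suc ∣ B ∣
  ∣+′∣ {B = true  ∷ B} {zero}  y∉ = contradiction here y∉
  ∣+′∣ {B = false ∷ B} {zero}  y∉ = refl
  ∣+′∣ {B = true  ∷ B} {suc y} y∉ = cong suc (∣+′∣ (y∉ ∘ there))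
  ∣+′∣ {B = false ∷ B} {suc y} y∉ = ∣+′∣ (y∉ ∘ there)

  ∣-′∣ : ∀ {B : Subset n} {x} → x ∈ B → suc ∣ B -′ x ∣ ≡ ∣ B ∣
  ∣-′∣ {B = true  ∷ B} {zero}  x∈ = refl
  ∣-′∣ {B = true  ∷ B} {suc x} (there x∈) = cong suc (∣-′∣ x∈)
  ∣-′∣ {B = false ∷ B} {suc x} (there x∈) = ∣-′∣ x∈

  ∉-′ : ∀ {B : Subset n} {y} x → y ∉ B → y ∉ B -′ x
  ∉-′ {B = b ∷ B} {zero}  zero    y∉ ()
  ∉-′ {B = b ∷ B} {zero}  (suc x) y∉ here = y∉ here
  ∉-′ {B = b ∷ B} {suc y} zero    y∉ (there y∈) = y∉ (there y∈)
  ∉-′ {B = b ∷ B} {suc y} (suc x) y∉ (there y∈) = ∉-′ x (y∉ ∘ there) y∈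

  ∣-′+′∣ : ∀ {B : Subset n} {x y} → x ∈ B → y ∉ B → ∣ B -′ x +′ y ∣ ≡ ∣ B ∣
  ∣-′+′∣ {x = x} x∈ y∉ = trans (∣+′∣ (∉-′ x y∉)) (∣-′∣ x∈)

  -- Lattice path matroids: an interval is prescribed for the size of the
  -- intersection of a basis with each final segment of the ground set.

  Bounds : ℕ → Set
  Bounds n = Vec (ℕ × ℕ) n

  _between_ : ℕ → ℕ × ℕ → Set
  k between (l , u) = l ≤ k × k ≤ u

  Fits : Bounds n → Subset n → Set
  Fits []       []      = Unit
  Fits (c ∷ cs) (b ∷ B) = ∣ b ∷ B ∣ between c × Fits cs B

  fits? : ∀ (cs : Bounds n) B → Dec (Fits cs B)
  fits? []             []      = yes tt
  fits? ((l , u) ∷ cs) (b ∷ B) = ((l ℕ.≤? ∣ b ∷ B ∣) ×-dec (∣ b ∷ B ∣ ℕ.≤? u)) ×-dec fits? cs B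

  between-≡ : ∀ {i j c} → i ≡ j → j between c → i between c
  between-≡ refl i = i

  -- The element `y` is the first position behind which `B₁` no longer has fewer elements than `B₂`.
  -- Only segments in which `B₁` has fewer elements gain one, and there the size of `B₂` shows that
  -- the upper bound is not yet reached.
  add : ∀ {cs : Bounds n} {B₁ B₂} → Fits cs B₁ → Fits cs B₂ → ∣ B₁ ∣ < ∣ B₂ ∣ →
        ∃ λ y → y ∈ B₂ × y ∉ B₁ × Fits cs (B₁ +′ y)
  add {cs = []} {[]} {[]} _ _ ()
  add {cs = c ∷ cs} {b₁ ∷ B₁} {b₂ ∷ B₂} ((l≤ , _) , f₁) ((_ , ≤u) , f₂) lt with ∣ B₁ ∣ ℕ.<? ∣ B₂ ∣
  ... | yes lt′ = let y , y∈ , y∉ , f = add f₁ f₂ lt′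
                      y∉′ = λ { (there y∈) → y∉ y∈ }
                  in suc y , there y∈ , y∉′ ,
                     between-≡ (∣+′∣ {B = b₁ ∷ B₁} y∉′) (ℕ.m≤n⇒m≤1+n l≤ , ℕ.≤-trans lt ≤u) , f
  add {B₁ = true  ∷ B₁} {true  ∷ B₂} _ _ lt | no ≮ = contradiction (ℕ.s<s⁻¹ lt) ≮
  add {B₁ = false ∷ B₁} {false ∷ B₂} _ _ lt | no ≮ = contradiction lt ≮
  add {B₁ = true  ∷ B₁} {false ∷ B₂} _ _ lt | no ≮ = contradiction (ℕ.<-trans (ℕ.n<1+n _) lt) ≮
  add {B₁ = false ∷ B₁} {true  ∷ B₂} ((l≤ , _) , f₁) ((_ , ≤u) , f₂) lt | no ≮ =
    zero , here , (λ ()) , (ℕ.m≤n⇒m≤1+n l≤ , ℕ.≤-trans lt ≤u) , f₁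

  -- The second alternative is a pending state: `x` is gone and nothing has replaced it. The lower
  -- bounds survive while `B₂` has strictly fewer elements in the segment. The first longer segment
  -- where the sizes balance begins with an element of `B₂` outside `B₁`, which becomes `y`. Once
  -- the total size is prescribed, the state cannot stay pending.
  remove : ∀ {cs : Bounds n} {B₁ B₂ x} → Fits cs B₁ → Fits cs B₂ → x ∈ B₁ → x ∉ B₂ →
           (∃ λ y → y ∈ B₂ × y ∉ B₁ × Fits cs (B₁ -′ x +′ y)) ⊎
           (∣ B₂ ∣ < ∣ B₁ ∣ × Fits cs (B₁ -′ x))
  remove {cs = c ∷ cs} {b₁ ∷ B₁} {true ∷ B₂} {zero} _ _ here x∉ = contradiction here x∉
  remove {cs = c ∷ cs} {b₁ ∷ B₁} {false ∷ B₂} {zero} (i₁@(_ , ≤u) , f₁) ((l≤ , _) , f₂) here x∉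
    with ∣ B₁ ∣ ℕ.<? ∣ B₂ ∣
  ... | yes lt = let y , y∈ , y∉ , f = add f₁ f₂ lt in
        inj₁ (suc y , there y∈ , (λ { (there y∈) → y∉ y∈ }) , between-≡ (∣+′∣ y∉) i₁ , f)
  ... | no ≮ = inj₂ (s≤s (ℕ.≮⇒≥ ≮) , (ℕ.≤-trans l≤ (ℕ.≮⇒≥ ≮) , ℕ.<⇒≤ ≤u) , f₁)
  remove {cs = c ∷ cs} {b₁ ∷ B₁} {b₂ ∷ B₂} {suc x} (i₁ , f₁) (i₂ , f₂) (there x∈) x∉
    with remove f₁ f₂ x∈ (x∉ ∘ there)
  ... | inj₁ (y , y∈ , y∉ , f) =
    let y∉′ = λ { (there y∈) → y∉ y∈ } in
    inj₁ (suc y , there y∈ , y∉′ , between-≡ (∣-′+′∣ {B = b₁ ∷ B₁} (there x∈) y∉′) i₁ , f)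
  ... | inj₂ (lt , f) = go b₁ b₂ i₁ i₂
    where
    go : ∀ b₁ b₂ → ∣ b₁ ∷ B₁ ∣ between c → ∣ b₂ ∷ B₂ ∣ between c →
         (∃ λ y → y ∈ b₂ ∷ B₂ × y ∉ b₁ ∷ B₁ × Fits (c ∷ cs) ((b₁ ∷ B₁) -′ suc x +′ y)) ⊎
         (∣ b₂ ∷ B₂ ∣ < ∣ b₁ ∷ B₁ ∣ × Fits (c ∷ cs) ((b₁ ∷ B₁) -′ suc x))
    drop-here : ∀ b₁ b₂ → ∣ b₁ ∷ B₁ ∣ between c → ∣ b₂ ∷ B₂ ∣ between c → ∣ b₂ ∷ B₂ ∣ < ∣ b₁ ∷ B₁ ∣ →
                ∣ b₂ ∷ B₂ ∣ < ∣ b₁ ∷ B₁ ∣ × Fits (c ∷ cs) ((b₁ ∷ B₁) -′ suc x)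
    drop-here b₁ b₂ (_ , ≤u) (l≤ , _) lt =
      let eq = ∣-′∣ {B = b₁ ∷ B₁} (there x∈) in
      lt , (ℕ.≤-trans l≤ (ℕ.s≤s⁻¹ (subst (∣ b₂ ∷ B₂ ∣ <_) (sym eq) lt)) ,
            ℕ.≤-trans (ℕ.n≤1+n _) (ℕ.≤-trans (ℕ.≤-reflexive eq) ≤u)) , f
    go true  true  i₁ i₂ = inj₂ (drop-here true true i₁ i₂ (s≤s lt))
    go false false i₁ i₂ = inj₂ (drop-here false false i₁ i₂ lt)
    go true  false i₁ i₂ = inj₂ (drop-here true false i₁ i₂ (ℕ.m≤n⇒m≤1+n lt))
    go false true  i₁ i₂ with suc ∣ B₂ ∣ ℕ.<? ∣ B₁ ∣
    ... | yes lt′ = inj₂ (drop-here false true i₁ i₂ lt′)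
    ... | no ≮    = inj₁ (zero , here , (λ ()) , between-≡ (∣-′∣ x∈) i₁ , f)

  LP : ∀ k (cs : Bounds n) → ∃ (Fits ((k , k) ∷ cs)) → Matroid (suc n)
  LP k cs feasible .Basis B = Fits ((k , k) ∷ cs) B
  LP k cs feasible .basis?  = fits? ((k , k) ∷ cs)
  LP k cs feasible .someBasis = feasible
  LP k cs feasible .basis-exchange {B₁} {B₂} f₁ f₂ {x} x∈ x∉ with remove f₁ f₂ x∈ x∉
  ... | inj₁ (y , y∈ , y∉ , f) = y , y∈ , y∉ , subst (Fits ((k , k) ∷ cs)) (sym (exchange≡ B₁ x y)) f
  LP k cs feasible .basis-exchange {_ ∷ B₁} {_ ∷ B₂} ((_ , ≤k) , f₁) ((k≤ , _) , f₂) x∈ x∉ | inj₂ (lt , f) =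
    contradiction (ℕ.≤-trans ≤k k≤) (ℕ.<⇒≱ lt)

open LatticePaths

-- Integrality: lattice path polytopes are given by their inequalities

module Inequalities where

  open +-*-Solver

  private variable
    m n k l : ℕ
    u w w′ : R
    x x′ : R^ n
    cs : Bounds n

  ⊠-cong : ∀ m → w ≋ w′ → m ⊠ w ≋ m ⊠ w′
  ⊠-cong zero    eq = ≋-refl
  ⊠-cong (suc m) eq = ≋-+ eq (⊠-cong m eq)

  interchange : ∀ p q r s → (p ⊞ q) ⊞ (r ⊞ s) ≋ (p ⊞ r) ⊞ (q ⊞ s)
  interchange p q r s = ≋-pw λ i →
    solve 4 (λ p q r s → (p :+ q) :+ (r :+ s) := (p :+ r) :+ (q :+ s)) refl (app p i) (app q i) (app r i) (app s i)

  𝟎≋𝟎⊞𝟎 : 𝟎 ≋ 𝟎 ⊞ 𝟎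
  𝟎≋𝟎⊞𝟎 = ≋-pw λ _ → refl

  ⊠-+ : ∀ m → m ⊠ (w ⊞ w′) ≋ m ⊠ w ⊞ m ⊠ w′
  ⊠-+ zero = 𝟎≋𝟎⊞𝟎
  ⊠-+ {w} {w′} (suc m) = ≋-trans (≋-+ ≋-refl (⊠-+ m)) (interchange w w′ (m ⊠ w) (m ⊠ w′))

  ⊠-𝟎 : ∀ m → m ⊠ 𝟎 ≋ 𝟎
  ⊠-𝟎 zero    = ≋-refl
  ⊠-𝟎 (suc m) = ≋-trans (≋-+ ≋-refl (⊠-𝟎 m)) (≋-sym 𝟎≋𝟎⊞𝟎)

  ⊠-nonneg : ∀ m → 𝟎 ≼ w → 𝟎 ≼ m ⊠ w
  ⊠-nonneg zero    0≤w = ≼-refl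
  ⊠-nonneg (suc m) 0≤w = 0≼+ 0≤w (⊠-nonneg m 0≤w)

  ⊠-mono : ∀ {l m} → l ≤ m → 𝟎 ≼ w → l ⊠ w ≼ m ⊠ w
  ⊠-mono {m = m} z≤n 0≤w = ⊠-nonneg m 0≤w
  ⊠-mono (s≤s l≤m)   0≤w = ≼-+ ≼-refl (⊠-mono l≤m 0≤w)

  ∑-+ : ∀ (x y : R^ n) → ∑ (x +ⁿ y) ≋ ∑ x ⊞ ∑ y
  ∑-+ {zero}  x y = 𝟎≋𝟎⊞𝟎
  ∑-+ {suc n} x y = ≋-trans (≋-+ ≋-refl (∑-+ (x ∘ suc) (y ∘ suc)))
                            (interchange (x zero) (y zero) (∑ (x ∘ suc)) (∑ (y ∘ suc)))

  ∑-0 : ∑ {n} 0ⁿ ≋ 𝟎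
  ∑-0 {zero}  = ≋-refl
  ∑-0 {suc n} = ≋-trans (≋-+ ≋-refl (∑-0 {n})) (≋-sym 𝟎≋𝟎⊞𝟎)

  ∑-χ : ∀ (B : Subset n) → ∑ (χ u B) ≋ ∣ B ∣ ⊠ u
  ∑-χ []          = ≋-refl
  ∑-χ (true  ∷ B) = ≋-+ ≋-refl (∑-χ B)
  ∑-χ {u = u} (false ∷ B) = ≋-trans (≋-+ ≋-refl (∑-χ {u = u} B)) (≋-sym (zero-+ ≋-refl))

  -- Ineq cs w x: x satisfies the inequalities of the w-th dilate of the polytope.

  Ineq : Bounds n → R → R^ n → Set
  Ineq []             w x = Unit
  Ineq ((l , u) ∷ cs) w x = (𝟎 ≼ x zero × x zero ≼ w) × (l ⊠ w ≼ ∑ x × ∑ x ≼ u ⊠ w) × Ineq cs w (x ∘ suc)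

  ineq-≋ : w ≋ w′ → x ≗ x′ → Ineq cs w x → Ineq cs w′ x′
  ineq-≋ {cs = []} w≋ x≋ _ = tt
  ineq-≋ {cs = (l , u) ∷ cs} w≋ x≋ ((0≤ , ≤w) , (l≤ , ≤u) , I) =
    (≼-trans 0≤ (≋⇒≼ (x≋ zero)) , ≼-trans (≋⇒≽ (x≋ zero)) (≼-trans ≤w (≋⇒≼ w≋))) ,
    (≼-trans (≋⇒≽ (⊠-cong l w≋)) (≼-trans l≤ (≋⇒≼ (∑-cong x≋))) ,
     ≼-trans (≋⇒≽ (∑-cong x≋)) (≼-trans ≤u (≋⇒≼ (⊠-cong u w≋)))) ,
    ineq-≋ w≋ (x≋ ∘ suc) I

  ineq-0 : ∀ (cs : Bounds n) → Ineq cs 𝟎 0ⁿ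
  ineq-0 [] = tt
  ineq-0 {suc n} ((l , u) ∷ cs) = (≼-refl , ≼-refl) ,
    (≋⇒≼ (≋-trans (⊠-𝟎 l) (≋-sym (∑-0 {suc n}))) , ≋⇒≼ (≋-trans (∑-0 {suc n}) (≋-sym (⊠-𝟎 u)))) ,
    ineq-0 cs

  ineq-+ : Ineq cs w x → Ineq cs w′ x′ → Ineq cs (w ⊞ w′) (x +ⁿ x′)
  ineq-+ {cs = []} _ _ = tt
  ineq-+ {cs = (l , u) ∷ cs} {x = x} {x′ = x′} ((0≤ , ≤w) , (l≤ , ≤u) , I) ((0≤′ , ≤w′) , (l≤′ , ≤u′) , I′) =
    (0≼+ 0≤ 0≤′ , ≼-+ ≤w ≤w′) ,
    (≼-trans (≋⇒≼ (⊠-+ l)) (≼-trans (≼-+ l≤ l≤′) (≋⇒≽ (∑-+ x x′))) ,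
     ≼-trans (≋⇒≼ (∑-+ x x′)) (≼-trans (≼-+ ≤u ≤u′) (≋⇒≽ (⊠-+ u)))) ,
    ineq-+ I I′

  ineq-χ : ∀ {cs} (B : Subset n) → 𝟎 ≼ w → Fits cs B → Ineq cs w (χ w B)
  ineq-χ {cs = []} [] 0≤w _ = tt
  ineq-χ {cs = (l , u) ∷ cs} (b ∷ B) 0≤w ((l≤ , ≤u) , f) = χ-bounds (b ∷ B) 0≤w zero ,
    (≼-trans (⊠-mono l≤ 0≤w) (≋⇒≽ (∑-χ (b ∷ B))) , ≼-trans (≋⇒≼ (∑-χ (b ∷ B))) (⊠-mono ≤u 0≤w)) ,
    ineq-χ B 0≤w f

  cone⇒ineq : Cone (Fits cs) w x → Ineq cs w x
  cone⇒ineq (nil w≋0 x≋0) = ineq-≋ (≋-sym w≋0) (λ e → ≋-sym (x≋0 e)) (ineq-0 _)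
  cone⇒ineq (cons B 0≤u f eq eqs C) =
    ineq-≋ (≋-sym eq) (λ e → ≋-sym (eqs e)) (ineq-+ (ineq-χ B 0≤u f) (cone⇒ineq C))

  -- A point of weight w whose coordinates sum to m w + b is spread over sets of size
  -- m (total weight a) and sets of size m + 1 (total weight b).

  record Spread (Q : Subset n → Set) (w : R) (x : R^ n) : Set where
    constructor spread
    field
      {low} : ℕ
      {a b} : R
      {p q} : R^ n
      w≋    : w ≋ a ⊞ b
      ∑≋    : ∑ x ≋ low ⊠ w ⊞ b
      x≋    : x ≗ p +ⁿ q
      lows  : Cone (λ B → Q B × ∣ B ∣ ≡ low) a p
      highs : Cone (λ B → Q B × ∣ B ∣ ≡ suc low) b q

  collapse : ∀ {Q : Subset n → Set} → Spread Q w x → Cone Q w x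
  collapse (spread w≋ _ x≋ C D) =
    cone-≋ (≋-sym w≋) (λ e → ≋-sym (x≋ e)) (cone-+ (cone-map proj₁ C) (cone-map proj₁ D))

  -- Here `∑ x` is `m ⊠ w ⊞ b` with `b` between zero and `w`. If one of the sizes `m` and `m + 1`
  -- violates a bound, the inequalities force the weight of the sets of that size to be at most
  -- zero, and `cone-null` disposes of them.
  fix-bounds : ∀ {Q : Subset n → Set} {l u} → l ⊠ w ≼ ∑ x → ∑ x ≼ u ⊠ w → Spread Q w x →
               Spread (λ B → ∣ B ∣ between (l , u) × Q B) w x
  fix-bounds {w = w} {x = x} {Q} {l} {u} l≤ ≤u (spread {m} {a} {b} {p} {q} w≋ ∑≋ x≋ C D) =
    spread w≋ ∑≋ x≋ (restrict C lo) (restrict D hi)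
    where
    restrict : ∀ {i a p} → Cone (λ B → Q B × ∣ B ∣ ≡ i) a p → (i < l ⊎ u < i → a ≼ 𝟎) →
               Cone (λ B → (∣ B ∣ between (l , u) × Q B) × ∣ B ∣ ≡ i) a p
    restrict {i} C out with l ℕ.≤? i | i ℕ.≤? u
    ... | no ≰    | _       = cone-null (out (inj₁ (ℕ.≰⇒> ≰))) C
    ... | yes _   | no ≰    = cone-null (out (inj₂ (ℕ.≰⇒> ≰))) C
    ... | yes l≤i | yes i≤u = cone-map (λ { (q , refl) → ((l≤i , i≤u) , q) , refl }) C

    0≤a : 𝟎 ≼ a
    0≤a = cone-0≤ C
    0≤b : 𝟎 ≼ b
    0≤b = cone-0≤ D
    0≤w : 𝟎 ≼ w
    0≤w = ≼-trans (0≼+ 0≤a 0≤b) (≋⇒≽ w≋)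

    lo : m < l ⊎ u < m → a ≼ 𝟎
    lo (inj₁ m<l) = ≼-by (≼-+ (≼-+ (⊠-mono m<l 0≤w) l≤) (≼-+ (≋⇒≼ ∑≋) (≋⇒≽ w≋))) λ i →
      solve 6 (λ w M L S a b → con 0ℚ :- a := (L :+ S :+ (M :+ b :+ w)) :- (w :+ M :+ L :+ (S :+ (a :+ b)))) refl
        (app w i) (app (m ⊠ w) i) (app (l ⊠ w) i) (app (∑ x) i) (app a i) (app b i)
    lo (inj₂ u<m) = ≼-by (≼-+ (≼-+ (≼-+ (⊠-mono u<m 0≤w) ≤u) (≼-+ (≋⇒≽ ∑≋) (≋⇒≽ w≋))) (≼-+ 0≤b 0≤b)) λ i →
      solve 6 (λ w M U S a b → con 0ℚ :- a :=
          (M :+ U :+ (S :+ w) :+ (b :+ b)) :- (w :+ U :+ S :+ (M :+ b :+ (a :+ b)) :+ (con 0ℚ :+ con 0ℚ))) refl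
        (app w i) (app (m ⊠ w) i) (app (u ⊠ w) i) (app (∑ x) i) (app a i) (app b i)

    hi : suc m < l ⊎ u < suc m → b ≼ 𝟎
    hi (inj₁ m<l) = ≼-by (≼-+ (≼-+ (≼-+ (⊠-mono m<l 0≤w) l≤) (≼-+ (≋⇒≼ ∑≋) (≋⇒≽ w≋))) (≼-+ (≋⇒≽ w≋) (≼-+ 0≤a 0≤a))) λ i →
      solve 6 (λ w M L S a b → con 0ℚ :- b :=
          (L :+ S :+ (M :+ b :+ w) :+ (w :+ (a :+ a))) :-
          (w :+ (w :+ M) :+ L :+ (S :+ (a :+ b)) :+ (a :+ b :+ (con 0ℚ :+ con 0ℚ)))) refl
        (app w i) (app (m ⊠ w) i) (app (l ⊠ w) i) (app (∑ x) i) (app a i) (app b i)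
    hi (inj₂ u<m) = ≼-by (≼-+ (≼-+ (⊠-mono (ℕ.s≤s⁻¹ u<m) 0≤w) ≤u) (≋⇒≽ ∑≋)) λ i →
      solve 4 (λ M U S b → con 0ℚ :- b := (M :+ U :+ S) :- (U :+ S :+ (M :+ b))) refl
        (app (m ⊠ w) i) (app (u ⊠ w) i) (app (∑ x) i) (app b i)

  infixr 5 _◂_
  _◂_ : R → R^ n → R^ (suc n)
  (r ◂ p) zero    = r
  (r ◂ p) (suc e) = p e

  prepend-in : ∀ {Q : Subset n → Set} {i} → Cone (λ B → Q B × ∣ B ∣ ≡ i) w x →
               Cone (λ B → Q (Vec.tail B) × ∣ B ∣ ≡ suc i) w (w ◂ x)
  prepend-in = cone-∷ true (λ (q , eq) → q , cong suc eq) ≋-refl (λ _ → ≋-refl)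

  prepend-out : ∀ {Q : Subset n → Set} {i} → Cone (λ B → Q B × ∣ B ∣ ≡ i) w x →
                Cone (λ B → Q (Vec.tail B) × ∣ B ∣ ≡ i) w (𝟎 ◂ x)
  prepend-out = cone-∷ false (λ (q , eq) → q , eq) ≋-refl (λ _ → ≋-refl)

  a≋x⊞[a⊟x] : ∀ a x → a ≋ x ⊞ (a ⊟ x)
  a≋x⊞[a⊟x] a x = ≋-pw λ i → solve 2 (λ a x → a := x :+ (a :- x)) refl (app a i) (app x i)

  -- The new element is given to the smaller sets first. As long as `x₀` is at most `a`, the sizes
  -- `m` and `m + 1` remain; beyond that all smaller sets have grown and the sizes are `m + 1` and
  -- `m + 2`. So only two consecutive sizes ever occur.
  extend : ∀ {Q : Subset n → Set} {x : R^ (suc n)} → 𝟎 ≼ x zero → x zero ≼ w → Spread Q w (x ∘ suc) →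
           ¬¬ Spread (Q ∘ Vec.tail) w x
  extend {w = w} {Q} {x} 0≤x x≤w (spread {m} {a} {b} {p} {q} w≋ ∑≋ x≋ C D) = compare x₀ a >>= λ
    { (inj₁ x≤a) → cone-split 0≤x (≼⇒0≼- x≤a) (a≋x⊞[a⊟x] a x₀) C >>= λ
      { (split-into {y} {z} p≋ Y Z) → pure (spread {low = m} {a ⊟ x₀} {x₀ ⊞ b}
          (≋-by w≋ λ i → solve 4 (λ w a b x → (a :- x :+ (x :+ b)) :- w := (a :+ b) :- w) refl (app w i) (app a i) (app b i) (app x₀ i))
          (≋-by ∑≋ λ i → solve 4 (λ x b s M → (M :+ (x :+ b)) :- (x :+ s) := (M :+ b) :- s) refl (app x₀ i) (app b i) (app s i) (app (m ⊠ w) i))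
          (λ { zero → ≋-pw λ i → solve 1 (λ x → x := con 0ℚ :+ (x :+ con 0ℚ)) refl (app x₀ i)
             ; (suc e) → ≋-by (≋-+ (x≋ e) (p≋ e)) λ i →
                 solve 5 (λ x p q y z → (z :+ (y :+ q)) :- x := ((p :+ q) :+ (y :+ z)) :- (x :+ p)) refl
                   (app (x (suc e)) i) (app (p e) i) (app (q e) i) (app (y e) i) (app (z e) i) })
          (prepend-out Z)
          (cone-+ (prepend-in Y) (prepend-out D))) }
    ; (inj₂ a≤x) → cone-split (≼⇒0≼- a≤x)
        (≼-by x≤w′ λ i → solve 3 (λ x a b → (b :- (x :- a)) :- con 0ℚ := (a :+ b) :- x) refl (app x₀ i) (app a i) (app b i))
        (a≋x⊞[a⊟x] b (x₀ ⊟ a)) D >>= λ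
      { (split-into {y} {z} q≋ Y Z) → pure (spread {low = suc m} {a ⊞ (b ⊟ (x₀ ⊟ a))} {x₀ ⊟ a}
          (≋-by w≋ λ i → solve 4 (λ w a b x → (a :+ (b :- (x :- a)) :+ (x :- a)) :- w := (a :+ b) :- w) refl (app w i) (app a i) (app b i) (app x₀ i))
          (≋-by (≋-+ ∑≋ (≋-sym w≋)) λ i → solve 6 (λ w x a b s M → ((w :+ M) :+ (x :- a)) :- (x :+ s) := ((M :+ b) :+ w) :- (s :+ (a :+ b))) refl
             (app w i) (app x₀ i) (app a i) (app b i) (app s i) (app (m ⊠ w) i))
          (λ { zero → ≋-pw λ i → solve 2 (λ x a → x := (a :+ con 0ℚ) :+ (x :- a)) refl (app x₀ i) (app a i)
             ; (suc e) → ≋-by (≋-+ (x≋ e) (q≋ e)) λ i →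
                 solve 5 (λ x p q y z → ((p :+ z) :+ y) :- x := ((p :+ q) :+ (y :+ z)) :- (x :+ q)) refl
                   (app (x (suc e)) i) (app (p e) i) (app (q e) i) (app (y e) i) (app (z e) i) })
          (cone-+ (prepend-in C) (prepend-out Z))
          (prepend-in Y)) } }
    where
    x₀ s : R
    x₀ = x zero
    s = ∑ (x ∘ suc)
    x≤w′ : x₀ ≼ a ⊞ b
    x≤w′ = ≼-trans x≤w (≋⇒≼ w≋)

  ineq⇒spread : ∀ {cs : Bounds n} {x} → 𝟎 ≼ w → Ineq cs w x → ¬¬ Spread (Fits cs) w x
  ineq⇒spread {w = w} {[]} {x} 0≤w _ = pure (spread {low = 0} {w} {𝟎} {λ ()} {λ ()}
    (≋-pw λ i → solve 1 (λ w → w := w :+ con 0ℚ) refl (app w i)) 𝟎≋𝟎⊞𝟎 (λ ())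
    (cons [] 0≤w (tt , refl) (≋-pw λ i → solve 1 (λ w → w := w :+ con 0ℚ) refl (app w i)) (λ ()) (nil {x = 0ⁿ} ≋-refl λ ()))
    (nil ≋-refl λ ()))
  ineq⇒spread {w = w} {cs = c ∷ cs} 0≤w ((0≤x , x≤w) , (l≤ , ≤u) , I) =
    ineq⇒spread 0≤w I >>= λ S → extend 0≤x x≤w S >>= λ S →
    pure (spread-map (λ { {_ ∷ _} q → q }) (fix-bounds l≤ ≤u S))
    where
    spread-map : ∀ {n} {Q Q′ : Subset n → Set} {w x} → (∀ {B} → Q B → Q′ B) → Spread Q w x → Spread Q′ w x
    spread-map f (spread w≋ ∑≋ x≋ C D) =
      spread w≋ ∑≋ x≋ (cone-map (λ (q , eq) → f q , eq) C) (cone-map (λ (q , eq) → f q , eq) D)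

  -- Together with `cone⇒ineq` this reduces every inclusion between lattice path polytopes to
  -- inequalities.
  ineq⇒cone : 𝟎 ≼ w → Ineq cs w x → ¬¬ Cone (Fits cs) w x
  ineq⇒cone 0≤w I = ineq⇒spread 0≤w I >>= λ S → pure (collapse S)

open Inequalities

-- Valuations, subdivisions and the value on uniform matroids

module Valuations where

  open +-*-Solver

  private variable
    d m n k l m₀ n₀ : ℕ
    u w w′ : R
    x x′ : R^ n
    cs : Bounds n

  open RawMonoidDefinitions ℤ.+-0-rawMonoid using () renaming (sum to ∑ℤ)

  record Valuative {n} (v : Matroid n → ℤ) : Set₁ where
    field
      valuative : ∀ {s} (a : Fin s → ℤ) (M : Fin s → Matroid n) → PolytopeRelation a M →
                  ∑ℤ (λ i → a i ℤ.* v (M i)) ≡ 0ℤ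

  infix 4 _≐_
  _≐_ : Matroid n → Matroid n → Set
  M ≐ N = (∀ {B} → Basis M B → Basis N B) × (∀ {B} → Basis N B → Basis M B)

  𝟙-equal : {P Q : Set} (p? : Dec P) (q? : Dec Q) → (P → Q) → (Q → P) →
            1ℤ ℤ.* 𝟙 p? ℤ.+ (-1ℤ ℤ.* 𝟙 q? ℤ.+ 0ℤ) ≡ 0ℤ
  𝟙-equal (yes p) (yes q) f g = refl
  𝟙-equal (yes p) (no ¬q) f g = contradiction (f p) ¬q
  𝟙-equal (no ¬p) (yes q) f g = contradiction (g q) ¬p
  𝟙-equal (no ¬p) (no ¬q) f g = refl

  𝟙-union : {P P₁ P₂ P₃ : Set} (p? : Dec P) (p₁? : Dec P₁) (p₂? : Dec P₂) (p₃? : Dec P₃) →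
            (P₁ → ¬¬ P) → (P₂ → ¬¬ P) → (P₃ → ¬¬ P₁) → (P₃ → ¬¬ P₂) → (P₁ → P₂ → ¬¬ P₃) → (P → ¬¬ (P₁ ⊎ P₂)) →
            1ℤ ℤ.* 𝟙 p? ℤ.+ (-1ℤ ℤ.* 𝟙 p₁? ℤ.+ (-1ℤ ℤ.* 𝟙 p₂? ℤ.+ (1ℤ ℤ.* 𝟙 p₃? ℤ.+ 0ℤ))) ≡ 0ℤ
  𝟙-union (yes p) (yes p₁) (yes p₂) (yes p₃) f₁ f₂ g₁ g₂ h k = refl
  𝟙-union (yes p) (yes p₁) (yes p₂) (no ¬p₃) f₁ f₂ g₁ g₂ h k = contradiction ¬p₃ (h p₁ p₂)
  𝟙-union (yes p) (no ¬p₁) _ (yes p₃) f₁ f₂ g₁ g₂ h k = contradiction ¬p₁ (g₁ p₃)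
  𝟙-union (yes p) (yes _) (no ¬p₂) (yes p₃) f₁ f₂ g₁ g₂ h k = contradiction ¬p₂ (g₂ p₃)
  𝟙-union (yes p) (yes p₁) (no ¬p₂) (no ¬p₃) f₁ f₂ g₁ g₂ h k = refl
  𝟙-union (yes p) (no ¬p₁) (yes p₂) (no ¬p₃) f₁ f₂ g₁ g₂ h k = refl
  𝟙-union (yes p) (no ¬p₁) (no ¬p₂) (no ¬p₃) f₁ f₂ g₁ g₂ h k = contradiction [ ¬p₁ , ¬p₂ ]′ (k p)
  𝟙-union (no ¬p) (yes p₁) _ _ f₁ f₂ g₁ g₂ h k = contradiction ¬p (f₁ p₁)
  𝟙-union (no ¬p) (no ¬p₁) (yes p₂) _ f₁ f₂ g₁ g₂ h k = contradiction ¬p (f₂ p₂)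
  𝟙-union (no ¬p) (no ¬p₁) (no ¬p₂) (yes p₃) f₁ f₂ g₁ g₂ h k = contradiction ¬p₁ (g₁ p₃)
  𝟙-union (no ¬p) (no ¬p₁) (no ¬p₂) (no ¬p₃) f₁ f₂ g₁ g₂ h k = refl

  -- 𝓟 M = 𝓟 M₁ ∪ 𝓟 M₂ and 𝓟 M₁ ∩ 𝓟 M₂ = 𝓟 M₃, classically

  record Subdivision {n} (P P₁ P₂ P₃ : R^ n → Set) : Set where
    field
      part₁  : ∀ {x} → P₁ x → ¬¬ P x
      part₂  : ∀ {x} → P₂ x → ¬¬ P x
      face₁  : ∀ {x} → P₃ x → ¬¬ P₁ x
      face₂  : ∀ {x} → P₃ x → ¬¬ P₂ x
      meet   : ∀ {x} → P₁ x → P₂ x → ¬¬ P₃ x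
      covers : ∀ {x} → P x → ¬¬ (P₁ x ⊎ P₂ x)

  module _ {v : Matroid n → ℤ} (V : Valuative v) where
    open Valuative V

    -- Matroids with the same bases may differ as records. The relation expressing that their
    -- indicator functions have difference zero makes a valuation agree on them.
    valuation-cong : ∀ {M N} → M ≐ N → v M ≡ v N
    valuation-cong {M} {N} (M⊆N , N⊆M) = begin
      v M                                                  ≡⟨ ℤS.solve 2 (λ x y → x ℤS.:= y ℤS.:+ (ℤS.con 1ℤ ℤS.:* x ℤS.:+ (ℤS.con -1ℤ ℤS.:* y ℤS.:+ ℤS.con 0ℤ))) refl (v M) (v N) ⟩
      v N ℤ.+ (1ℤ ℤ.* v M ℤ.+ (-1ℤ ℤ.* v N ℤ.+ 0ℤ))        ≡⟨ cong (λ z → v N ℤ.+ z) (valuative (lookup (1ℤ ∷ -1ℤ ∷ [])) (lookup (M ∷ N ∷ [])) relation) ⟩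
      v N ℤ.+ 0ℤ                                           ≡⟨ ℤ.+-identityʳ (v N) ⟩
      v N                                                  ∎
      where
      open ≡-Reasoning
      relation : PolytopeRelation (lookup (1ℤ ∷ -1ℤ ∷ [])) (lookup (M ∷ N ∷ []))
      relation x x∈? = 𝟙-equal (x∈? zero) (x∈? (suc zero))
        (λ p → cone⇒𝓟 N x (cone-map M⊆N (𝓟⇒cone M x p))) (λ p → cone⇒𝓟 M x (cone-map N⊆M (𝓟⇒cone N x p)))

    valuation-union : ∀ {M M₁ M₂ M₃} →
      Subdivision (Cone (Basis M) 𝟏) (Cone (Basis M₁) 𝟏) (Cone (Basis M₂) 𝟏) (Cone (Basis M₃) 𝟏) →
      v M ≡ v M₁ ℤ.+ v M₂ ℤ.- v M₃
    valuation-union {M} {M₁} {M₂} {M₃} S = begin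
      v M
        ≡⟨ ℤS.solve 4 (λ x x₁ x₂ x₃ → x ℤS.:= (x₁ ℤS.:+ x₂ ℤS.:- x₃) ℤS.:+ (ℤS.con 1ℤ ℤS.:* x ℤS.:+
               (ℤS.con -1ℤ ℤS.:* x₁ ℤS.:+ (ℤS.con -1ℤ ℤS.:* x₂ ℤS.:+ (ℤS.con 1ℤ ℤS.:* x₃ ℤS.:+ ℤS.con 0ℤ))))) refl
             (v M) (v M₁) (v M₂) (v M₃) ⟩
      v M₁ ℤ.+ v M₂ ℤ.- v M₃ ℤ.+ (1ℤ ℤ.* v M ℤ.+ (-1ℤ ℤ.* v M₁ ℤ.+ (-1ℤ ℤ.* v M₂ ℤ.+ (1ℤ ℤ.* v M₃ ℤ.+ 0ℤ))))
        ≡⟨ cong (λ z → v M₁ ℤ.+ v M₂ ℤ.- v M₃ ℤ.+ z) (valuative a Ms relation) ⟩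
      v M₁ ℤ.+ v M₂ ℤ.- v M₃ ℤ.+ 0ℤ                        ≡⟨ ℤ.+-identityʳ _ ⟩
      v M₁ ℤ.+ v M₂ ℤ.- v M₃                               ∎
      where
      open ≡-Reasoning
      open Subdivision S
      a : Fin 4 → ℤ
      a = lookup (1ℤ ∷ -1ℤ ∷ -1ℤ ∷ 1ℤ ∷ [])
      Ms : Fin 4 → Matroid n
      Ms = lookup (M ∷ M₁ ∷ M₂ ∷ M₃ ∷ [])
      relation : PolytopeRelation a Ms
      relation x x∈? = 𝟙-union (x∈? zero) (x∈? (suc zero)) (x∈? (suc (suc zero))) (x∈? (suc (suc (suc zero))))
        (λ p → part₁ (𝓟⇒cone M₁ x p) >>= λ C → pure (cone⇒𝓟 M x C))
        (λ p → part₂ (𝓟⇒cone M₂ x p) >>= λ C → pure (cone⇒𝓟 M x C))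
        (λ p → face₁ (𝓟⇒cone M₃ x p) >>= λ C → pure (cone⇒𝓟 M₁ x C))
        (λ p → face₂ (𝓟⇒cone M₃ x p) >>= λ C → pure (cone⇒𝓟 M₂ x C))
        (λ p q → meet (𝓟⇒cone M₁ x p) (𝓟⇒cone M₂ x q) >>= λ C → pure (cone⇒𝓟 M₃ x C))
        (λ p → covers (𝓟⇒cone M x p) >>= λ C → pure ([ (λ C → inj₁ (cone⇒𝓟 M₁ x C)) , (λ C → inj₂ (cone⇒𝓟 M₂ x C)) ]′ C))

  -- A word describes a chain of strips m ≤ |B ∩ T| ≤ m + 1, one for each final
  -- segment T, starting with a segment of n elements; a cut inserts an equality.

  data Word : ℕ → ℕ → Set where
    last : Word 0 1
    par  : Word m n → Word m (suc n)
    ser  : Word m n → Word (suc m) (suc n)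
    cut  : Word m n → Word (suc m) (suc (suc n))

  cuts : Word m n → ℕ
  cuts last    = 0
  cuts (par w) = cuts w
  cuts (ser w) = cuts w
  cuts (cut w) = suc (cuts w)

  strip : ℕ → ℕ × ℕ
  strip m = m , suc m

  bounds : Word m n → Bounds n
  bounds last              = strip 0 ∷ []
  bounds (par {m = m} w) = strip m ∷ bounds w
  bounds (ser {m = m} w) = strip (suc m) ∷ bounds w
  bounds (cut {m = m} w) = strip (suc m) ∷ (suc m , suc m) ∷ bounds w

  -- A word with a hole for a word of type m n, at which the d-th block is in progress.

  data Context (m₀ n₀ : ℕ) : ℕ → ℕ → ℕ → Set where
    start : Context m₀ n₀ 1 m₀ n₀
    par   : Context m₀ n₀ d m (suc n) → Context m₀ n₀ d m n
    ser   : Context m₀ n₀ d (suc m) (suc n) → Context m₀ n₀ d m n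
    cut   : Context m₀ n₀ d (suc m) (suc (suc n)) → Context m₀ n₀ (suc d) m n

  plug : Context m₀ n₀ d m n → Bounds n → Bounds n₀
  plug start             cs = cs
  plug (par {m = m} K) cs = plug K (strip m ∷ cs)
  plug (ser {m = m} K) cs = plug K (strip (suc m) ∷ cs)
  plug (cut {m = m} K) cs = plug K (strip (suc m) ∷ (suc m , suc m) ∷ cs)

  plug-word : Context m₀ n₀ d m n → Word m n → Word m₀ n₀
  plug-word start   w = w
  plug-word (par K) w = plug-word K (par w)
  plug-word (ser K) w = plug-word K (ser w)
  plug-word (cut K) w = plug-word K (cut w)

  plug-bounds : ∀ (K : Context m₀ n₀ d m n) w → plug K (bounds w) ≡ bounds (plug-word K w)
  plug-bounds start   w = refl
  plug-bounds (par K) w = plug-bounds K (par w)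
  plug-bounds (ser K) w = plug-bounds K (ser w)
  plug-bounds (cut K) w = plug-bounds K (cut w)

  plug-cuts : ∀ (K : Context m₀ n₀ d m n) w → suc (cuts (plug-word K w)) ≡ d ℕ.+ cuts w
  plug-cuts start   w = refl
  plug-cuts (par K) w = plug-cuts K (par w)
  plug-cuts (ser K) w = plug-cuts K (ser w)
  plug-cuts (cut {d = d} K) w = trans (plug-cuts K (cut w)) (ℕ.+-suc d (cuts w))

  plug-fits : ∀ (K : Context m₀ n₀ d m n) {cs cs′} → (∀ {B} → Fits cs B → Fits cs′ B) →
              ∀ {B} → Fits (plug K cs) B → Fits (plug K cs′) B
  plug-fits start   f = f
  plug-fits (par K) f = plug-fits K λ { {b ∷ B} (i , g) → i , f g }
  plug-fits (ser K) f = plug-fits K λ { {b ∷ B} (i , g) → i , f g }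
  plug-fits (cut K) f = plug-fits K λ { {b ∷ b′ ∷ B} (i , j , g) → i , j , f g }

  in-strip : k ≡ m ⊎ k ≡ suc m → k between strip m
  in-strip (inj₁ refl) = ℕ.≤-refl , ℕ.n≤1+n _
  in-strip (inj₂ refl) = ℕ.n≤1+n _ , ℕ.≤-refl

  at : k ≡ m → k between (m , m)
  at refl = ℕ.≤-refl , ℕ.≤-refl

  to-point : ∀ (B : Subset n) → ∣ B ∣ ≡ m ⊎ ∣ B ∣ ≡ suc m → ∃ λ s → ∣ s ∷ B ∣ ≡ suc m
  to-point B (inj₁ eq) = inside , cong suc eq
  to-point B (inj₂ eq) = outside , eq

  plug-feasible : ∀ (K : Context m₀ n₀ d m n) {cs B} → Fits cs B → ∣ B ∣ ≡ m ⊎ ∣ B ∣ ≡ suc m →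
                  ∃ (Fits ((suc m₀ , suc m₀) ∷ plug K cs))
  plug-feasible start {B = B} f e = let s , eq = to-point B e in s ∷ B , at eq , f
  plug-feasible (par K) {B = B} f e = plug-feasible K {B = outside ∷ B} (in-strip e , f) e
  plug-feasible (ser K) {B = B} f e = plug-feasible K {B = inside ∷ B} (in-strip e′ , f) e′
    where e′ = [ (λ eq → inj₁ (cong suc eq)) , (λ eq → inj₂ (cong suc eq)) ]′ e
  plug-feasible (cut K) {B = B} f e = let s , eq = to-point B e in
    plug-feasible K {B = outside ∷ s ∷ B} (in-strip (inj₁ eq) , at eq , f) (inj₁ eq)

  HeadIneq : ℕ × ℕ → R → R^ (suc n) → Set
  HeadIneq (l , u) w x = (𝟎 ≼ x zero × x zero ≼ w) × (l ⊠ w ≼ ∑ x × ∑ x ≼ u ⊠ w)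

  rest : Context m₀ n₀ d m n → R^ n₀ → R^ n
  rest start   x = x
  rest (par K) x e = rest K x (suc e)
  rest (ser K) x e = rest K x (suc e)
  rest (cut K) x e = rest K x (suc (suc e))

  PreIneq : Context m₀ n₀ d m n → R → R^ n₀ → Set
  PreIneq start w x = Unit
  PreIneq (par {m = m} K) w x = PreIneq K w x × HeadIneq (strip m) w (rest K x)
  PreIneq (ser {m = m} K) w x = PreIneq K w x × HeadIneq (strip (suc m)) w (rest K x)
  PreIneq (cut {m = m} K) w x =
    PreIneq K w x × HeadIneq (strip (suc m)) w (rest K x) × HeadIneq (suc m , suc m) w (λ e → rest K x (suc e))

  plug-ineq⁻ : ∀ (K : Context m₀ n₀ d m n) {cs} → Ineq (plug K cs) w x → PreIneq K w x × Ineq cs w (rest K x)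
  plug-ineq⁻ start I = tt , I
  plug-ineq⁻ (par K) I = let p , b , c , I = plug-ineq⁻ K I in (p , b , c) , I
  plug-ineq⁻ (ser K) I = let p , b , c , I = plug-ineq⁻ K I in (p , b , c) , I
  plug-ineq⁻ (cut K) I = let p , b , c , b′ , c′ , I = plug-ineq⁻ K I in (p , (b , c) , (b′ , c′)) , I

  plug-ineq⁺ : ∀ (K : Context m₀ n₀ d m n) {cs} → PreIneq K w x → Ineq cs w (rest K x) → Ineq (plug K cs) w x
  plug-ineq⁺ start _ I = I
  plug-ineq⁺ (par K) (p , b , c) I = plug-ineq⁺ K p (b , c , I)
  plug-ineq⁺ (ser K) (p , b , c) I = plug-ineq⁺ K p (b , c , I)
  plug-ineq⁺ (cut K) (p , (b , c) , (b′ , c′)) I = plug-ineq⁺ K p (b , c , b′ , c′ , I)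

  0≼𝟏 : 𝟎 ≼ 𝟏
  0≼𝟏 = ≼-intro λ ε 0<ε → 0 , λ i _ → ℚ.≤-trans (ℚ.<⇒≤ 0<ε) (ℚ.≤-trans (ℚ.≤-reflexive (sym (ℚ.+-identityˡ ε)))
    (ℚ.+-monoˡ-≤ ε (ℚ.nonNegative⁻¹ 1ℚ)))

  -- The context imposes the same inequalities, `PreIneq`, on all four pieces, so a subdivision in
  -- the hole persists; integrality translates between inequalities and cones.
  subdivision-lift : ∀ {k : ℕ} (K : Context m₀ n₀ d m n) {cs cs₁ cs₂ cs₃} →
    Subdivision (Ineq cs 𝟏) (Ineq cs₁ 𝟏) (Ineq cs₂ 𝟏) (Ineq cs₃ 𝟏) →
    Subdivision (Cone (Fits ((k , k) ∷ plug K cs)) 𝟏) (Cone (Fits ((k , k) ∷ plug K cs₁)) 𝟏)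
                (Cone (Fits ((k , k) ∷ plug K cs₂)) 𝟏) (Cone (Fits ((k , k) ∷ plug K cs₃)) 𝟏)
  subdivision-lift {n₀ = n₀} {k = k} K S = record
    { part₁  = λ {x} C → lift part₁ {x} (cone⇒ineq C) >>= ineq⇒cone 0≼𝟏
    ; part₂  = λ {x} C → lift part₂ {x} (cone⇒ineq C) >>= ineq⇒cone 0≼𝟏
    ; face₁  = λ {x} C → lift face₁ {x} (cone⇒ineq C) >>= ineq⇒cone 0≼𝟏
    ; face₂  = λ {x} C → lift face₂ {x} (cone⇒ineq C) >>= ineq⇒cone 0≼𝟏
    ; meet   = λ C D → let b , c , I = cone⇒ineq C
                           _ , _ , J = cone⇒ineq D
                           p , I = plug-ineq⁻ K I
                           _ , J = plug-ineq⁻ K J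
                       in meet I J >>= λ I → ineq⇒cone 0≼𝟏 (b , c , plug-ineq⁺ K p I)
    ; covers = λ C → let b , c , I = cone⇒ineq C
                         p , I = plug-ineq⁻ K I
                     in covers I >>= λ
                        { (inj₁ I) → ineq⇒cone 0≼𝟏 (b , c , plug-ineq⁺ K p I) >>= λ C → pure (inj₁ C)
                        ; (inj₂ I) → ineq⇒cone 0≼𝟏 (b , c , plug-ineq⁺ K p I) >>= λ C → pure (inj₂ C) }
    }
    where
    open Subdivision S
    lift : ∀ {cs cs′} → (∀ {x} → Ineq cs 𝟏 x → ¬¬ Ineq cs′ 𝟏 x) →
           ∀ {x : R^ (suc n₀)} → Ineq ((k , k) ∷ plug K cs) 𝟏 x → ¬¬ Ineq ((k , k) ∷ plug K cs′) 𝟏 x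
    lift f (b , c , I) = let p , I = plug-ineq⁻ K I in f I >>= λ I → pure (b , c , plug-ineq⁺ K p I)

  free : ∀ n → Bounds n
  free zero    = []
  free (suc n) = (0 , suc n) ∷ free n

  fits-free : ∀ (B : Subset n) → Fits (free n) B
  fits-free []      = tt
  fits-free (b ∷ B) = (z≤n , ∣p∣≤n (b ∷ B)) , fits-free B

  -- The case distinction on the next partial sum: at most m + 1 or at least m + 1.
  free-subdivision : ∀ {m n} → m < n → 
    Subdivision (Ineq (strip (suc m) ∷ free (suc n)) 𝟏)
                (Ineq (strip (suc m) ∷ strip m ∷ free n) 𝟏)
                (Ineq (strip (suc m) ∷ strip (suc m) ∷ free n) 𝟏)
                (Ineq (strip (suc m) ∷ (suc m , suc m) ∷ free n) 𝟏)
  free-subdivision {m} {n} m<n = record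
    { part₁  = λ {x} (b , c , I) → pure (b , c , widen {l = m} (x ∘ suc) z≤n (s≤s (ℕ.<⇒≤ m<n)) I)
    ; part₂  = λ {x} (b , c , I) → pure (b , c , widen {l = suc m} (x ∘ suc) z≤n (s≤s m<n) I)
    ; face₁  = λ {x} (b , c , I) → pure (b , c , widen {l = suc m} {u = suc m} (x ∘ suc) (ℕ.n≤1+n m) ℕ.≤-refl I)
    ; face₂  = λ {x} (b , c , I) → pure (b , c , widen {l = suc m} {u = suc m} (x ∘ suc) ℕ.≤-refl (ℕ.n≤1+n (suc m)) I)
    ; meet   = λ (b , c , b′ , (_ , ≤u) , I) (_ , _ , _ , (l≤ , _) , _) → pure (b , c , b′ , (l≤ , ≤u) , I)
    -- The comparison gives one bound of the new strip. The other one follows from the strip above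
    -- it, because the coordinate left out lies between 0 and 1.
    ; covers = λ {x} ((0≤ , ≤w) , (l≤ , ≤u) , b′ , (l≤′ , ≤u′) , I) → compare (∑ (x ∘ suc)) (suc m ⊠ 𝟏) >>= λ
        { (inj₁ ≤m) → pure (inj₁ ((0≤ , ≤w) , (l≤ , ≤u) , b′ ,
            (≼-by (≼-+ l≤ ≤w) (λ i → solve 4 (λ w x s M → s :- M := (x :+ s :+ w) :- (w :+ M :+ x)) refl
               (app 𝟏 i) (app (x zero) i) (app (∑ (x ∘ suc)) i) (app (m ⊠ 𝟏) i)) , ≤m) , I))
        ; (inj₂ m≤) → pure (inj₂ ((0≤ , ≤w) , (l≤ , ≤u) , b′ ,
            (m≤ , ≼-by (≼-+ ≤u 0≤) (λ i → solve 3 (λ x s M → M :- s := (M :+ x) :- (x :+ s :+ con 0ℚ)) refl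
               (app (x zero) i) (app (∑ (x ∘ suc)) i) (app (suc (suc m) ⊠ 𝟏) i))) , I)) }
    }
    where
    widen : ∀ {n l l′ u u′ cs} (x : R^ (suc n)) → l′ ≤ l → u ≤ u′ → Ineq ((l , u) ∷ cs) 𝟏 x → Ineq ((l′ , u′) ∷ cs) 𝟏 x
    widen x l′≤l u≤u′ (b , (l≤ , ≤u) , I) =
      b , (≼-trans (⊠-mono l′≤l 0≼𝟏) l≤ , ≼-trans ≤u (⊠-mono u≤u′ 0≼𝟏)) , I

  sign : ℕ → ℤ
  sign d = -1ℤ ℤ.^ d

  δ : ℕ → ℕ → ℕ
  δ i d = if does (i ℕ.≟ d) then 1 else 0

  -- words d m n i is the number of words in Word m (n + 1) with i − d cuts.
  words : ℕ → ℕ → ℕ → ℕ → ℕ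
  words d zero    zero          i = δ i d
  words d (suc m) zero          i = 0
  words d zero    (suc n)       i = words d zero n i
  -- A `cut` here would continue with a word in `Word m 0`, and there is none.
  words d (suc m) (suc zero)    i = words d (suc m) zero i ℕ.+ words d m zero i
  words d (suc m) (suc (suc n)) i = words d (suc m) (suc n) i ℕ.+ words d m (suc n) i ℕ.+ words (suc d) m n i

  words-zero : ∀ {d m n i} → n < m → words d m n i ≡ 0
  words-zero {m = suc m} {zero}        n<m = refl
  words-zero {d} {suc m} {suc zero} {i} n<m = words-zero {d} {m} {zero} {i} (ℕ.s<s⁻¹ n<m)
  words-zero {d} {suc m} {suc (suc n)} {i} n<m
    rewrite words-zero {d} {suc m} {suc n} {i} (ℕ.<-trans (ℕ.n<1+n _) n<m)
          | words-zero {d} {m} {suc n} {i} (ℕ.s<s⁻¹ n<m)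
          = words-zero {suc d} {m} {n} {i} (ℕ.<-trans (ℕ.n<1+n _) (ℕ.s<s⁻¹ n<m))

  module Evaluation {m₀ n₀} {v : Matroid (suc n₀) → ℤ} (V : Valuative v) (i : ℕ)
    (v-word : ∀ (w : Word m₀ n₀) feasible →
              v (LP (suc m₀) (bounds w) feasible) ≡ sign (suc (cuts w)) ℤ.* + δ i (suc (cuts w))) where

    state-feasible : ∀ (K : Context m₀ n₀ d m (suc n)) → m ≤ n → ∃ (Fits ((suc m₀ , suc m₀) ∷ plug K (strip m ∷ free n)))
    state-feasible {m = m} {n} K m≤n with someBasis (U m (suc n) (ℕ.m≤n⇒m≤1+n m≤n))
    ... | b ∷ B , eq = plug-feasible K {B = b ∷ B} (in-strip (inj₁ eq) , fits-free B) (inj₁ eq)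

    state : ∀ (K : Context m₀ n₀ d m (suc n)) → m ≤ n → Matroid (suc n₀)
    state {m = m} {n} K m≤n = LP (suc m₀) (plug K (strip m ∷ free n)) (state-feasible K m≤n)

    fits-cong : ∀ (K : Context m₀ n₀ d m n) {cs cs′ k} → (∀ {B} → Fits cs B → Fits cs′ B) → (∀ {B} → Fits cs′ B → Fits cs B) →
              (∀ {B} → Fits ((k , k) ∷ plug K cs) B → Fits ((k , k) ∷ plug K cs′) B) ×
              (∀ {B} → Fits ((k , k) ∷ plug K cs′) B → Fits ((k , k) ∷ plug K cs) B)
    fits-cong K f g = (λ { {b ∷ B} (i , h) → i , plug-fits K f h }) , (λ { {b ∷ B} (i , h) → i , plug-fits K g h })

    tail-≥ : ∀ s (B : Subset n) → suc m ≤ ∣ s ∷ B ∣ → m ≤ ∣ B ∣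
    tail-≥ true  B = ℕ.s≤s⁻¹
    tail-≥ false B = ℕ.<⇒≤

    tail-≤ : ∀ s (B : Subset n) → ∣ s ∷ B ∣ ≤ m → ∣ B ∣ ≤ m
    tail-≤ true  B = ℕ.<⇒≤
    tail-≤ false B = id

    -- In general the polytope is cut in two along the next segment, and the common face is
    -- subtracted. That face has one more block, hence the opposite sign, and the three counts add
    -- up as in the recursion of `words`. When the strip is the lowest or the highest possible one,
    -- the next strip is forced, and equality of bases replaces the subdivision.
    v-state : ∀ n {m d} (m≤n : m ≤ n) (K : Context m₀ n₀ d m (suc n)) →
              v (state K m≤n) ≡ sign d ℤ.* + words d m n i
    v-state-split : ∀ n {m d} (m≤n : m ≤ n) (K : Context m₀ n₀ d (suc m) (suc (suc n))) → m < n ⊎ m ≡ n →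
                    v (state K (s≤s m≤n)) ≡ sign d ℤ.* + words d (suc m) (suc n) i
    v-state zero {zero} {d} z≤n K = v-refined d (plug-word K last) (plug-bounds K last)
        (trans (plug-cuts K last) (ℕ.+-identityʳ d)) _
      where
      v-refined : ∀ d (w : Word m₀ n₀) {cs} → cs ≡ bounds w → suc (cuts w) ≡ d → ∀ f → v (LP (suc m₀) cs f) ≡ sign d ℤ.* + δ i d
      v-refined _ w refl refl f = v-word w f
    v-state (suc n) {zero} z≤n K = trans
      (valuation-cong V {state K z≤n} {state (par K) z≤n} (fits-cong K
        (λ { {b ∷ b′ ∷ B} ((_ , ≤1) , (_ , _) , f) → (z≤n , ≤1) , (z≤n , tail-≤ b (b′ ∷ B) ≤1) , f })
        (λ { {b ∷ b′ ∷ B} (j , _ , f) → j , (z≤n , ∣p∣≤n (b′ ∷ B)) , f })))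
      (v-state n z≤n (par K))
    v-state (suc n) {suc m} (s≤s m≤n) K = v-state-split n m≤n K (ℕ.m≤n⇒m<n∨m≡n m≤n)

    v-state-split n {m} {d} m≤n K (inj₂ refl) = trans
      (valuation-cong V {state K (s≤s m≤n)} {state (ser K) m≤n} (fits-cong K
        (λ { {b ∷ b′ ∷ B} (j@(≤j , _) , _ , f) → j , (tail-≥ b (b′ ∷ B) ≤j , ∣p∣≤n (b′ ∷ B)) , f })
        (λ { {b ∷ b′ ∷ B} (j , _ , f) → j , (z≤n , ∣p∣≤n (b′ ∷ B)) , f })))
      (trans (v-state n m≤n (ser K)) (cong (λ z → sign d ℤ.* + z) (sym (top n))))
      where
      top : ∀ n → words d (suc n) (suc n) i ≡ words d n n i
      top zero    = refl
      top (suc n) rewrite words-zero {d} {suc (suc n)} {suc n} {i} (ℕ.n<1+n _)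
                        | words-zero {suc d} {suc n} {n} {i} (ℕ.n<1+n _) = ℕ.+-identityʳ _
    v-state-split (suc n) {m} {d} m≤n K (inj₁ (s≤s m<n)) = begin
      v (state K (s≤s m≤n))
        ≡⟨ valuation-union V {M = state K (s≤s m≤n)} {state (ser K) m≤n} {state (par K) (s≤s m<n)}
             {point}
             (subdivision-lift K (free-subdivision (s≤s m<n))) ⟩
      v (state (ser K) m≤n) ℤ.+ v (state (par K) (s≤s m<n)) ℤ.- v point
        ≡⟨ cong₂ ℤ._-_ (cong₂ ℤ._+_ (v-state (suc n) m≤n (ser K)) (v-state (suc n) (s≤s m<n) (par K)))
                       (trans point≡ (v-state n m<n (cut K))) ⟩
      sign d ℤ.* + words d m (suc n) i ℤ.+ sign d ℤ.* + words d (suc m) (suc n) i ℤ.- -1ℤ ℤ.* sign d ℤ.* + words (suc d) m n i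
        ≡⟨ ℤS.solve 4 (λ s x y z → s ℤS.:* x ℤS.:+ s ℤS.:* y ℤS.:- ℤS.con -1ℤ ℤS.:* s ℤS.:* z ℤS.:= s ℤS.:* (y ℤS.:+ x ℤS.:+ z)) refl
             (sign d) (+ words d m (suc n) i) (+ words d (suc m) (suc n) i) (+ words (suc d) m n i) ⟩
      sign d ℤ.* + words d (suc m) (suc (suc n)) i  ∎
      where
      open ≡-Reasoning
      point-feasible : ∃ (Fits ((suc m₀ , suc m₀) ∷ plug K (strip (suc m) ∷ (suc m , suc m) ∷ free (suc n))))
      point-feasible = let B , f = state-feasible (cut K) m<n in B , widen f
        where
        widen : ∀ {B} → Fits ((suc m₀ , suc m₀) ∷ plug (cut K) (strip m ∷ free n)) B →
                Fits ((suc m₀ , suc m₀) ∷ plug K (strip (suc m) ∷ (suc m , suc m) ∷ free (suc n))) B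
        widen {b ∷ B} (j , f) = j , plug-fits K (λ { {_ ∷ _ ∷ b ∷ B} (j , j′ , _ , f) → j , j′ , (z≤n , ∣p∣≤n (b ∷ B)) , f }) f
      point : Matroid (suc n₀)
      point = LP (suc m₀) (plug K (strip (suc m) ∷ (suc m , suc m) ∷ free (suc n))) point-feasible
      -- A segment containing exactly `m + 1` elements forces the strip `m` on the next shorter one.
      point≡ : v point ≡ v (state (cut K) m<n)
      point≡ = valuation-cong V {point} {state (cut K) m<n} (fits-cong K
        (λ { {_ ∷ b ∷ b′ ∷ B} (j , j′@(≤j , j≤) , _ , f) → j , j′ , (tail-≥ b (b′ ∷ B) ≤j , tail-≤ b (b′ ∷ B) j≤) , f })
        (λ { {_ ∷ b ∷ b′ ∷ B} (j , j′ , _ , f) → j , j′ , (z≤n , ∣p∣≤n (b′ ∷ B)) , f }))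

open Valuations

-- Counting connected components

module Components where

  private variable
    n : ℕ

  ⟦_⟧ : {P : Fin n → Set} → (∀ x → Dec (P x)) → Subset n
  ⟦ P? ⟧ = tabulate λ x → does (P? x)

  ∈⟦⟧⁺ : ∀ {P : Fin n → Set} (P? : ∀ x → Dec (P x)) {x} → P x → x ∈ ⟦ P? ⟧
  ∈⟦⟧⁺ P? {x} Px = Vec.lookup⇒[]= x _ (trans (Vec.lookup∘tabulate _ x) does≡true)
    where
    does≡true : does (P? x) ≡ true
    does≡true with P? x
    ... | yes _  = refl
    ... | no ¬Px = contradiction Px ¬Px

  ∈⟦⟧⁻ : ∀ {P : Fin n → Set} (P? : ∀ x → Dec (P x)) {x} → x ∈ ⟦ P? ⟧ → P x
  ∈⟦⟧⁻ P? {x} x∈ with P? x | trans (sym (Vec.lookup∘tabulate (λ x → does (P? x)) x)) (Vec.[]=⇒lookup x∈)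
  ... | yes Px | _ = Px

  connected-sym : ∀ (M : Matroid n) {e f} → Connected M e f → Connected M f e
  connected-sym M (inj₁ refl)              = inj₁ refl
  connected-sym M (inj₂ (C , c , e∈ , f∈)) = inj₂ (C , c , f∈ , e∈)

  -- The common circuit is the fundamental circuit of e with respect to B.
  swap⇒connected : ∀ (M : Matroid n) {B e f} → Basis M B → f ∈ B → e ∉ B → Basis M (exchange B f e) → Connected M e f
  swap⇒connected M {B} {e} {f} b f∈ e∉ b′ =
    inj₂ (C , (dependent , proper) , ∈⟦⟧⁺ P? (inj₁ refl) , ∈⟦⟧⁺ P? (inj₂ (f∈ , b′)))
    where
    P? = λ x → (x Fin.≟ e) ⊎-dec ((x ∈? B) ×-dec basis? M (exchange B x e))
    C = ⟦ P? ⟧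
    dependent : Dependent M C
    dependent (B′ , b″ , C⊆B′) =
      let x , x∈ , x∉ , b = dual-exchange M b b″ (C⊆B′ (∈⟦⟧⁺ P? (inj₁ refl))) e∉
      in x∉ (C⊆B′ (∈⟦⟧⁺ P? (inj₂ (x∈ , b))))
    proper : ∀ D → D ⊂ C → Independent M D
    proper D (D⊆C , y , y∈C , y∉D) with ∈⟦⟧⁻ P? y∈C
    ... | inj₁ refl = B , b , λ z∈D →
      [ (λ { refl → contradiction z∈D y∉D }) , proj₁ ]′ (∈⟦⟧⁻ P? (D⊆C z∈D))
    ... | inj₂ (y∈B , b) = exchange B y e , b , λ z∈D →
      [ (λ { refl → ∈exchangeʳ y e })
      , (λ (z∈B , _) → ∈exchangeˡ y e z∈B (λ { refl → y∉D z∈D })) ]′ (∈⟦⟧⁻ P? (D⊆C z∈D))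

  mix : Subset n → Subset n → Subset n → Subset n
  mix []          []        []        = []
  mix (true  ∷ A) (b₁ ∷ B₁) (b₂ ∷ B₂) = b₁ ∷ mix A B₁ B₂
  mix (false ∷ A) (b₁ ∷ B₁) (b₂ ∷ B₂) = b₂ ∷ mix A B₁ B₂

  ∈-mixˡ : ∀ {A B₁ B₂ : Subset n} {z} → z ∈ A → z ∈ B₁ → z ∈ mix A B₁ B₂
  ∈-mixˡ {A = true  ∷ A} {_ ∷ B₁} {_ ∷ B₂} here       here       = here
  ∈-mixˡ {A = true  ∷ A} {_ ∷ B₁} {_ ∷ B₂} (there z∈) (there z∈′) = there (∈-mixˡ z∈ z∈′)
  ∈-mixˡ {A = false ∷ A} {_ ∷ B₁} {_ ∷ B₂} (there z∈) (there z∈′) = there (∈-mixˡ z∈ z∈′)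

  ∈-mixʳ : ∀ {A B₁ B₂ : Subset n} {z} → z ∉ A → z ∈ B₂ → z ∈ mix A B₁ B₂
  ∈-mixʳ {A = true  ∷ A} {_ ∷ B₁} {_ ∷ B₂} z∉ here       = contradiction here z∉
  ∈-mixʳ {A = false ∷ A} {_ ∷ B₁} {_ ∷ B₂} z∉ here       = here
  ∈-mixʳ {A = true  ∷ A} {_ ∷ B₁} {_ ∷ B₂} z∉ (there z∈) = there (∈-mixʳ (z∉ ∘ there) z∈)
  ∈-mixʳ {A = false ∷ A} {_ ∷ B₁} {_ ∷ B₂} z∉ (there z∈) = there (∈-mixʳ (z∉ ∘ there) z∈)

  -- A circuit meeting both sides would have independent traces on `A` and on its complement. Mixing
  -- bases that extend these traces gives a basis containing the circuit.
  separated : ∀ (M : Matroid n) A → (∀ {B₁ B₂} → Basis M B₁ → Basis M B₂ → Basis M (mix A B₁ B₂)) →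
              ∀ {e f} → e ∈ A → f ∉ A → ¬ Connected M e f
  separated M A closed e∈A f∉A (inj₁ refl) = f∉A e∈A
  separated M A closed {e} {f} e∈A f∉A (inj₂ (C , (dependent , proper) , e∈C , f∈C)) =
    dependent (mix A B₁ B₂ , closed b₁ b₂ , λ {z} z∈C → [ (λ z∈A → ∈-mixˡ z∈A (⊆₁ (∈⟦⟧⁺ in? (z∈C , z∈A))))
                                                       , (λ z∉A → ∈-mixʳ z∉A (⊆₂ (∈⟦⟧⁺ out? (z∈C , z∉A)))) ]′ (em z))
    where
    em : ∀ z → z ∈ A ⊎ z ∉ A
    em z with z ∈? A
    ... | yes z∈ = inj₁ z∈
    ... | no z∉  = inj₂ z∉
    in?  = λ z → (z ∈? C) ×-dec (z ∈? A)
    out? = λ z → (z ∈? C) ×-dec ¬? (z ∈? A)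
    i₁ = proper ⟦ in? ⟧ (proj₁ ∘ ∈⟦⟧⁻ in? , f , f∈C , f∉A ∘ proj₂ ∘ ∈⟦⟧⁻ in?)
    i₂ = proper ⟦ out? ⟧ (proj₁ ∘ ∈⟦⟧⁻ out? , e , e∈C , λ e∈ → proj₂ (∈⟦⟧⁻ out? e∈) e∈A)
    B₁ = proj₁ i₁ ; b₁ = proj₁ (proj₂ i₁) ; ⊆₁ = proj₂ (proj₂ i₁)
    B₂ = proj₁ i₂ ; b₂ = proj₁ (proj₂ i₂) ; ⊆₂ = proj₂ (proj₂ i₂)

  -- By identifying `Connected` with equality of colours, this shows that it is an equivalence
  -- relation with `p` classes.
  record Colouring (M : Matroid n) (p : ℕ) : Set where
    field
      colour    : Fin n → ℕ
      connected : ∀ {e f} → colour e ≡ colour f → Connected M e f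
      coloured  : ∀ {e f} → Connected M e f → colour e ≡ colour f
      in-range   : ∀ e → colour e < p
      attained  : ∀ {j} → j < p → ∃ λ e → colour e ≡ j

  -- The representatives kept by `deduplicate` have pairwise different colours, and every colour
  -- occurs among them.
  components≡ : ∀ (M : Matroid n) {p} → Colouring M p → components M ≡ p
  components≡ {n} M {p} K = begin
    length L                ≡⟨ List.length-map colour L ⟨
    length (map colour L)   ≡⟨ ↭-length (∼bag⇒↭ (unique∧set⇒bag unique (Unique.upTo⁺ p) (mk⇔ to from))) ⟩
    length (upTo p)         ≡⟨ List.length-upTo p ⟩
    p                       ∎
    where
    open Colouring K
    open ≡-Reasoning
    L = deduplicate (connected? M) (allFin n)
    pairs : ∀ xs → AllPairs (λ e f → ¬ Connected M e f) (deduplicate (connected? M) xs)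
    pairs []       = []
    pairs (x ∷ xs) = All.all-filter _ (deduplicate (connected? M) xs) ∷ AllPairs.filter⁺ _ (pairs xs)
    unique : Unique (map colour L)
    unique = AllPairs.map⁺ (AllPairs.map (λ ¬c eq → ¬c (connected eq)) (pairs (allFin n)))
    to : ∀ {j} → j ∈ᴸ map colour L → j ∈ᴸ upTo p
    to j∈ with List∈.∈-map⁻ colour j∈
    ... | e , _ , refl = List∈.∈-upTo⁺ (in-range e)
    from : ∀ {j} → j ∈ᴸ upTo p → j ∈ᴸ map colour L
    from {j} j∈ = let e , eq = attained (List∈.∈-upTo⁻ j∈) in
      Any.map⁺ (Any.deduplicate⁺ (connected? M) (λ c eq → trans eq (sym (coloured c)))
                 (lose (List∈.∈-allFin e) (sym eq)))

open Components

-- The matroid of a word: its bases, blocks and components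

module WordComponents where

  private variable
    d m n k l p : ℕ

  image-id : ∀ (B : Subset n) → image Perm.id B ≡ B
  image-id B = Vec.tabulate∘lookup B

  ≐⇒≅ : {M N : Matroid n} → M ≐ N → M ≅ N
  ≐⇒≅ {N = N} (f , g) = Perm.id , λ B →
    mk⇔ (λ b → subst (Basis N) (sym (image-id B)) (f b)) (λ b → g (subst (Basis N) (image-id B) b))

  -- The coefficients of g in degree i, on matroids of a fixed size.

  record SpeyerCoefficient {n} (i : ℕ) (γ : Matroid n → ℤ) : Set₁ where
    field
      v         : Matroid n → ℤ
      v≡        : ∀ M → v M ≡ sign (components M) ℤ.* γ M
      valuative : Valuative v
      ≅-cong    : ∀ {M N} → M ≅ N → γ M ≡ γ N
      degenerate : ∀ {M} → ∃ (Loop M) ⊎ ∃ (Coloop M) → γ M ≡ 0ℤ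
      series-parallel : ∀ {M} → ¬ ∃ (Loop M) → ¬ ∃ (Coloop M) → ∀ Ms → All (SeriesParallel ∘ proj₂) Ms →
                        M ≅ ⨁ Ms → γ M ≡ + δ i (length Ms)

  -- A positive form of the absence of loops and coloops.
  Free : Matroid n → Set
  Free M = ∀ e → (∃ λ B → Basis M B × e ∈ B) × (∃ λ B → Basis M B × e ∉ B)

  record Decomposition (M : Matroid n) (p : ℕ) : Set₁ where
    field
      {summands} : List (∃ Matroid)
      all-sp     : All (SeriesParallel ∘ proj₂) summands
      count      : length summands ≡ p
      iso        : M ≅ ⨁ summands

  module _ {i} {γ : Matroid n → ℤ} (S : SpeyerCoefficient i γ) where
    open SpeyerCoefficient S

    γ-decomposition : ∀ {M} → Free M → Decomposition M p → γ M ≡ + δ i p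
    γ-decomposition free D = trans
      (series-parallel (λ (e , loop) → let (B , b , e∈) , _ = free e in loop B b e∈)
                       (λ (e , coloop) → let _ , (B , b , e∉) = free e in e∉ (coloop B b))
                       _ all-sp iso)
      (cong (λ p → + δ i p) count)
      where open Decomposition D

    v-decomposition : ∀ {M} → Free M → Decomposition M p → Colouring M p → v M ≡ sign p ℤ.* + δ i p
    v-decomposition {M = M} free D K =
      trans (v≡ M) (cong₂ (λ c g → sign c ℤ.* g) (components≡ M K) (γ-decomposition free D))

  -- The components of the matroid of a word are its blocks.

  Whole : Word m n → Subset (suc n) → Set
  Whole {m} w = Fits ((suc m , suc m) ∷ bounds w)

  word-bounds : ∀ (w : Word m n) {B} → Fits (bounds w) B → ∣ B ∣ between strip m
  word-bounds last    {_ ∷ _} (i , _) = i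
  word-bounds (par w) {_ ∷ _} (i , _) = i
  word-bounds (ser w) {_ ∷ _} (i , _) = i
  word-bounds (cut w) {_ ∷ _} (i , _) = i

  fill : ∀ (w : Word m n) s → ∃ λ B → Fits (bounds w) B × ∣ B ∣ ≡ (if s then suc m else m)
  fill last false = outside ∷ [] , ((z≤n , z≤n) , tt) , refl
  fill last true  = inside ∷ [] , ((z≤n , s≤s z≤n) , tt) , refl
  fill (par w) s =
    let B , f , eq = fill w s in outside ∷ B , (in-strip (eq⇒ s eq) , f) , eq
    where
    eq⇒ : ∀ s {B m} → B ≡ (if s then suc m else m) → B ≡ m ⊎ B ≡ suc m
    eq⇒ true  = inj₂
    eq⇒ false = inj₁
  fill (ser {m = m} w) s =
    let B , f , eq = fill w s in inside ∷ B , (in-strip (eq⇒ s (cong suc eq)) , f) , trans (cong suc eq) (suc-if s)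
    where
    suc-if : ∀ s → suc (if s then suc m else m) ≡ (if s then suc (suc m) else suc m)
    suc-if true  = refl
    suc-if false = refl
    eq⇒ : ∀ s {B} → B ≡ suc (if s then suc m else m) → B ≡ suc m ⊎ B ≡ suc (suc m)
    eq⇒ true  = inj₂
    eq⇒ false = inj₁
  fill (cut w) s with fill w true
  fill (cut w) false | B , f , eq = outside ∷ outside ∷ B , (in-strip (inj₁ eq) , at eq , f) , eq
  fill (cut w) true  | B , f , eq = inside ∷ outside ∷ B , (in-strip (inj₂ (cong suc eq)) , at eq , f) , cong suc eq

  word-feasible : ∀ (w : Word m n) → ∃ (Whole w)
  word-feasible w = let B , f , eq = fill w true in outside ∷ B , at eq , f

  wordMatroid : Word m n → Matroid (suc n)
  wordMatroid {m} w = LP (suc m) (bounds w) (word-feasible w)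

  ∷-whole : ∀ (w : Word m n) {B} → Fits (bounds w) B → ∃ λ s → Whole w (s ∷ B)
  ∷-whole w {B} f = let s , eq = to-point B (strip⇒ (word-bounds w f)) in s , at eq , f
    where
    strip⇒ : ∀ {j m} → j between strip m → j ≡ m ⊎ j ≡ suc m
    strip⇒ (m≤j , j≤) with ℕ.m≤n⇒m<n∨m≡n m≤j
    ... | inj₁ m<j  = inj₂ (ℕ.≤-antisym j≤ m<j)
    ... | inj₂ refl = inj₁ refl

  choose : ∀ (w : Word m n) e s → ∃ λ B → Fits (bounds w) B × lookup B e ≡ s
  choose last zero s = let B , f , eq = single s in B , f , eq
    where
    single : ∀ s → ∃ λ B → Fits (bounds last) B × lookup B zero ≡ s
    single true  = inside ∷ [] , ((z≤n , s≤s z≤n) , tt) , refl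
    single false = outside ∷ [] , ((z≤n , z≤n) , tt) , refl
  choose (par w) zero true  = let B , f , eq = fill w false in
    inside ∷ B , (in-strip (inj₂ (cong suc eq)) , f) , refl
  choose (par w) zero false = let B , f , eq = fill w false in
    outside ∷ B , (in-strip (inj₁ eq) , f) , refl
  choose (ser w) zero true  = let B , f , eq = fill w false in
    inside ∷ B , (in-strip (inj₁ (cong suc eq)) , f) , refl
  choose (ser w) zero false = let B , f , eq = fill w true in
    outside ∷ B , (in-strip (inj₁ eq) , f) , refl
  choose (cut w) zero s = let B , f , eq = fill w true in
    s ∷ outside ∷ B , (bit s (outside ∷ B) eq , at eq , f) , refl
    where
    bit : ∀ s (B : Subset n) → ∣ B ∣ ≡ suc m → ∣ s ∷ B ∣ between strip (suc m)
    bit true  _ eq = in-strip (inj₂ (cong suc eq))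
    bit false _ eq = in-strip (inj₁ eq)
  choose (par w) (suc e) s = let B , f , eq = choose w e s in outside ∷ B , (word-bounds w f , f) , eq
  choose (ser w) (suc e) s = let B , f , eq = choose w e s
                                 l , u = word-bounds w f in inside ∷ B , ((s≤s l , s≤s u) , f) , eq
  choose (cut w) (suc zero) true  = let B , f , eq = fill w false in
    outside ∷ inside ∷ B , (in-strip (inj₁ (cong suc eq)) , at (cong suc eq) , f) , refl
  choose (cut w) (suc zero) false = let B , f , eq = fill w true in
    outside ∷ outside ∷ B , (in-strip (inj₁ eq) , at eq , f) , refl
  choose (cut w) (suc (suc e)) s = let B , f , eq = choose w e s
                                       t , (l , u) , f = ∷-whole w f
    in outside ∷ t ∷ B , ((l , ℕ.m≤n⇒m≤1+n u) , (l , u) , f) , eq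

  lookup-false⇒∉ : ∀ {B : Subset n} {e} → lookup B e ≡ false → e ∉ B
  lookup-false⇒∉ eq e∈ = contradiction (trans (sym (Vec.[]=⇒lookup e∈)) eq) λ ()

  word-free : ∀ (w : Word m n) → Free (wordMatroid w)
  word-free w zero =
    (let B , f , eq = fill w false in inside ∷ B , (at (cong suc eq) , f) , here) ,
    (let B , f , eq = fill w true in outside ∷ B , (at eq , f) , λ ())
  word-free w (suc e) =
    (let B , f , eq = choose w e true ; s , f = ∷-whole w f in s ∷ B , f , there (Vec.lookup⇒[]= e B eq)) ,
    (let B , f , eq = choose w e false ; s , f = ∷-whole w f in s ∷ B , f , λ { (there e∈) → lookup-false⇒∉ eq e∈ })

  -- Blocks are numbered from the left. The first of the two elements consumed by a `cut` still
  -- belongs to the block in progress; the segment of prescribed size, and with it the next block,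
  -- starts at the second one.
  block : Word m n → Fin n → ℕ
  wholeBlock : Word m n → Fin (suc n) → ℕ

  block last    e       = 0
  block (par w)         = wholeBlock w
  block (ser w)         = wholeBlock w
  block (cut w) zero    = 0
  block (cut w) (suc e) = suc (wholeBlock w e)

  wholeBlock w zero    = 0
  wholeBlock w (suc e) = block w e

  -- Up to an element of block 0, every segment still admits both sizes of its strip. A set with the
  -- larger size in all of them stays admissible when `f` is taken out, which makes room for an
  -- element further left.
  lower : ∀ (w : Word m n) f → block w f ≡ 0 →
          ∃ λ B → Fits (bounds w) B × ∣ B ∣ ≡ suc m × f ∈ B × Fits (bounds w) (B -′ f)
  lower last zero _ = inside ∷ [] , ((z≤n , s≤s z≤n) , tt) , refl , here , ((z≤n , z≤n) , tt)
  lower (par w) zero _ = let B , f , eq = fill w false in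
    inside ∷ B , (in-strip (inj₂ (cong suc eq)) , f) , cong suc eq , here , (in-strip (inj₁ eq) , f)
  lower (ser w) zero _ = let B , f , eq = fill w true in
    inside ∷ B , (in-strip (inj₂ (cong suc eq)) , f) , cong suc eq , here , (in-strip (inj₁ eq) , f)
  lower (cut w) zero _ = let B , f , eq = fill w true in
    inside ∷ outside ∷ B , (in-strip (inj₂ (cong suc eq)) , at eq , f) , cong suc eq , here , (in-strip (inj₁ eq) , at eq , f)
  lower (par w) (suc e) eq₀ = let B , f , eq , e∈ , f′ = lower w e eq₀ in
    outside ∷ B , (in-strip (inj₂ eq) , f) , eq , there e∈ ,
    (in-strip (inj₁ (ℕ.suc-injective (trans (∣-′∣ e∈) eq))) , f′)
  lower (ser w) (suc e) eq₀ = let B , f , eq , e∈ , f′ = lower w e eq₀ in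
    inside ∷ B , (in-strip (inj₂ (cong suc eq)) , f) , cong suc eq , there e∈ ,
    (in-strip (inj₁ (trans (∣-′∣ e∈) eq)) , f′)

  Swap : ∀ {n} → (Subset n → Set) → Fin n → Fin n → Set
  Swap F e f = ∃ λ B → F B × f ∈ B × e ∉ B × F (B -′ f +′ e)

  swap : ∀ (w : Word m n) {e f} → e Fin.< f → block w e ≡ block w f → Swap (Fits (bounds w)) e f
  swap-whole : ∀ (w : Word m n) {e f} → e Fin.< f → wholeBlock w e ≡ wholeBlock w f → Swap (Whole w) e f

  swap last {zero} {zero} () _
  swap (par w) {zero} {suc f} _ eq = let B , g , eq , f∈ , g′ = lower w f (sym eq) in
    outside ∷ B , (in-strip (inj₂ eq) , g) , there f∈ , (λ ()) , (in-strip (inj₂ (trans (∣-′∣ f∈) eq)) , g′)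
  swap (ser w) {zero} {suc f} _ eq = let B , g , eq , f∈ , g′ = lower w f (sym eq) in
    outside ∷ B , (in-strip (inj₁ eq) , g) , there f∈ , (λ ()) , (in-strip (inj₁ (trans (∣-′∣ f∈) eq)) , g′)
  swap (par w) {suc e} {suc f} (s≤s e<f) eq = let B , g , f∈ , e∉ , g′ = swap w e<f eq in
    outside ∷ B , (word-bounds w g , g) , there f∈ , (λ { (there e∈) → e∉ e∈ }) , (word-bounds w g′ , g′)
  swap (ser w) {suc e} {suc f} (s≤s e<f) eq = let B , g , f∈ , e∉ , g′ = swap w e<f eq
                                                  l , u = word-bounds w g
                                                  l′ , u′ = word-bounds w g′ in
    inside ∷ B , ((s≤s l , s≤s u) , g) , there f∈ , (λ { (there e∈) → e∉ e∈ }) , ((s≤s l′ , s≤s u′) , g′)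
  swap (cut w) {zero} {suc f} _ ()
  swap (cut {m = m} w) {suc e} {suc f} (s≤s e<f) eq =
    let B , g , f∈ , e∉ , g′ = swap-whole w e<f (ℕ.suc-injective eq) in
    outside ∷ B , out g , there f∈ , (λ { (there e∈) → e∉ e∈ }) , out g′
    where
    out : ∀ {B} → Whole w B → Fits (bounds (cut w)) (outside ∷ B)
    out {_ ∷ _} ((l , u) , g) = (l , ℕ.m≤n⇒m≤1+n u) , (l , u) , g

  swap-whole w {zero} {suc f} _ eq = let B , g , eq , f∈ , g′ = lower w f (sym eq) in
    outside ∷ B , (at eq , g) , there f∈ , (λ ()) , (at (trans (∣-′∣ f∈) eq) , g′)
  swap-whole {m} w {suc e} {suc f} (s≤s e<f) eq =
    let B , g , f∈ , e∉ , g′ = swap w e<f eq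
        s , i , _ = ∷-whole w g
        e∉′ = λ { (there e∈) → e∉ e∈ }
    in s ∷ B , (i , g) , there f∈ , e∉′ ,
       (between-≡ (∣-′+′∣ {B = s ∷ B} (there f∈) e∉′) i , g′)

  upto : Word m n → ℕ → Subset n
  uptoWhole : Word m n → ℕ → Subset (suc n)

  upto last    j       = inside ∷ []
  upto (par w) j       = uptoWhole w j
  upto (ser w) j       = uptoWhole w j
  upto (cut w) zero    = inside ∷ ⊥
  upto (cut w) (suc j) = inside ∷ uptoWhole w j

  uptoWhole w j = inside ∷ upto w j

  ∈-upto : ∀ (w : Word m n) {j e} → block w e ≤ j → e ∈ upto w j
  ∈-uptoWhole : ∀ (w : Word m n) {j e} → wholeBlock w e ≤ j → e ∈ uptoWhole w j
  ∈-upto last    {e = zero} _ = here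
  ∈-upto (par w) i = ∈-uptoWhole w i
  ∈-upto (ser w) i = ∈-uptoWhole w i
  ∈-upto (cut w) {zero}  {zero}  _ = here
  ∈-upto (cut w) {suc j} {zero}  _ = here
  ∈-upto (cut w) {suc j} {suc e} (s≤s i) = there (∈-uptoWhole w i)
  ∈-uptoWhole w {e = zero}  i = here
  ∈-uptoWhole w {e = suc e} i = there (∈-upto w i)

  upto-≤ : ∀ (w : Word m n) {j e} → e ∈ upto w j → block w e ≤ j
  uptoWhole-≤ : ∀ (w : Word m n) {j e} → e ∈ uptoWhole w j → wholeBlock w e ≤ j
  upto-≤ last _ = z≤n
  upto-≤ (par w) e∈ = uptoWhole-≤ w e∈
  upto-≤ (ser w) e∈ = uptoWhole-≤ w e∈
  upto-≤ (cut w) {e = zero} _ = z≤n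
  upto-≤ (cut w) {zero}  {suc e} (there e∈) = contradiction e∈ ∉⊥
  upto-≤ (cut w) {suc j} {suc e} (there e∈) = s≤s (uptoWhole-≤ w e∈)
  uptoWhole-≤ w {e = zero}  _ = z≤n
  uptoWhole-≤ w {e = suc e} (there e∈) = upto-≤ w e∈

  mix-⊥ : ∀ (B₁ B₂ : Subset n) → mix ⊥ B₁ B₂ ≡ B₂
  mix-⊥ []       []       = refl
  mix-⊥ (_ ∷ B₁) (b ∷ B₂) = cong (b ∷_) (mix-⊥ B₁ B₂)

  ∣∷∣-cong : ∀ s (B B′ : Subset n) → ∣ B ∣ ≡ ∣ B′ ∣ → ∣ s ∷ B ∣ ≡ ∣ s ∷ B′ ∣
  ∣∷∣-cong true  _ _ = cong suc
  ∣∷∣-cong false _ _ = id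

  -- A block ends where a segment has prescribed size. Replacing the part of a set in such a segment
  -- changes no size of a longer segment.
  mix-fits : ∀ (w : Word m n) j {B₁ B₂} → Fits (bounds w) B₁ → Fits (bounds w) B₂ →
             Fits (bounds w) (mix (upto w j) B₁ B₂) × ∣ mix (upto w j) B₁ B₂ ∣ ≡ ∣ B₁ ∣
  mix-∷ : ∀ (w : Word m n) j c {B₁ B₂} → Fits (c ∷ bounds w) B₁ → Fits (c ∷ bounds w) B₂ →
          Fits (c ∷ bounds w) (mix (uptoWhole w j) B₁ B₂) × ∣ mix (uptoWhole w j) B₁ B₂ ∣ ≡ ∣ B₁ ∣
  mix-fits last j {_ ∷ []} {_ ∷ []} f₁ f₂ = f₁ , refl
  mix-fits (par {m = m} w) j f₁ f₂ = mix-∷ w j (strip m) f₁ f₂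
  mix-fits (ser {m = m} w) j f₁ f₂ = mix-∷ w j (strip (suc m)) f₁ f₂
  mix-fits (cut w) zero {b ∷ B₁} {_ ∷ B₂} (i , f₁) (_ , f₂) =
    let eq = ∣∷∣-cong b (mix ⊥ B₁ B₂) B₁ (trans (cong ∣_∣ (mix-⊥ B₁ B₂)) (same-size {cs = bounds w} f₂ f₁)) in
    (between-≡ eq i , subst (Whole w) (sym (mix-⊥ B₁ B₂)) f₂) , eq
    where
    same-size : ∀ {k n} {cs : Bounds n} {B B′} → Fits ((k , k) ∷ cs) B → Fits ((k , k) ∷ cs) B′ → ∣ B ∣ ≡ ∣ B′ ∣
    same-size {B = _ ∷ _} {_ ∷ _} ((l , u) , _) ((l′ , u′) , _) = ℕ.≤-antisym (ℕ.≤-trans u l′) (ℕ.≤-trans u′ l)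
  mix-fits (cut {m = m} w) (suc j) {b ∷ B₁} {_ ∷ B₂} (i , f₁) (_ , f₂) =
    let f , eq = mix-∷ w j (suc m , suc m) f₁ f₂
        eq′ = ∣∷∣-cong b (mix (uptoWhole w j) B₁ B₂) B₁ eq
    in (between-≡ eq′ i , f) , eq′
  mix-∷ w j c {b ∷ B₁} {_ ∷ B₂} (i , f₁) (_ , f₂) =
    let f , eq = mix-fits w j f₁ f₂
        eq′ = ∣∷∣-cong b (mix (upto w j) B₁ B₂) B₁ eq
    in (between-≡ eq′ i , f) , eq′

  block-< : ∀ (w : Word m n) e → block w e < suc (cuts w)
  wholeBlock-< : ∀ (w : Word m n) e → wholeBlock w e < suc (cuts w)
  block-< last e = s≤s z≤n
  block-< (par w) e = wholeBlock-< w e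
  block-< (ser w) e = wholeBlock-< w e
  block-< (cut w) zero = s≤s z≤n
  block-< (cut w) (suc e) = s≤s (wholeBlock-< w e)
  wholeBlock-< w zero    = s≤s z≤n
  wholeBlock-< w (suc e) = block-< w e

  block-attained : ∀ (w : Word m n) {j} → j < suc (cuts w) → ∃ λ e → block w e ≡ j
  block-attained last {zero} (s≤s z≤n) = zero , refl
  block-attained (par w) j< = let e , eq = block-attained w j< in suc e , eq
  block-attained (ser w) j< = let e , eq = block-attained w j< in suc e , eq
  block-attained (cut w) {zero}  _ = zero , refl
  block-attained (cut w) {suc j} (s≤s j<) = let e , eq = block-attained w j< in suc (suc e) , cong suc eq

  word-colouring : ∀ (w : Word m n) → Colouring (wordMatroid w) (suc (cuts w))
  word-colouring {m} w = record
    { colour    = wholeBlock w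
    ; connected = connected
    ; coloured  = coloured
    ; in-range  = wholeBlock-< w
    ; attained  = λ j< → let e , eq = block-attained w j< in suc e , eq
    }
    where
    M = wordMatroid w
    connected-< : ∀ {e f} → e Fin.< f → wholeBlock w e ≡ wholeBlock w f → Connected M e f
    connected-< {e} {f} e<f eq = let B , b , f∈ , e∉ , b′ = swap-whole w e<f eq in
      swap⇒connected M b f∈ e∉ (subst (Whole w) (sym (exchange≡ B f e)) b′)
    connected : ∀ {e f} → wholeBlock w e ≡ wholeBlock w f → Connected M e f
    connected {e} {f} eq with Fin.<-cmp e f
    ... | tri< e<f _ _  = connected-< e<f eq

    ... | tri≈ _ refl _ = inj₁ refl
    ... | tri> _ _ f<e  = connected-sym M (connected-< f<e (sym eq))
    not-< : ∀ {e f} → Connected M e f → ¬ (wholeBlock w e < wholeBlock w f)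
    not-< {e} {f} c e<f = separated M (uptoWhole w (wholeBlock w e))
      (λ {B₁} {B₂} f₁ f₂ → proj₁ (mix-∷ w (wholeBlock w e) (suc m , suc m) {B₁} {B₂} f₁ f₂))
      (∈-uptoWhole w ℕ.≤-refl) (λ f∈ → ℕ.<⇒≱ e<f (uptoWhole-≤ w f∈)) c
    coloured : ∀ {e f} → Connected M e f → wholeBlock w e ≡ wholeBlock w f
    coloured c = ℕ.≤-antisym (ℕ.≮⇒≥ (not-< (connected-sym M c))) (ℕ.≮⇒≥ (not-< c))

open WordComponents

-- Words as direct sums of series-parallel matroids

module WordDecompositions where

  private variable
    d m n k l p : ℕ

  ∁∁ : ∀ (B : Subset n) → ∁ (∁ B) ≡ B
  ∁∁ []      = refl
  ∁∁ (b ∷ B) = cong₂ _∷_ (Bool.not-involutive b) (∁∁ B)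

  module _ (M : Matroid (suc n)) where

    -- In this and the next lemmas element 0 is the new one, and element 1 is the old element 0 that
    -- is being extended.
    parallel-in⁺ : ∀ {B} → Basis M (inside ∷ B) → Basis (parallelExtension M zero) (inside ∷ outside ∷ B)
    parallel-in⁺ {B} b = (λ ()) , subst (λ C → Basis M (inside ∷ C)) (sym (∪-identityʳ B)) b

    parallel-in⁻ : ∀ {s B} → Basis (parallelExtension M zero) (inside ∷ s ∷ B) → s ≡ outside × Basis M (inside ∷ B)
    parallel-in⁻ {true}  (0∉ , _) = contradiction here 0∉
    parallel-in⁻ {false} {B} (_ , b) = refl , subst (λ C → Basis M (inside ∷ C)) (∪-identityʳ B) b

    series-in⁺ : ∀ {B} → Basis M B → Basis (seriesExtension M zero) (inside ∷ B)
    series-in⁺ {B} b = subst (Basis M) (sym (∁∁ B)) b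

    series-in⁻ : ∀ {B} → Basis (seriesExtension M zero) (inside ∷ B) → Basis M B
    series-in⁻ {B} b = subst (Basis M) (∁∁ B) b

    series-out⁺ : ∀ {B} → Basis M (outside ∷ B) → Basis (seriesExtension M zero) (outside ∷ inside ∷ B)
    series-out⁺ {B} b = (λ ()) , subst (λ C → Basis M (outside ∷ C)) (sym (trans (cong ∁ (∪-identityʳ (∁ B))) (∁∁ B))) b

    series-out⁻ : ∀ {s B} → Basis (seriesExtension M zero) (outside ∷ s ∷ B) → s ≡ inside × Basis M (outside ∷ B)
    series-out⁻ {false} (0∉ , _) = contradiction here 0∉
    series-out⁻ {true} {B} (_ , b) = refl , subst (λ C → Basis M (outside ∷ C)) (trans (cong ∁ (∪-identityʳ (∁ B))) (∁∁ B)) b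

  -- F is the set of bases of a direct sum of p blocks, the first of which is a
  -- series-parallel matroid containing the element 0, where extensions take place.

  data Blocks : ∀ {n} → (Subset (suc n) → Set) → ℕ → Set₁ where
    blocks : ∀ {a p} {A : Matroid (suc a)} → SP A → ∀ Ms → All (SeriesParallel ∘ proj₂) Ms → suc (length Ms) ≡ p →
             ∀ {F : Subset (suc a ℕ.+ sum (map proj₁ Ms)) → Set} →
             (∀ B C → Basis A B → Basis (⨁ Ms) C → F (B ++ᵛ C)) →
             (∀ B C → F (B ++ᵛ C) → Basis A B × Basis (⨁ Ms) C) → Blocks {a ℕ.+ sum (map proj₁ Ms)} F p

  blocks-parallel : ∀ {F : Subset (suc n) → Set} {G : Subset (suc (suc n)) → Set} → Blocks F p →
    (∀ {B} → F B → G (outside ∷ B)) → (∀ {B} → F (inside ∷ B) → G (inside ∷ outside ∷ B)) →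
    (∀ {B} → G (outside ∷ B) → F B) → (∀ {s B} → G (inside ∷ s ∷ B) → s ≡ outside × F (inside ∷ B)) → Blocks G p
  blocks-parallel {G = G} (blocks {A = A} sp Ms all eq f g) out⁺ in⁺ out⁻ in⁻ = blocks (parallel zero sp) Ms all eq f′ g′
    where
    f′ : ∀ B C → Basis (parallelExtension A zero) B → Basis (⨁ Ms) C → G (B ++ᵛ C)
    f′ (false ∷ B) C b c = out⁺ (f B C b c)
    f′ (true ∷ s ∷ B) C b c with parallel-in⁻ A b
    ... | refl , b = in⁺ (f (inside ∷ B) C b c)
    g′ : ∀ B C → G (B ++ᵛ C) → Basis (parallelExtension A zero) B × Basis (⨁ Ms) C
    g′ (false ∷ B) C h = g B C (out⁻ h)
    g′ (true ∷ s ∷ B) C h with in⁻ h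
    ... | refl , h = let b , c = g (inside ∷ B) C h in parallel-in⁺ A b , c

  blocks-series : ∀ {F : Subset (suc n) → Set} {G : Subset (suc (suc n)) → Set} → Blocks F p →
    (∀ {B} → F B → G (inside ∷ B)) → (∀ {B} → F (outside ∷ B) → G (outside ∷ inside ∷ B)) →
    (∀ {B} → G (inside ∷ B) → F B) → (∀ {s B} → G (outside ∷ s ∷ B) → s ≡ inside × F (outside ∷ B)) → Blocks G p
  blocks-series {G = G} (blocks {A = A} sp Ms all eq f g) in⁺ out⁺ in⁻ out⁻ = blocks (series zero sp) Ms all eq f′ g′
    where
    f′ : ∀ B C → Basis (seriesExtension A zero) B → Basis (⨁ Ms) C → G (B ++ᵛ C)
    f′ (true ∷ B) C b c = in⁺ (f B C (series-in⁻ A b) c)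
    f′ (false ∷ s ∷ B) C b c with series-out⁻ A b
    ... | refl , b = out⁺ (f (outside ∷ B) C b c)
    g′ : ∀ B C → G (B ++ᵛ C) → Basis (seriesExtension A zero) B × Basis (⨁ Ms) C
    g′ (true ∷ B) C h = let b , c = g B C (in⁻ h) in series-in⁺ A b , c
    g′ (false ∷ s ∷ B) C h with out⁻ h
    ... | refl , h = let b , c = g (outside ∷ B) C h in series-out⁺ A b , c

  blocks-cut : ∀ {F : Subset (suc n) → Set} {G : Subset (suc (suc (suc n))) → Set} → Blocks F p →
    (∀ {s t B} → ∣ s ∷ t ∷ [] ∣ ≡ 1 → F B → G (s ∷ t ∷ B)) →
    (∀ {s t B} → G (s ∷ t ∷ B) → ∣ s ∷ t ∷ [] ∣ ≡ 1 × F B) → Blocks G (suc p)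
  blocks-cut {F = F} {G} (blocks {a} {A = A} sp Ms all eq f g) h⁺ h⁻ =
    blocks U₁,₂ ((suc a , A) ∷ Ms) (inj₁ sp ∷ all) (cong suc eq) f′ g′
    where
    f′ : ∀ B C → Basis (U 1 2 (s≤s z≤n)) B → Basis (⨁ ((suc a , A) ∷ Ms)) C → G (B ++ᵛ C)
    f′ (s ∷ t ∷ []) C b (c , d) = h⁺ b (subst F (Vec.take++drop≡id (suc a) C) (f (take (suc a) C) (drop (suc a) C) c d))
    g′ : ∀ B C → G (B ++ᵛ C) → Basis (U 1 2 (s≤s z≤n)) B × Basis (⨁ ((suc a , A) ∷ Ms)) C
    g′ (s ∷ t ∷ []) C h = let b , h = h⁻ h in
      b , g (take (suc a) C) (drop (suc a) C) (subst F (sym (Vec.take++drop≡id (suc a) C)) h)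

  at⁻ : k between (m , m) → k ≡ m
  at⁻ (m≤k , k≤m) = ℕ.≤-antisym k≤m m≤k

  -- Compare the prescribed total with the sizes that remain behind the first two elements. After
  -- `par` a basis contains at most one of the two, so they are parallel; after `ser` it contains at
  -- least one, so they are in series; after `cut` exactly one, so they form a new summand U₁,₂.
  word-blocks : ∀ (w : Word m n) → Blocks (Whole w) (suc (cuts w))
  word-blocks last = blocks U₁,₂ [] [] refl
    (λ { (true ∷ false ∷ []) [] refl _ → at refl , (z≤n , z≤n) , tt
       ; (false ∷ true ∷ []) [] refl _ → at refl , (z≤n , s≤s z≤n) , tt })
    (λ { (s ∷ t ∷ []) [] (i , _) → at⁻ i , refl })
  word-blocks (par {m = m} w) = blocks-parallel (word-blocks w)
    (λ { {_ ∷ B} (i , f) → i , in-strip (inj₂ (at⁻ i)) , f })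
    (λ { {B} (i , f) → i , in-strip (inj₁ (ℕ.suc-injective (at⁻ i))) , f })
    (λ { {_ ∷ B} (i , _ , f) → i , f })
    (λ { {true} {B} (i , _ , f) → contradiction (proj₁ (word-bounds w f)) (ℕ.<⇒≱ (ℕ.≤-reflexive (ℕ.suc-injective (at⁻ i))))
       ; {false} {B} (i , _ , f) → refl , i , f })
  word-blocks (ser {m = m} w) = blocks-series (word-blocks w)
    (λ { {_ ∷ B} (i , f) → at (cong suc (at⁻ i)) , in-strip (inj₁ (at⁻ i)) , f })
    (λ { {B} (i , f) → at (cong suc (at⁻ i)) , in-strip (inj₂ (cong suc (at⁻ i))) , f })
    (λ { {_ ∷ B} (i , _ , f) → at (ℕ.suc-injective (at⁻ i)) , f })
    (λ { {false} {B} (i , _ , f) → contradiction (proj₂ (word-bounds w f)) (ℕ.<⇒≱ (ℕ.≤-reflexive (sym (at⁻ i))))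
       ; {true} {B} (i , _ , f) → refl , at (ℕ.suc-injective (at⁻ i)) , f })
  word-blocks (cut {m = m} w) = blocks-cut (word-blocks w)
    (λ { {true} {false} {_ ∷ B} _ (i , f) → at (cong suc (at⁻ i)) , in-strip (inj₁ (at⁻ i)) , i , f
       ; {false} {true} {_ ∷ B} _ (i , f) → at (cong suc (at⁻ i)) , in-strip (inj₂ (cong suc (at⁻ i))) , i , f })
    (λ { {true} {true} {_ ∷ B} (i , _ , i′ , f) → contradiction (trans (sym (cong (λ j → suc (suc j)) (at⁻ i′))) (at⁻ i)) ℕ.1+n≢n
       ; {true} {false} {_ ∷ B} (i , _ , i′ , f) → refl , i′ , f
       ; {false} {true} {_ ∷ B} (i , _ , i′ , f) → refl , i′ , f
       ; {false} {false} {_ ∷ B} (i , _ , i′ , f) → contradiction (trans (sym (at⁻ i)) (at⁻ i′)) ℕ.1+n≢n })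

  blocks⇒decomposition : ∀ {M : Matroid (suc n)} → Blocks (Basis M) p → Decomposition M p
  blocks⇒decomposition {M = M} B = go B id id
    where
    go : ∀ {n} {M : Matroid (suc n)} {F} → Blocks F p → (∀ {B} → F B → Basis M B) → (∀ {B} → Basis M B → F B) → Decomposition M p
    go {M = M} {F} (blocks {a} {A = A} sp Ms all eq f g) F⊆ ⊆F = record
      { all-sp = inj₁ sp ∷ all
      ; count  = eq
      ; iso    = ≐⇒≅ {M = M} {⨁ ((suc a , A) ∷ Ms)}
          ( (λ {B} b → g (take (suc a) B) (drop (suc a) B) (subst F (sym (Vec.take++drop≡id (suc a) B)) (⊆F b)))
          , (λ {B} (b , c) → F⊆ (subst F (Vec.take++drop≡id (suc a) B) (f (take (suc a) B) (drop (suc a) B) b c))))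
      }

  word-decomposition : ∀ (w : Word m n) → Decomposition (wordMatroid w) (suc (cuts w))
  word-decomposition w = blocks⇒decomposition (word-blocks w)

  module _ {i} {γ : Matroid (suc n) → ℤ} (S : SpeyerCoefficient i γ) where
    open SpeyerCoefficient S

    v-word : ∀ (w : Word m n) feasible → v (LP (suc m) (bounds w) feasible) ≡ sign (suc (cuts w)) ℤ.* + δ i (suc (cuts w))
    v-word {m} w feasible = trans (valuation-cong valuative {LP (suc m) (bounds w) feasible} {wordMatroid w} (id , id))
      (v-decomposition S (word-free w) (word-decomposition w) (word-colouring w))

    -- The uniform matroid is the case of the empty context.
    v-uniform : ∀ {m n′} → n ≡ suc n′ → (m≤n′ : m ≤ n′) → ∀ {M} →
                (∀ {B} → Basis M B → ∣ B ∣ ≡ suc m) → (∀ {B} → ∣ B ∣ ≡ suc m → Basis M B) →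
                v M ≡ ℤ.- (+ words 1 m n′ i)
    v-uniform {m} {n′} refl m≤n′ {M} ⇒ ⇐ = trans
      (valuation-cong valuative {M} {Evaluation.state valuative i v-word start m≤n′} (to , from))
      (trans (Evaluation.v-state valuative i v-word n′ m≤n′ start) (ℤ.-1*i≡-i (+ words 1 m n′ i)))
      where
      strip≤ : ∀ {n} s (B : Subset n) → ∣ s ∷ B ∣ ≡ suc m → ∣ B ∣ between strip m
      strip≤ true  B eq = in-strip (inj₁ (ℕ.suc-injective eq))
      strip≤ false B eq = in-strip (inj₂ eq)
      to : ∀ {B} → Basis M B → Fits ((suc m , suc m) ∷ strip m ∷ free n′) B
      to {s ∷ t ∷ B} b = let eq = ⇒ b in at eq , strip≤ s (t ∷ B) eq , fits-free B
      from : ∀ {B} → Fits ((suc m , suc m) ∷ strip m ∷ free n′) B → Basis M B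
      from {s ∷ B} (i , _) = ⇐ (at⁻ i)

open WordDecompositions

-- Relabelling, and the series-parallel matroids around a hyperplane

module Relabellings where

  private variable
    d m n k l p : ℕ

  ∈-image⁺ : ∀ (π : Permutation m n) {B x} → π ⟨$⟩ˡ x ∈ B → x ∈ image π B
  ∈-image⁺ π {B} {x} x∈ = Vec.lookup⇒[]= x _ (trans (Vec.lookup∘tabulate _ x) (Vec.[]=⇒lookup x∈))

  ∈-image⁻ : ∀ (π : Permutation m n) {B x} → x ∈ image π B → π ⟨$⟩ˡ x ∈ B
  ∈-image⁻ π {B} {x} x∈ = Vec.lookup⇒[]= _ B (trans (sym (Vec.lookup∘tabulate _ x)) (Vec.[]=⇒lookup x∈))

  image-exchange : ∀ (π : Permutation m n) B x y →
                   image π (exchange B x y) ≡ exchange (image π B) (π ⟨$⟩ʳ x) (π ⟨$⟩ʳ y)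
  image-exchange π B x y = ∼⇒≡
    ( (λ z∈ → [ (λ (z∈B , z≢x) → ∈exchangeˡ _ _ (∈-image⁺ π z∈B) (λ { refl → z≢x (Perm.inverseˡ π) }))
              , (λ z≡y → subst (_∈ exchange (image π B) (π ⟨$⟩ʳ x) (π ⟨$⟩ʳ y)) (trans (cong (π ⟨$⟩ʳ_) (sym z≡y)) (Perm.inverseʳ π))
                           (∈exchangeʳ _ _)) ]′ (∈exchange⁻ B x y (∈-image⁻ π z∈)))
    , (λ z∈ → [ (λ (z∈B , z≢x) → ∈-image⁺ π (∈exchangeˡ {p = B} x y (∈-image⁻ π z∈B)
                  (λ eq → z≢x (trans (sym (Perm.inverseʳ π)) (cong (π ⟨$⟩ʳ_) eq)))))
              , (λ { refl → ∈-image⁺ π (subst (_∈ exchange B x y) (sym (Perm.inverseˡ π)) (∈exchangeʳ {p = B} x y)) }) ]′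
              (∈exchange⁻ (image π B) _ _ z∈)))

  image-flip : ∀ (π : Permutation m n) B → image π (image (Perm.flip π) B) ≡ B
  image-flip π B = ∼⇒≡
    ( (λ z∈ → subst (_∈ B) (Perm.inverseʳ π) (∈-image⁻ (Perm.flip π) (∈-image⁻ π z∈)))
    , (λ z∈ → ∈-image⁺ π (∈-image⁺ (Perm.flip π) (subst (_∈ B) (sym (Perm.inverseʳ π)) z∈))) )

  relabelled : Permutation m n → Matroid n → Matroid m
  relabelled π M .Basis B  = Basis M (image π B)
  relabelled π M .basis? B = basis? M (image π B)
  relabelled π M .someBasis =
    let B , b = someBasis M in image (Perm.flip π) B , subst (Basis M) (sym (image-flip π B)) b
  relabelled π M .basis-exchange {B₁} {B₂} b₁ b₂ {x} x∈ x∉ =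
    let y , y∈ , y∉ , b = basis-exchange M b₁ b₂ {π ⟨$⟩ʳ x}
          (∈-image⁺ π (subst (_∈ B₁) (sym (Perm.inverseˡ π)) x∈))
          (λ x∈ → x∉ (subst (_∈ B₂) (Perm.inverseˡ π) (∈-image⁻ π x∈)))
        y′ = π ⟨$⟩ˡ y
    in y′ , ∈-image⁻ π y∈ , (λ y′∈ → y∉ (∈-image⁺ π y′∈)) ,
       subst (Basis M) (sym (trans (image-exchange π B₁ x y′) (cong (exchange (image π B₁) _) (Perm.inverseʳ π)))) b

  relabelled-≅ : ∀ (π : Permutation m n) M → relabelled π M ≅ M
  relabelled-≅ π M = π , λ B → mk⇔ id id

  -- Sorting the ground set: first the complement of H, then H

  side : ∀ (H : Subset n) → Fin n → Fin ∣ ∁ H ∣ ⊎ Fin ∣ H ∣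
  side (true  ∷ H) zero    = inj₂ zero
  side (false ∷ H) zero    = inj₁ zero
  side (true  ∷ H) (suc e) = Sum.map₂ suc (side H e)
  side (false ∷ H) (suc e) = Sum.map₁ suc (side H e)

  unside : ∀ (H : Subset n) → Fin ∣ ∁ H ∣ ⊎ Fin ∣ H ∣ → Fin n
  unside (true  ∷ H) (inj₁ j)       = suc (unside H (inj₁ j))
  unside (true  ∷ H) (inj₂ zero)    = zero
  unside (true  ∷ H) (inj₂ (suc j)) = suc (unside H (inj₂ j))
  unside (false ∷ H) (inj₁ zero)    = zero
  unside (false ∷ H) (inj₁ (suc j)) = suc (unside H (inj₁ j))
  unside (false ∷ H) (inj₂ j)       = suc (unside H (inj₂ j))

  unside-side : ∀ (H : Subset n) e → unside H (side H e) ≡ e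
  unside-side (true  ∷ H) zero = refl
  unside-side (false ∷ H) zero = refl
  unside-side (true  ∷ H) (suc e) with side H e | unside-side H e
  ... | inj₁ j | eq = cong suc eq
  ... | inj₂ j | eq = cong suc eq
  unside-side (false ∷ H) (suc e) with side H e | unside-side H e
  ... | inj₁ j | eq = cong suc eq
  ... | inj₂ j | eq = cong suc eq

  side-unside : ∀ (H : Subset n) j → side H (unside H j) ≡ j
  side-unside (true  ∷ H) (inj₁ j)       = cong (Sum.map₂ suc) (side-unside H (inj₁ j))
  side-unside (true  ∷ H) (inj₂ zero)    = refl
  side-unside (true  ∷ H) (inj₂ (suc j)) = cong (Sum.map₂ suc) (side-unside H (inj₂ j))
  side-unside (false ∷ H) (inj₁ zero)    = refl
  side-unside (false ∷ H) (inj₁ (suc j)) = cong (Sum.map₁ suc) (side-unside H (inj₁ j))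
  side-unside (false ∷ H) (inj₂ j)       = cong (Sum.map₁ suc) (side-unside H (inj₂ j))

  outs : ∀ (H B : Subset n) → Subset ∣ ∁ H ∣
  outs H B = tabulate λ j → lookup B (unside H (inj₁ j))

  ins : ∀ (H B : Subset n) → Subset ∣ H ∣
  ins H B = tabulate λ j → lookup B (unside H (inj₂ j))

  ∣outs∣ : ∀ (H B : Subset n) → ∣ outs H B ∣ ≡ ∣ B ∩ ∁ H ∣
  ∣outs∣ []          []          = refl
  ∣outs∣ (true  ∷ H) (true  ∷ B) = ∣outs∣ H B
  ∣outs∣ (true  ∷ H) (false ∷ B) = ∣outs∣ H B
  ∣outs∣ (false ∷ H) (true  ∷ B) = cong suc (∣outs∣ H B)
  ∣outs∣ (false ∷ H) (false ∷ B) = ∣outs∣ H B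

  ∣ins∣ : ∀ (H B : Subset n) → ∣ ins H B ∣ ≡ ∣ B ∩ H ∣
  ∣ins∣ []          []          = refl
  ∣ins∣ (true  ∷ H) (true  ∷ B) = cong suc (∣ins∣ H B)
  ∣ins∣ (true  ∷ H) (false ∷ B) = ∣ins∣ H B
  ∣ins∣ (false ∷ H) (true  ∷ B) = ∣ins∣ H B
  ∣ins∣ (false ∷ H) (false ∷ B) = ∣ins∣ H B

  ∣∩∣+∣∩∁∣ : ∀ (B H : Subset n) → ∣ B ∩ ∁ H ∣ ℕ.+ ∣ B ∩ H ∣ ≡ ∣ B ∣
  ∣∩∣+∣∩∁∣ []          []          = refl
  ∣∩∣+∣∩∁∣ (true  ∷ B) (true  ∷ H) = trans (ℕ.+-suc _ _) (cong suc (∣∩∣+∣∩∁∣ B H))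
  ∣∩∣+∣∩∁∣ (true  ∷ B) (false ∷ H) = cong suc (∣∩∣+∣∩∁∣ B H)
  ∣∩∣+∣∩∁∣ (false ∷ B) (true  ∷ H) = ∣∩∣+∣∩∁∣ B H
  ∣∩∣+∣∩∁∣ (false ∷ B) (false ∷ H) = ∣∩∣+∣∩∁∣ B H

  take-tabulate : ∀ {A : Set} {m n} (f : Fin (m ℕ.+ n) → A) → take m (tabulate f) ≡ tabulate (f ∘ (_↑ˡ n))
  take-tabulate {m = zero}  f = refl
  take-tabulate {m = suc m} f = cong (f zero ∷_) (take-tabulate (f ∘ suc))

  drop-tabulate : ∀ {A : Set} {m n} (f : Fin (m ℕ.+ n) → A) → drop m (tabulate f) ≡ tabulate (f ∘ (m ↑ʳ_))
  drop-tabulate {m = zero}  f = refl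
  drop-tabulate {m = suc m} f = drop-tabulate {m = m} (f ∘ suc)

  ∣take∣+∣drop∣ : ∀ m (B : Subset (m ℕ.+ n)) → ∣ B ∣ ≡ ∣ take m B ∣ ℕ.+ ∣ drop m B ∣
  ∣take∣+∣drop∣ zero    B           = refl
  ∣take∣+∣drop∣ (suc m) (true  ∷ B) = cong suc (∣take∣+∣drop∣ m B)
  ∣take∣+∣drop∣ (suc m) (false ∷ B) = ∣take∣+∣drop∣ m B

  -- thick l k is the circuit of rank k with one element replaced by l parallel
  -- ones, which are put first.

  thick : ∀ l k → Matroid (l ℕ.+ k)
  thick zero          k = U k k ℕ.≤-refl
  thick (suc zero)    k = U k (suc k) (ℕ.n≤1+n k)
  thick (suc (suc l)) k = parallelExtension (thick (suc l) k) zero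

  thick-basis : ∀ l k B → Basis (thick (suc l) k) B ⇔ (∣ B ∣ ≡ k × ∣ take (suc l) B ∣ ≤ 1)
  thick-basis zero k (s ∷ B) = mk⇔ (λ eq → eq , ≤1 s) proj₁
    where
    ≤1 : ∀ s → ∣ s ∷ [] ∣ ≤ 1
    ≤1 true  = s≤s z≤n
    ≤1 false = z≤n
  thick-basis (suc l) k (false ∷ B) = thick-basis l k B
  thick-basis (suc l) k (true ∷ true ∷ B) = mk⇔ (λ (0∉ , _) → contradiction here 0∉) (λ { (_ , s≤s ()) })
  thick-basis (suc l) k (true ∷ false ∷ B) with thick-basis l k (true ∷ B)
  ... | IH = mk⇔ (λ b → Equivalence.to IH (proj₂ (parallel-in⁻ (thick (suc l) k) {false} {B} b)))
                 (λ h → parallel-in⁺ (thick (suc l) k) (Equivalence.from IH h))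

  -- A series extension of a circuit is a circuit with one more element.
  sp-circuit : ∀ k → SP (U (suc k) (suc (suc k)) (ℕ.n≤1+n (suc k)))
  sp-circuit zero    = relabel (≐⇒≅ {M = U 1 2 (s≤s z≤n)} {U 1 2 (ℕ.n≤1+n 1)} ((λ b → b) , (λ b → b))) U₁,₂
  sp-circuit (suc k) = relabel (≐⇒≅ {M = seriesExtension (U (suc k) (suc (suc k)) (ℕ.n≤1+n (suc k))) zero} {U (suc (suc k)) (suc (suc (suc k))) (ℕ.n≤1+n (suc (suc k)))}
                                    ((λ {B} → to {B}) , λ {B} → from {B}))
                               (series zero (sp-circuit k))
    where
    M = U (suc k) (suc (suc k)) (ℕ.n≤1+n (suc k))
    to : ∀ {B} → Basis (seriesExtension M zero) B → ∣ B ∣ ≡ suc (suc k)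
    to {true ∷ B} b = cong suc (series-in⁻ M {B} b)
    to {false ∷ s ∷ B} b with series-out⁻ M {s} {B} b
    ... | refl , eq = cong suc eq
    from : ∀ {B} → ∣ B ∣ ≡ suc (suc k) → Basis (seriesExtension M zero) B
    from {true ∷ B} eq = series-in⁺ M {B} (ℕ.suc-injective eq)
    from {false ∷ true ∷ B} eq = series-out⁺ M {B} (ℕ.suc-injective eq)
    from {false ∷ false ∷ B} eq = contradiction (∣p∣≤n B) (ℕ.<⇒≱ (ℕ.<-≤-trans (ℕ.n<1+n _) (ℕ.≤-reflexive (sym eq))))

  sp-thick : ∀ l k → 1 ≤ l → 1 ≤ k → SP (thick l k)
  sp-thick (suc zero)    (suc k) _ _   = sp-circuit k
  sp-thick (suc (suc l)) k       _ 1≤k = parallel zero (sp-thick (suc l) k (s≤s z≤n) 1≤k)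

  sp-parallel : ∀ l → SP (U 1 (suc (suc l)) (s≤s z≤n))
  sp-parallel zero    = U₁,₂
  sp-parallel (suc l) = relabel (≐⇒≅ {M = parallelExtension M zero} {U 1 (suc (suc (suc l))) (s≤s z≤n)}
                                    ((λ {B} → to {B}) , λ {B} → from {B})) (parallel zero (sp-parallel l))
    where
    M = U 1 (suc (suc l)) (s≤s z≤n)
    to : ∀ {B} → Basis (parallelExtension M zero) B → ∣ B ∣ ≡ 1
    to {false ∷ B} b = b
    to {true ∷ s ∷ B} b with parallel-in⁻ M {s} {B} b
    ... | refl , eq = eq
    from : ∀ {B} → ∣ B ∣ ≡ 1 → Basis (parallelExtension M zero) B
    from {false ∷ B} eq = eq
    from {true ∷ false ∷ B} eq = parallel-in⁺ M {B} eq
    from {true ∷ true ∷ B} ()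

  module _ (H : Subset n) where
    private
      l′ = ∣ ∁ H ∣
      k′ = ∣ H ∣

    -- The trailing `0` is the ground set of the empty sum with which `⨁` ends.
    thickSort : Permutation n (l′ ℕ.+ k′ ℕ.+ 0)
    thickSort = permutation (λ e → [ (λ j → (j ↑ˡ k′) ↑ˡ 0) , (λ j → (l′ ↑ʳ j) ↑ˡ 0) ]′ (side H e))
      (λ j → unside H (from j)) (λ j → inv j) λ e → inv′ e
      where
      from : Fin (l′ ℕ.+ k′ ℕ.+ 0) → Fin l′ ⊎ Fin k′
      from j = [ splitAt l′ , (λ ()) ]′ (splitAt (l′ ℕ.+ k′) j)
      to : Fin l′ ⊎ Fin k′ → Fin (l′ ℕ.+ k′ ℕ.+ 0)
      to = [ (λ j → (j ↑ˡ k′) ↑ˡ 0) , (λ j → (l′ ↑ʳ j) ↑ˡ 0) ]′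
      from-to : ∀ s → from (to s) ≡ s
      from-to (inj₁ j) rewrite Fin.splitAt-↑ˡ (l′ ℕ.+ k′) (j ↑ˡ k′) 0 = Fin.splitAt-↑ˡ l′ j k′
      from-to (inj₂ j) rewrite Fin.splitAt-↑ˡ (l′ ℕ.+ k′) (l′ ↑ʳ j) 0 = Fin.splitAt-↑ʳ l′ k′ j
      to-from : ∀ j → to (from j) ≡ j
      to-from j with splitAt (l′ ℕ.+ k′) j in eq
      ... | inj₁ i with splitAt l′ i in eq′
      ...   | inj₁ h rewrite Fin.splitAt⁻¹-↑ˡ {i = i} eq′ = Fin.splitAt⁻¹-↑ˡ eq
      ...   | inj₂ h rewrite Fin.splitAt⁻¹-↑ʳ {i = i} eq′ = Fin.splitAt⁻¹-↑ˡ eq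
      inv : ∀ j → to (side H (unside H (from j))) ≡ j
      inv j = trans (cong to (side-unside H (from j))) (to-from j)
      inv′ : ∀ e → unside H (from (to (side H e))) ≡ e
      inv′ e = trans (cong (unside H) (from-to (side H e))) (unside-side H e)

    pairSort : Permutation n (l′ ℕ.+ (k′ ℕ.+ 0))
    pairSort = permutation (λ e → to (side H e)) (λ j → unside H (from j))
      (λ j → trans (cong to (side-unside H (from j))) (to-from j))
      (λ e → trans (cong (unside H) (from-to (side H e))) (unside-side H e))
      where
      from : Fin (l′ ℕ.+ (k′ ℕ.+ 0)) → Fin l′ ⊎ Fin k′
      from j = [ inj₁ , (λ i → [ inj₂ , (λ ()) ]′ (splitAt k′ i)) ]′ (splitAt l′ j)
      to : Fin l′ ⊎ Fin k′ → Fin (l′ ℕ.+ (k′ ℕ.+ 0))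
      to = [ (λ j → j ↑ˡ (k′ ℕ.+ 0)) , (λ j → l′ ↑ʳ (j ↑ˡ 0)) ]′
      from-to : ∀ s → from (to s) ≡ s
      from-to (inj₁ j) rewrite Fin.splitAt-↑ˡ l′ j (k′ ℕ.+ 0) = refl
      from-to (inj₂ j) rewrite Fin.splitAt-↑ʳ l′ (k′ ℕ.+ 0) (j ↑ˡ 0) | Fin.splitAt-↑ˡ k′ j 0 = refl
      to-from : ∀ j → to (from j) ≡ j
      to-from j with splitAt l′ j in eq
      ... | inj₁ i = Fin.splitAt⁻¹-↑ˡ eq
      ... | inj₂ i with splitAt k′ i in eq′
      ...   | inj₁ h rewrite Fin.splitAt⁻¹-↑ˡ {i = i} eq′ = Fin.splitAt⁻¹-↑ʳ eq

open Relabellings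

-- The matroids of a circuit-hyperplane and its neighbours

module CircuitHyperplanes where

  private variable
    d m n k l p : ℕ

  upd-absorb : ∀ (B : Subset n) x {s} → lookup B x ≡ s → B [ x ]≔ s ≡ B
  upd-absorb B x refl = Vec.[]≔-lookup B x

  ∉⇒lookup : ∀ {B : Subset n} {x} → x ∉ B → lookup B x ≡ outside
  ∉⇒lookup {B = B} {x} x∉ with lookup B x in eq
  ... | true  = contradiction (Vec.lookup⇒[]= x B eq) x∉
  ... | false = refl

  -′-absorb : ∀ {B : Subset n} {x} → x ∉ B → B -′ x ≡ B
  -′-absorb {B = B} {x} x∉ = upd-absorb B x (∉⇒lookup x∉)

  +′-absorb : ∀ {B : Subset n} {x} → x ∈ B → B +′ x ≡ B
  +′-absorb {B = B} {x} x∈ = upd-absorb B x (Vec.[]=⇒lookup x∈)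

  ∈-′ : ∀ {B : Subset n} {x y} → x ≢ y → x ∈ B → x ∈ B -′ y
  ∈-′ {B = B} {x} {y} x≢y = Vec.[]≔-minimal B x y x≢y

  ∈+′ : ∀ {B : Subset n} {x y} → x ≢ y → x ∈ B → x ∈ B +′ y
  ∈+′ {B = B} {x} {y} x≢y = Vec.[]≔-minimal B x y x≢y

  ∈+′-here : ∀ (B : Subset n) y → y ∈ B +′ y
  ∈+′-here B y = Vec.[]≔-updates B y

  ∉-′-here : ∀ (B : Subset n) y → y ∉ B -′ y
  ∉-′-here B y y∈ = contradiction (trans (sym (Vec.[]=⇒lookup y∈)) (Vec.[]=⇒lookup (Vec.[]≔-updates B y))) λ ()

  ∉+′ : ∀ {B : Subset n} {x y} → x ≢ y → x ∉ B → x ∉ B +′ y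
  ∉+′ {B = B} {x} {y} x≢y x∉ x∈ = x∉ (Vec.lookup⇒[]= x B (trans (sym (Vec.lookup∘update′ x≢y B inside)) (Vec.[]=⇒lookup x∈)))

  -′-∩ : ∀ (B A : Subset n) x → (B -′ x) ∩ A ≡ (B ∩ A) -′ x
  -′-∩ (b ∷ B) (a ∷ A) zero    = refl
  -′-∩ (b ∷ B) (a ∷ A) (suc x) = cong (_ ∷_) (-′-∩ B A x)

  +′-∩-∈ : ∀ (B A : Subset n) x → x ∈ A → (B +′ x) ∩ A ≡ (B ∩ A) +′ x
  +′-∩-∈ (b ∷ B) (_ ∷ A) zero    here       = refl
  +′-∩-∈ (b ∷ B) (a ∷ A) (suc x) (there x∈) = cong (_ ∷_) (+′-∩-∈ B A x x∈)

  +′-∩-∉ : ∀ (B A : Subset n) x → x ∉ A → (B +′ x) ∩ A ≡ B ∩ A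
  +′-∩-∉ (b ∷ B)     (true  ∷ A) zero    x∉ = contradiction here x∉
  +′-∩-∉ (true ∷ B)  (false ∷ A) zero    x∉ = refl
  +′-∩-∉ (false ∷ B) (false ∷ A) zero    x∉ = refl
  +′-∩-∉ (b ∷ B)     (a ∷ A)     (suc x) x∉ = cong (_ ∷_) (+′-∩-∉ B A x (x∉ ∘ there))

  mix-∩ : ∀ (H B₁ B₂ : Subset n) → mix H B₁ B₂ ∩ H ≡ B₁ ∩ H
  mix-∩ []          []       []       = refl
  mix-∩ (true  ∷ H) (_ ∷ B₁) (_ ∷ B₂) = cong (_ ∷_) (mix-∩ H B₁ B₂)
  mix-∩ (false ∷ H) (b₁ ∷ B₁) (b₂ ∷ B₂) = cong₂ _∷_ (trans (Bool.∧-zeroʳ b₂) (sym (Bool.∧-zeroʳ b₁))) (mix-∩ H B₁ B₂)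

  mix-∩∁ : ∀ (H B₁ B₂ : Subset n) → mix H B₁ B₂ ∩ ∁ H ≡ B₂ ∩ ∁ H
  mix-∩∁ []          []       []       = refl
  mix-∩∁ (true  ∷ H) (b₁ ∷ B₁) (b₂ ∷ B₂) = cong₂ _∷_ (trans (Bool.∧-zeroʳ b₁) (sym (Bool.∧-zeroʳ b₂))) (mix-∩∁ H B₁ B₂)
  mix-∩∁ (false ∷ H) (_ ∷ B₁) (_ ∷ B₂) = cong (_ ∷_) (mix-∩∁ H B₁ B₂)

  self-∩ : ∀ (H : Subset n) → H ∩ H ≡ H
  self-∩ []      = refl
  self-∩ (h ∷ H) = cong₂ _∷_ (Bool.∧-idem h) (self-∩ H)

  self-∩∁ : ∀ (H : Subset n) → H ∩ ∁ H ≡ ⊥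
  self-∩∁ []      = refl
  self-∩∁ (h ∷ H) = cong₂ _∷_ (Bool.∧-inverseʳ h) (self-∩∁ H)

  member : ∀ {A : Subset n} → 1 ≤ ∣ A ∣ → ∃ (_∈ A)
  member {A = true  ∷ A} _  = zero , here
  member {A = false ∷ A} 1≤ = let x , x∈ = member 1≤ in suc x , there x∈

  another : ∀ {A : Subset n} → 2 ≤ ∣ A ∣ → ∀ x → ∃ λ y → y ∈ A × y ≢ x
  another {A = A} 2≤ x with x ∈? A
  ... | yes x∈ = let y , y∈ = member {A = A -′ x} (ℕ.s≤s⁻¹ (ℕ.≤-trans 2≤ (ℕ.≤-reflexive (sym (∣-′∣ x∈)))))
                     y≢x = λ y≡x → ∉-′-here A x (subst (_∈ A -′ x) y≡x y∈)
                 in y , subst (y ∈_) (trans (Vec.[]≔-idempotent A x) (+′-absorb x∈)) (∈+′ y≢x y∈) , y≢x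
  ... | no x∉  = let y , y∈ = member (ℕ.<⇒≤ 2≤) in y , y∈ , λ y≡x → x∉ (subst (_∈ A) y≡x y∈)

  -- The two matroids attached to a circuit-hyperplane H: the matroid of H and all
  -- its neighbours, and that of the neighbours alone.

  module _ (H : Subset n) where
    private
      l′ = ∣ ∁ H ∣
      k′ = ∣ H ∣

    thickened : Matroid n
    thickened = relabelled (thickSort H) (⨁ ((l′ ℕ.+ k′ , thick l′ k′) ∷ []))

    neighbours : 1 ≤ l′ → Matroid n
    neighbours 1≤l = relabelled (pairSort H) (⨁ ((l′ , U 1 l′ 1≤l) ∷ (k′ , U (ℕ.pred k′) k′ ℕ.pred[n]≤n) ∷ []))

    private
      unsort : ∀ {N} (π : Permutation n N) (f : Fin l′ ⊎ Fin k′ → Fin N) → (∀ e → π ⟨$⟩ʳ e ≡ f (side H e)) →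
               ∀ s → π ⟨$⟩ˡ (f s) ≡ unside H s
      unsort π f eq s = begin
        π ⟨$⟩ˡ f s                       ≡⟨ cong (λ s → π ⟨$⟩ˡ f s) (side-unside H s) ⟨
        π ⟨$⟩ˡ f (side H (unside H s))   ≡⟨ cong (π ⟨$⟩ˡ_) (eq (unside H s)) ⟨
        π ⟨$⟩ˡ (π ⟨$⟩ʳ unside H s)       ≡⟨ Perm.inverseˡ π ⟩
        unside H s                       ∎
        where open ≡-Reasoning

      thick-outs : ∀ B → take l′ (take (l′ ℕ.+ k′) (image (thickSort H) B)) ≡ outs H B
      thick-outs B = trans (cong (take l′) (take-tabulate {m = l′ ℕ.+ k′} {0} _)) (trans (take-tabulate {m = l′} _)
        (Vec.tabulate-cong λ j → cong (lookup B) (unsort (thickSort H) [ (λ j → (j ↑ˡ k′) ↑ˡ 0) , (λ j → (l′ ↑ʳ j) ↑ˡ 0) ]′ (λ _ → refl) (inj₁ j))))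

      thick-ins : ∀ B → drop l′ (take (l′ ℕ.+ k′) (image (thickSort H) B)) ≡ ins H B
      thick-ins B = trans (cong (drop l′) (take-tabulate {m = l′ ℕ.+ k′} {0} _)) (trans (drop-tabulate {m = l′} _)
        (Vec.tabulate-cong λ j → cong (lookup B) (unsort (thickSort H) [ (λ j → (j ↑ˡ k′) ↑ˡ 0) , (λ j → (l′ ↑ʳ j) ↑ˡ 0) ]′ (λ _ → refl) (inj₂ j))))

      pair-outs : ∀ B → take l′ (image (pairSort H) B) ≡ outs H B
      pair-outs B = trans (take-tabulate {m = l′} _)
        (Vec.tabulate-cong λ j → cong (lookup B) (unsort (pairSort H) [ (λ j → j ↑ˡ (k′ ℕ.+ 0)) , (λ j → l′ ↑ʳ (j ↑ˡ 0)) ]′ (λ _ → refl) (inj₁ j)))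

      pair-ins : ∀ B → take k′ (drop l′ (image (pairSort H) B)) ≡ ins H B
      pair-ins B = trans (cong (take k′) (drop-tabulate {m = l′} _)) (trans (take-tabulate {m = k′} {0} _)
        (Vec.tabulate-cong λ j → cong (lookup B) (unsort (pairSort H) [ (λ j → j ↑ˡ (k′ ℕ.+ 0)) , (λ j → l′ ↑ʳ (j ↑ˡ 0)) ]′ (λ _ → refl) (inj₂ j))))

      empty : ∀ (B : Subset 0) → ∣ B ∣ ≡ 0
      empty [] = refl

      thick-basis′ : ∀ l k B → 1 ≤ l → Basis (thick l k) B ⇔ (∣ B ∣ ≡ k × ∣ take l B ∣ ≤ 1)
      thick-basis′ (suc l) k B _ = thick-basis l k B

      thick-size : ∀ B → ∣ take (l′ ℕ.+ k′) (image (thickSort H) B) ∣ ≡ ∣ B ∣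
      thick-size B = begin
        ∣ X ∣                                ≡⟨ ∣take∣+∣drop∣ l′ X ⟩
        ∣ take l′ X ∣ ℕ.+ ∣ drop l′ X ∣      ≡⟨ cong₂ (λ p q → ∣ p ∣ ℕ.+ ∣ q ∣) (thick-outs B) (thick-ins B) ⟩
        ∣ outs H B ∣ ℕ.+ ∣ ins H B ∣         ≡⟨ cong₂ ℕ._+_ (∣outs∣ H B) (∣ins∣ H B) ⟩
        ∣ B ∩ ∁ H ∣ ℕ.+ ∣ B ∩ H ∣            ≡⟨ ∣∩∣+∣∩∁∣ B H ⟩
        ∣ B ∣                                ∎
        where
        open ≡-Reasoning
        X = take (l′ ℕ.+ k′) (image (thickSort H) B)

      thick-out : ∀ B → ∣ take l′ (take (l′ ℕ.+ k′) (image (thickSort H) B)) ∣ ≡ ∣ B ∩ ∁ H ∣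
      thick-out B = trans (cong ∣_∣ (thick-outs B)) (∣outs∣ H B)

    thickened-basis⁻ : 1 ≤ l′ → ∀ B → Basis thickened B → ∣ B ∣ ≡ k′ × ∣ B ∩ ∁ H ∣ ≤ 1
    thickened-basis⁻ 1≤l B (b , _) =
      let eq , ≤1 = Equivalence.to (thick-basis′ l′ k′ _ 1≤l) b in
      trans (sym (thick-size B)) eq , subst (_≤ 1) (thick-out B) ≤1

    thickened-basis⁺ : 1 ≤ l′ → ∀ B → ∣ B ∣ ≡ k′ → ∣ B ∩ ∁ H ∣ ≤ 1 → Basis thickened B
    thickened-basis⁺ 1≤l B eq ≤1 =
      Equivalence.from (thick-basis′ l′ k′ _ 1≤l) (trans (thick-size B) eq , subst (_≤ 1) (sym (thick-out B)) ≤1) ,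
      empty (drop (l′ ℕ.+ k′) (image (thickSort H) B))

    neighbours-basis⁻ : ∀ 1≤l B → Basis (neighbours 1≤l) B → ∣ B ∩ ∁ H ∣ ≡ 1 × ∣ B ∩ H ∣ ≡ ℕ.pred k′
    neighbours-basis⁻ 1≤l B (b , c , _) =
      trans (sym (trans (cong ∣_∣ (pair-outs B)) (∣outs∣ H B))) b ,
      trans (sym (trans (cong ∣_∣ (pair-ins B)) (∣ins∣ H B))) c

    neighbours-basis⁺ : ∀ 1≤l B → ∣ B ∩ ∁ H ∣ ≡ 1 → ∣ B ∩ H ∣ ≡ ℕ.pred k′ → Basis (neighbours 1≤l) B
    neighbours-basis⁺ 1≤l B b c =
      trans (trans (cong ∣_∣ (pair-outs B)) (∣outs∣ H B)) b ,
      trans (trans (cong ∣_∣ (pair-ins B)) (∣ins∣ H B)) c ,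
      empty (drop k′ (drop l′ (image (pairSort H) B)))

  sp-U₁ : ∀ l (1≤l : 1 ≤ l) → 2 ≤ l → SP (U 1 l 1≤l)
  sp-U₁ (suc (suc l)) (s≤s z≤n) _ = sp-parallel l
  sp-U₁ (suc zero) _ (s≤s ())

  sp-U₋₁ : ∀ k → 2 ≤ k → SP (U (ℕ.pred k) k ℕ.pred[n]≤n)
  sp-U₋₁ (suc (suc k)) _ = relabel (≐⇒≅ {M = U (suc k) (suc (suc k)) (ℕ.n≤1+n (suc k))} {U (suc k) (suc (suc k)) ℕ.pred[n]≤n}
                                        ((λ b → b) , (λ b → b))) (sp-circuit k)
  sp-U₋₁ (suc zero) (s≤s ())

  -- With a single element outside `H` that element would be a coloop of `S`, and with a single
  -- element in `H` that element would be a loop of `S`.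
  module CircuitHyperplane (H : Subset n) (2≤k : 2 ≤ ∣ H ∣) (2≤l : 2 ≤ ∣ ∁ H ∣) where

    1≤l : 1 ≤ ∣ ∁ H ∣
    1≤l = ℕ.<⇒≤ 2≤l

    T S : Matroid n
    T = thickened H
    S = neighbours H 1≤l

    neighbour-∩∁ : ∀ {h b} → b ∉ H → ∣ (H -′ h +′ b) ∩ ∁ H ∣ ≡ 1
    neighbour-∩∁ {h} {b} b∉ = begin
      ∣ (H -′ h +′ b) ∩ ∁ H ∣       ≡⟨ cong ∣_∣ (+′-∩-∈ (H -′ h) (∁ H) b (x∉p⇒x∈∁p b∉)) ⟩
      ∣ ((H -′ h) ∩ ∁ H) +′ b ∣     ≡⟨ cong (λ A → ∣ A +′ b ∣) (trans (-′-∩ H (∁ H) h) (cong (_-′ h) (self-∩∁ H))) ⟩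
      ∣ ⊥ -′ h +′ b ∣               ≡⟨ cong (λ A → ∣ A +′ b ∣) (-′-absorb ∉⊥) ⟩
      ∣ ⊥ +′ b ∣                    ≡⟨ ∣+′∣ {B = ⊥ {n}} {b} ∉⊥ ⟩
      suc ∣ ⊥ {n} ∣                 ≡⟨ cong suc (∣⊥∣≡0 n) ⟩
      1                             ∎
      where open ≡-Reasoning

    neighbour-∩ : ∀ {h b} → h ∈ H → b ∉ H → ∣ (H -′ h +′ b) ∩ H ∣ ≡ ℕ.pred ∣ H ∣
    neighbour-∩ {h} {b} h∈ b∉ = begin
      ∣ (H -′ h +′ b) ∩ H ∣         ≡⟨ cong ∣_∣ (trans (+′-∩-∉ (H -′ h) H b b∉) (-′-∩ H H h)) ⟩
      ∣ (H ∩ H) -′ h ∣              ≡⟨ cong (λ A → ∣ A -′ h ∣) (self-∩ H) ⟩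
      ∣ H -′ h ∣                    ≡⟨ cong ℕ.pred (∣-′∣ h∈) ⟩
      ℕ.pred ∣ H ∣                  ∎
      where open ≡-Reasoning

    neighbour : ∀ {h b} → h ∈ H → b ∉ H → Basis S (H -′ h +′ b)
    neighbour {h} {b} h∈ b∉ = neighbours-basis⁺ H 1≤l (H -′ h +′ b) (neighbour-∩∁ {h} b∉) (neighbour-∩ h∈ b∉)

    neighbours-size : ∀ B → Basis S B → ∣ B ∣ ≡ ∣ H ∣
    neighbours-size B b = let b , c = neighbours-basis⁻ H 1≤l B b in
      trans (sym (∣∩∣+∣∩∁∣ B H)) (trans (cong₂ ℕ._+_ b c) (suc-pred 2≤k))
      where
      suc-pred : ∀ {k} → 2 ≤ k → suc (ℕ.pred k) ≡ k
      suc-pred {suc k} _ = refl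

    S⊆T : ∀ B → Basis S B → Basis T B
    S⊆T B b = thickened-basis⁺ H 1≤l B (neighbours-size B b)
      (ℕ.≤-reflexive (proj₁ (neighbours-basis⁻ H 1≤l B b)))

    H∈T : Basis T H
    H∈T = thickened-basis⁺ H 1≤l H refl (ℕ.≤-trans (ℕ.≤-reflexive (trans (cong ∣_∣ (self-∩∁ H)) (∣⊥∣≡0 n))) z≤n)

    S-free : Free S
    S-free e with e ∈? H | member (ℕ.<⇒≤ 2≤k) | member 1≤l
    ... | yes e∈ | _ | b , b∈ =
      let h , h∈ , h≢e = another 2≤k e
          b∉ = x∈∁p⇒x∉p b∈
          e≢b = λ { refl → b∉ e∈ }
      in (_ , neighbour h∈ b∉ , ∈+′ e≢b (∈-′ (h≢e ∘ sym) e∈)) , (_ , neighbour e∈ b∉ , ∉+′ e≢b (∉-′-here H e))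
    ... | no e∉ | h , h∈ | _ =
      let b , b∈ , b≢e = another 2≤l e
          b∉ = x∈∁p⇒x∉p b∈
      in (_ , neighbour h∈ e∉ , ∈+′-here (H -′ h) e) , (_ , neighbour h∈ b∉ , ∉+′ (b≢e ∘ sym) (∉-′ h e∉))

    T-free : Free T
    T-free e = let (B , b , e∈) , (B′ , b′ , e∉) = S-free e in (B , S⊆T B b , e∈) , (B′ , S⊆T B′ b′ , e∉)

    -- Exchanges between two neighbours of `H` stay on one side of `H`. They are stated for any
    -- matroid having the neighbours among its bases, as both `S` and `T` do.
    module Swaps (M : Matroid n) (S⊆M : ∀ B → Basis S B → Basis M B) where

      swaps : ∀ B C {e f} → Basis M B → f ∈ B → e ∉ B → B -′ f +′ e ≡ C → Basis M C → Connected M e f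
      swaps B C b f∈ e∉ eq c = swap⇒connected M b f∈ e∉ (subst (Basis M) (sym (trans (exchange≡ B _ _) eq)) c)

      inside-H : ∀ {e f} → e ∈ H → f ∈ H → e ≢ f → Connected M e f
      inside-H {e} {f} e∈ f∈ e≢f =
        let b , b∈ = member 1≤l
            b∉ = x∈∁p⇒x∉p b∈
            e≢b = λ { refl → b∉ e∈ }
            f≢b = λ { refl → b∉ f∈ }
        in swaps (H -′ e +′ b) (H -′ f +′ b) (S⊆M _ (neighbour e∈ b∉)) (∈+′ f≢b (∈-′ (e≢f ∘ sym) f∈)) (∉+′ e≢b (∉-′-here H e))
             (begin
               H -′ e +′ b -′ f +′ e      ≡⟨ cong (_+′ e) (Vec.[]≔-commutes (H -′ e) b f (f≢b ∘ sym)) ⟩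
               H -′ e -′ f +′ b +′ e      ≡⟨ Vec.[]≔-commutes (H -′ e -′ f) b e (e≢b ∘ sym) ⟩
               H -′ e -′ f +′ e +′ b      ≡⟨ cong (λ A → A +′ e +′ b) (Vec.[]≔-commutes H e f e≢f) ⟩
               H -′ f -′ e +′ e +′ b      ≡⟨ cong (_+′ b) (Vec.[]≔-idempotent (H -′ f) e) ⟩
               H -′ f +′ e +′ b           ≡⟨ cong (_+′ b) (+′-absorb (∈-′ e≢f e∈)) ⟩
               H -′ f +′ b                ∎)
             (S⊆M _ (neighbour f∈ b∉))
        where open ≡-Reasoning

      outside-H : ∀ {e f} → e ∉ H → f ∉ H → e ≢ f → Connected M e f
      outside-H {e} {f} e∉ f∉ e≢f =
        let h , h∈ = member (ℕ.<⇒≤ 2≤k) in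
        swaps (H -′ h +′ f) (H -′ h +′ e) (S⊆M _ (neighbour h∈ f∉)) (∈+′-here (H -′ h) f) (∉+′ e≢f (∉-′ h e∉))
          (cong (_+′ e) (trans (Vec.[]≔-idempotent (H -′ h) f) (-′-absorb (∉-′ h f∉))))
          (S⊆M _ (neighbour h∈ e∉))

    -- The exchange leads from a neighbour to `H` itself. This one additional basis is what joins
    -- the two components of `S`.
    across : ∀ {e f} → e ∈ H → f ∉ H → Connected T e f
    across {e} {f} e∈ f∉ = Swaps.swaps T S⊆T (H -′ e +′ f) H (S⊆T (H -′ e +′ f) (neighbour e∈ f∉)) (∈+′-here (H -′ e) f)
      (∉+′ (λ { refl → f∉ e∈ }) (∉-′-here H e))
      (trans (cong (_+′ e) (trans (Vec.[]≔-idempotent (H -′ e) f) (-′-absorb (∉-′ e f∉))))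
             (trans (Vec.[]≔-idempotent H e) (+′-absorb e∈))) H∈T

    T-connected : ∀ e f → Connected T e f
    T-connected e f with e Fin.≟ f | e ∈? H | f ∈? H
    ... | yes e≡f | _ | _ = inj₁ e≡f
    ... | no e≢f | yes e∈ | yes f∈ = Swaps.inside-H T S⊆T e∈ f∈ e≢f
    ... | no e≢f | no e∉ | no f∉ = Swaps.outside-H T S⊆T e∉ f∉ e≢f
    ... | no e≢f | yes e∈ | no f∉ = across e∈ f∉
    ... | no e≢f | no e∉ | yes f∈ = connected-sym T (across f∈ e∉)

    T-decomposition : Decomposition T 1
    T-decomposition = record
      { summands = (∣ ∁ H ∣ ℕ.+ ∣ H ∣ , thick ∣ ∁ H ∣ ∣ H ∣) ∷ []
      ; all-sp   = inj₁ (sp-thick _ _ 1≤l (ℕ.<⇒≤ 2≤k)) ∷ []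
      ; count    = refl
      ; iso      = relabelled-≅ (thickSort H) (⨁ ((∣ ∁ H ∣ ℕ.+ ∣ H ∣ , thick ∣ ∁ H ∣ ∣ H ∣) ∷ []))
      }

    S-decomposition : Decomposition S 2
    S-decomposition = record
      { summands = (∣ ∁ H ∣ , U 1 ∣ ∁ H ∣ 1≤l) ∷ (∣ H ∣ , U (ℕ.pred ∣ H ∣) ∣ H ∣ ℕ.pred[n]≤n) ∷ []
      ; all-sp   = inj₁ (sp-U₁ _ 1≤l 2≤l) ∷ inj₁ (sp-U₋₁ _ 2≤k) ∷ []
      ; count    = refl
      ; iso      = relabelled-≅ (pairSort H) (⨁ ((∣ ∁ H ∣ , U 1 ∣ ∁ H ∣ 1≤l) ∷ (∣ H ∣ , U (ℕ.pred ∣ H ∣) ∣ H ∣ ℕ.pred[n]≤n) ∷ []))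
      }

    S-colouring : Colouring S 2
    S-colouring = record
      { colour    = colour
      ; connected = connected
      ; coloured  = coloured
      ; in-range  = in-range
      ; attained  = attained
      }
      where
      colour : Fin n → ℕ
      colour e = if does (e ∈? H) then 0 else 1
      connected : ∀ {e f} → colour e ≡ colour f → Connected S e f
      connected {e} {f} eq with e Fin.≟ f | e ∈? H | f ∈? H
      ... | yes e≡f | _ | _ = inj₁ e≡f
      ... | no e≢f | yes e∈ | yes f∈ = Swaps.inside-H S (λ _ b → b) e∈ f∈ e≢f
      ... | no e≢f | no e∉ | no f∉ = Swaps.outside-H S (λ _ b → b) e∉ f∉ e≢f
      closed : ∀ {B₁ B₂} → Basis S B₁ → Basis S B₂ → Basis S (mix H B₁ B₂)
      closed {B₁} {B₂} b₁ b₂ = neighbours-basis⁺ H 1≤l (mix H B₁ B₂)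
        (trans (cong ∣_∣ (mix-∩∁ H B₁ B₂)) (proj₁ (neighbours-basis⁻ H 1≤l B₂ b₂)))
        (trans (cong ∣_∣ (mix-∩ H B₁ B₂)) (proj₂ (neighbours-basis⁻ H 1≤l B₁ b₁)))
      apart : ∀ {e f} → e ∈ H → f ∉ H → ¬ Connected S e f
      apart = separated S H (λ {B₁} {B₂} → closed {B₁} {B₂})
      coloured : ∀ {e f} → Connected S e f → colour e ≡ colour f
      coloured {e} {f} c with e ∈? H | f ∈? H
      ... | yes _  | yes _  = refl
      ... | no _   | no _   = refl
      ... | yes e∈ | no f∉  = contradiction c (apart e∈ f∉)
      ... | no e∉  | yes f∈ = contradiction (connected-sym S c) (apart f∈ e∉)
      in-range : ∀ e → colour e < 2
      in-range e with e ∈? H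
      ... | yes _ = s≤s z≤n
      ... | no _  = s≤s (s≤s z≤n)
      attained : ∀ {j} → j < 2 → ∃ λ e → colour e ≡ j
      attained {zero} _ with member (ℕ.<⇒≤ 2≤k)
      ... | e , e∈ = e , inside⇒0
        where
        inside⇒0 : colour e ≡ 0
        inside⇒0 with e ∈? H
        ... | yes _ = refl
        ... | no e∉ = contradiction e∈ e∉
      attained {suc zero} _ with member 1≤l
      ... | e , e∈ = e , outside⇒1
        where
        outside⇒1 : colour e ≡ 1
        outside⇒1 with e ∈? H
        ... | yes e∈H = contradiction e∈H (x∈∁p⇒x∉p e∈)
        ... | no _ = refl
      attained {suc (suc _)} (s≤s (s≤s ()))

  connected⇒colouring : ∀ (M : Matroid (suc n)) → (∀ e f → Connected M e f) → Colouring M 1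
  connected⇒colouring M c = record
    { colour    = λ _ → 0
    ; connected = λ _ → c _ _
    ; coloured  = λ _ → refl
    ; in-range  = λ _ → s≤s z≤n
    ; attained  = λ { {zero} _ → zero , refl ; {suc _} (s≤s ()) }
    }

  module _ {i} {γ : Matroid (suc n) → ℤ} (C : SpeyerCoefficient i γ) (H : Subset (suc n)) (2≤k : 2 ≤ ∣ H ∣) (2≤l : 2 ≤ ∣ ∁ H ∣) where
    open SpeyerCoefficient C
    open CircuitHyperplane H 2≤k 2≤l

    v-thickened : v T ≡ ℤ.- (+ δ i 1)
    v-thickened = trans (v-decomposition C T-free T-decomposition (connected⇒colouring T T-connected)) (ℤ.-1*i≡-i (+ δ i 1))

    v-neighbours : v S ≡ + δ i 2
    v-neighbours = trans (v-decomposition C S-free S-decomposition S-colouring) (ℤ.*-identityˡ (+ δ i 2))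

open CircuitHyperplanes

-- Scaling, sums over a subset and exchange of indicator vectors

module ConeGeometry where

  open +-*-Solver

  private variable
    m n k l : ℕ
    u w w′ : R
    x x′ : R^ n

  natℚ : ℕ → ℚ
  natℚ zero    = 0ℚ
  natℚ (suc m) = 1ℚ ℚ.+ natℚ m

  0≤natℚ : ∀ m → 0ℚ ℚ.≤ natℚ m
  0≤natℚ zero    = ℚ.≤-refl
  0≤natℚ (suc m) = ℚ.≤-trans (0≤natℚ m) (ℚ.≤-trans (ℚ.≤-reflexive (sym (ℚ.+-identityˡ (natℚ m))))
    (ℚ.+-monoˡ-≤ (natℚ m) (ℚ.nonNegative⁻¹ 1ℚ)))

  0<natℚ : ∀ m → 0ℚ ℚ.< natℚ (suc m)
  0<natℚ m = ℚ.<-≤-trans (ℚ.positive⁻¹ 1ℚ) (ℚ.≤-trans (ℚ.≤-reflexive (sym (ℚ.+-identityʳ 1ℚ)))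
    (ℚ.+-monoʳ-≤ 1ℚ (0≤natℚ m)))

  app-⊠ : ∀ m x i → app (m ⊠ x) i ≡ natℚ m ℚ.* app x i
  app-⊠ zero    x i = sym (ℚ.*-zeroˡ (app x i))
  app-⊠ (suc m) x i = trans (cong (app x i ℚ.+_) (app-⊠ m x i))
    (solve 2 (λ p q → q :+ p :* q := (con 1ℚ :+ p) :* q) refl (natℚ m) (app x i))

  scale : ℚ → R → R
  R.val (scale q x) = fromℚ q *ᴿ R.val x

  scale-mono : ∀ {q x y} → 0ℚ ℚ.< q → x ≼ y → scale q x ≼ scale q y
  scale-mono {q} {x} {y} 0<q (≼-intro x≤y) = ≼-intro λ ε 0<ε →
    let δ , 0<δ , eq = divide 0<q 0<ε
        N , p = x≤y δ 0<δ
        open ℚ.≤-Reasoning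
    in N , λ i N≤i → begin
      q ℚ.* app x i                  ≤⟨ ℚ.*-monoˡ-≤-nonNeg q {{ℚ.nonNegative (ℚ.<⇒≤ 0<q)}} (p i N≤i) ⟩
      q ℚ.* (app y i ℚ.+ δ)          ≡⟨ ℚ.*-distribˡ-+ q (app y i) δ ⟩
      q ℚ.* app y i ℚ.+ q ℚ.* δ      ≡⟨ cong (q ℚ.* app y i ℚ.+_) eq ⟩
      q ℚ.* app y i ℚ.+ ε            ∎

  -- Multiplication by the rational 1/(d + 1). It serves to find the share of a term that absorbs a
  -- given weight on `H`.
  divide-⊠ : ∀ d {h u} → 𝟎 ≼ h → h ≼ suc d ⊠ u → ∃ λ t → 𝟎 ≼ t × t ≼ u × suc d ⊠ t ≋ h
  divide-⊠ d {h} {u} 0≤h h≤ with divide (0<natℚ d) (ℚ.positive⁻¹ 1ℚ)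
  ... | q , 0<q , eq = scale q h ,
    ≼-trans (≼-pw λ i → sym (ℚ.*-zeroʳ q)) (scale-mono 0<q 0≤h) ,
    ≼-trans (scale-mono 0<q h≤) (≼-pw λ i → trans (cong (q ℚ.*_) (app-⊠ (suc d) u i)) (cancel′ (app u i))) ,
    ≋-pw λ i → trans (app-⊠ (suc d) (scale q h) i) (cancel (app h i))
    where
    cancel : ∀ r → natℚ (suc d) ℚ.* (q ℚ.* r) ≡ r
    cancel r = trans (sym (ℚ.*-assoc (natℚ (suc d)) q r)) (trans (cong (ℚ._* r) eq) (ℚ.*-identityˡ r))
    cancel′ : ∀ r → q ℚ.* (natℚ (suc d) ℚ.* r) ≡ r
    cancel′ r = trans (solve 3 (λ q m r → q :* (m :* r) := m :* (q :* r)) refl q (natℚ (suc d)) r) (cancel r)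

  dot : Subset n → R^ n → R
  dot []          x = 𝟎
  dot (true  ∷ H) x = x zero ⊞ dot H (x ∘ suc)
  dot (false ∷ H) x = dot H (x ∘ suc)

  dot-cong : ∀ (H : Subset n) → x ≗ x′ → dot H x ≋ dot H x′
  dot-cong []          eq = ≋-refl
  dot-cong (true  ∷ H) eq = ≋-+ (eq zero) (dot-cong H (eq ∘ suc))
  dot-cong (false ∷ H) eq = dot-cong H (eq ∘ suc)

  dot-+ : ∀ (H : Subset n) (x y : R^ n) → dot H (x +ⁿ y) ≋ dot H x ⊞ dot H y
  dot-+ []          x y = 𝟎≋𝟎⊞𝟎
  dot-+ (true  ∷ H) x y = ≋-trans (≋-+ ≋-refl (dot-+ H (x ∘ suc) (y ∘ suc)))
                                  (interchange (x zero) (y zero) (dot H (x ∘ suc)) (dot H (y ∘ suc)))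
  dot-+ (false ∷ H) x y = dot-+ H (x ∘ suc) (y ∘ suc)

  dot-0 : ∀ (H : Subset n) → x ≗ 0ⁿ → dot H x ≋ 𝟎
  dot-0 []          eq = ≋-refl
  dot-0 (true  ∷ H) eq = ≋-trans (≋-+ (eq zero) (dot-0 H (eq ∘ suc))) (≋-sym 𝟎≋𝟎⊞𝟎)
  dot-0 (false ∷ H) eq = dot-0 H (eq ∘ suc)

  dot-χ : ∀ (H B : Subset n) → dot H (χ u B) ≋ ∣ B ∩ H ∣ ⊠ u
  dot-χ []          []          = ≋-refl
  dot-χ (true  ∷ H) (true  ∷ B) = ≋-+ ≋-refl (dot-χ H B)
  dot-χ {u = u} (true  ∷ H) (false ∷ B) = ≋-trans (≋-+ ≋-refl (dot-χ {u = u} H B)) (≋-sym (zero-+ ≋-refl))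
  dot-χ {u = u} (false ∷ H) (true  ∷ B) = dot-χ {u = u} H B
  dot-χ {u = u} (false ∷ H) (false ∷ B) = dot-χ {u = u} H B

  ⊆-size : ∀ {A B : Subset n} → A ⊆ B → ∣ A ∣ ≡ ∣ B ∣ → A ≡ B
  ⊆-size {A = []}        {[]}        A⊆B eq = refl
  ⊆-size {A = true  ∷ A} {true  ∷ B} A⊆B eq = cong (inside ∷_) (⊆-size (drop-∷-⊆ A⊆B) (ℕ.suc-injective eq))
  ⊆-size {A = true  ∷ A} {false ∷ B} A⊆B eq with A⊆B here
  ... | ()
  ⊆-size {A = false ∷ A} {true  ∷ B} A⊆B eq = contradiction (p⊆q⇒∣p∣≤∣q∣ (drop-∷-⊆ A⊆B))
    (ℕ.<⇒≱ (ℕ.≤-reflexive (sym eq)))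
  ⊆-size {A = false ∷ A} {false ∷ B} A⊆B eq = cong (outside ∷_) (⊆-size (drop-∷-⊆ A⊆B) eq)

  larger : ∀ (A B : Subset n) → ∣ B ∣ < ∣ A ∣ → ∃ λ x → x ∈ A × x ∉ B
  larger (true  ∷ A) (true  ∷ B) lt = let x , x∈ , x∉ = larger A B (ℕ.s<s⁻¹ lt) in suc x , there x∈ , λ { (there x∈) → x∉ x∈ }
  larger (true  ∷ A) (false ∷ B) lt = zero , here , λ ()
  larger (false ∷ A) (true  ∷ B) lt = let x , x∈ , x∉ = larger A B (ℕ.<-trans (ℕ.n<1+n _) lt) in suc x , there x∈ , λ { (there x∈) → x∉ x∈ }
  larger (false ∷ A) (false ∷ B) lt = let x , x∈ , x∉ = larger A B lt in suc x , there x∈ , λ { (there x∈) → x∉ x∈ }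

  outsider : ∀ {A B : Subset n} → ∣ A ∣ ≡ ∣ B ∣ → A ≢ B → ∃ λ x → x ∈ A × x ∉ B
  outsider {A = []}        {[]}        eq A≢B = contradiction refl A≢B
  outsider {A = true  ∷ A} {true  ∷ B} eq A≢B =
    let x , x∈ , x∉ = outsider (ℕ.suc-injective eq) (A≢B ∘ cong (inside ∷_)) in suc x , there x∈ , λ { (there x∈) → x∉ x∈ }
  outsider {A = true  ∷ A} {false ∷ B} eq A≢B = zero , here , λ ()
  outsider {A = false ∷ A} {true  ∷ B} eq A≢B =
    let x , x∈ , x∉ = larger A B (ℕ.≤-reflexive (sym eq)) in suc x , there x∈ , λ { (there x∈) → x∉ x∈ }
  outsider {A = false ∷ A} {false ∷ B} eq A≢B =
    let x , x∈ , x∉ = outsider eq (A≢B ∘ cong (outside ∷_)) in suc x , there x∈ , λ { (there x∈) → x∉ x∈ }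

  -- The exchange makes the two sets trade their membership of `h` and of `b`, so no coordinate of
  -- the sum changes.
  χ-exchange : ∀ {H B : Subset n} {h b} → h ∈ H → h ∉ B → b ∈ B → b ∉ H →
               χ u (H -′ h +′ b) +ⁿ χ u (B -′ b +′ h) ≗ χ u H +ⁿ χ u B
  χ-exchange {u = u} {H} {B} {h} {b} h∈ h∉ b∈ b∉ e = bits (lookup (H -′ h +′ b) e) _ _ _ (table (e Fin.≟ h) (e Fin.≟ b))
    where
    bit : Bool → R
    bit s = if s then u else 𝟎
    comm : ∀ p q → p ⊞ q ≋ q ⊞ p
    comm p q = ≋-pw λ i → ℚ.+-comm (app p i) (app q i)
    bits : ∀ p q r s → (p ≡ r × q ≡ s) ⊎ (p ≡ s × q ≡ r) → bit p ⊞ bit q ≋ bit r ⊞ bit s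
    bits p q r s (inj₁ (refl , refl)) = ≋-refl
    bits p q r s (inj₂ (refl , refl)) = comm (bit p) (bit q)
    h≢b : h ≢ b
    h≢b refl = b∉ h∈
    table : Dec (e ≡ h) → Dec (e ≡ b) →
      (lookup (H -′ h +′ b) e ≡ lookup H e × lookup (B -′ b +′ h) e ≡ lookup B e) ⊎
      (lookup (H -′ h +′ b) e ≡ lookup B e × lookup (B -′ b +′ h) e ≡ lookup H e)
    table (yes refl) _ = inj₂
      ( trans (Vec.lookup∘update′ h≢b (H -′ h) inside) (trans (Vec.lookup∘update h H outside) (sym (∉⇒lookup h∉)))
      , trans (Vec.lookup∘update h (B -′ b) inside) (sym (Vec.[]=⇒lookup h∈)) )
    table (no _) (yes refl) = inj₂
      ( trans (Vec.lookup∘update b (H -′ h) inside) (sym (Vec.[]=⇒lookup b∈))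
      , trans (Vec.lookup∘update′ (h≢b ∘ sym) (B -′ b) inside) (trans (Vec.lookup∘update b B outside) (sym (∉⇒lookup b∉))) )
    table (no e≢h) (no e≢b) = inj₁
      ( trans (Vec.lookup∘update′ e≢b (H -′ h) inside) (Vec.lookup∘update′ e≢h H outside)
      , trans (Vec.lookup∘update′ e≢h (B -′ b) inside) (Vec.lookup∘update′ e≢b B outside) )

  -- All weight lying on `H` is gathered in one number `h`, ready to be compared with what the
  -- remaining terms can absorb.
  separate : ∀ {P Q : Subset n → Set} {H} → (∀ B → P B → B ≡ H ⊎ Q B) → Cone P w x →
             ∃ λ h → ∃₂ λ w′ y → 𝟎 ≼ h × w ≋ h ⊞ w′ × x ≗ χ h H +ⁿ y × Cone Q w′ y
  separate {H = H} split (nil w≋0 x≋0) = 𝟎 , 𝟎 , 0ⁿ , ≼-refl , ≋-trans w≋0 𝟎≋𝟎⊞𝟎 ,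
    (λ e → ≋-trans (x≋0 e) (≋-trans 𝟎≋𝟎⊞𝟎 (≋-+ (≋-sym (χ-𝟎 H e)) ≋-refl))) , nil ≋-refl (λ _ → ≋-refl)
    where
    χ-𝟎 : ∀ (B : Subset _) e → χ 𝟎 B e ≋ 𝟎
    χ-𝟎 B e with lookup B e
    ... | true  = ≋-refl
    ... | false = ≋-refl
  separate {w = w} {x = x} {H = H} split (cons {u = u} {w₀} {x₀} B 0≤u p eq eqs C) with separate split C | split B p
  ... | h , w′ , y , 0≤h , w≋ , x≋ , D | inj₁ refl =
    u ⊞ h , w′ , y , 0≼+ 0≤u 0≤h ,
    ≋-by (≋-+ eq w≋) (λ i → solve 5 (λ w u h v w₀ → (u :+ h :+ v) :- w := (u :+ w₀ :+ (h :+ v)) :- (w :+ w₀)) refl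
      (app w i) (app u i) (app h i) (app w′ i) (app w₀ i)) ,
    (λ e → ≋-trans (≋-by (≋-+ (eqs e) (x≋ e)) (λ i → solve 5 (λ w u h v w₀ → (u :+ h :+ v) :- w := (u :+ w₀ :+ (h :+ v)) :- (w :+ w₀)) refl
      (app (x e) i) (app (χ u H e) i) (app (χ h H e) i) (app (y e) i) (app (x₀ e) i)))
      (≋-+ (≋-sym (χ-+ H ≋-refl e)) ≋-refl)) , D
  ... | h , w′ , y , 0≤h , w≋ , x≋ , D | inj₂ q =
    h , u ⊞ w′ , χ u B +ⁿ y , 0≤h ,
    ≋-by (≋-+ eq w≋) (λ i → solve 5 (λ w u h v w₀ → (h :+ (u :+ v)) :- w := (u :+ w₀ :+ (h :+ v)) :- (w :+ w₀)) refl
      (app w i) (app u i) (app h i) (app w′ i) (app w₀ i)) ,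
    (λ e → ≋-by (≋-+ (eqs e) (x≋ e)) (λ i → solve 5 (λ w u h v w₀ → (h :+ (u :+ v)) :- w := (u :+ w₀ :+ (h :+ v)) :- (w :+ w₀)) refl
      (app (x e) i) (app (χ u B e) i) (app (χ h H e) i) (app (y e) i) (app (x₀ e) i))) ,
    cons B 0≤u q ≋-refl (λ _ → ≋-refl) D

open ConeGeometry

-- The subdivision given by relaxing a circuit-hyperplane

module Relaxations where

  open +-*-Solver

  private variable
    u w : R

  ⊠-add : ∀ a b → (a ℕ.+ b) ⊠ u ≋ a ⊠ u ⊞ b ⊠ u
  ⊠-add {u} zero    b = zero-+ ≋-refl
  ⊠-add {u} (suc a) b = ≋-by (⊠-add a b) λ i →
    solve 4 (λ u p q r → (u :+ q :+ r) :- (u :+ p) := (q :+ r) :- p) refl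
      (app u i) (app ((a ℕ.+ b) ⊠ u) i) (app (a ⊠ u) i) (app (b ⊠ u) i)

  χ-zero : ∀ {n} (B : Subset n) → u ≋ 𝟎 → χ u B ≗ 0ⁿ
  χ-zero B u≋0 e with lookup B e
  ... | true  = u≋0
  ... | false = ≋-refl

  -- P is Q with H added, T is N with H added, and N consists of the neighbours
  -- H − h + b of H, all of which lie in Q.

  module Relaxation {n} (H : Subset n) {r} (∣H∣ : ∣ H ∣ ≡ suc r) (N Q T P : Subset n → Set)
    (N⁺ : ∀ B → ∣ B ∩ ∁ H ∣ ≡ 1 → ∣ B ∩ H ∣ ≡ r → N B) (N⁻ : ∀ B → N B → ∣ B ∩ H ∣ ≡ r)
    (neighbour : ∀ {h b} → h ∈ H → b ∉ H → N (H -′ h +′ b))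
    (N⊆Q : ∀ B → N B → Q B) (Q-size : ∀ B → Q B → ∣ B ∣ ≡ suc r) (H∉Q : ∀ B → Q B → B ≢ H)
    (Q⊆P : ∀ B → Q B → P B) (H∈P : P H) (P-split : ∀ B → P B → B ≡ H ⊎ Q B)
    (N⊆T : ∀ B → N B → T B) (H∈T : T H) (T-split : ∀ B → T B → B ≡ H ⊎ N B) where

    overlap-≤ : ∀ {B} → Q B → ∣ B ∩ H ∣ ≤ r
    overlap-≤ {B} q = ℕ.s≤s⁻¹ (ℕ.≤-trans (ℕ.≤∧≢⇒< (∣p∩q∣≤∣q∣ B H) λ eq →
        let H⊆B = λ {z} z∈ → p∩q⊆p B H (subst (z ∈_) (sym (⊆-size (p∩q⊆q B H) eq)) z∈)
        in H∉Q B q (sym (⊆-size H⊆B (trans ∣H∣ (sym (Q-size B q))))))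
      (ℕ.≤-reflexive ∣H∣))

    -- d e_H + e_B is the sum of d + 1 neighbours of H, if d + 1 elements of H are not in B.
    neighbours-sum : ∀ d B → ∣ B ∣ ≡ suc r → ∣ B ∩ H ∣ ℕ.+ suc d ≡ suc r → 𝟎 ≼ u →
                     Cone N (suc d ⊠ u) (χ u B +ⁿ χ (d ⊠ u) H)
    neighbours-sum {u} zero B size eq 0≤u = cone-≋ (right u) (λ e → ≋-trans (right (χ u B e)) (≋-+ ≋-refl (≋-sym (χ-zero H ≋-refl e))))
      (cone-single 0≤u (N⁺ B outside≡1 inside≡r))
      where
      right : ∀ p → p ≋ p ⊞ 𝟎
      right p = ≋-pw λ i → solve 1 (λ p → p := p :+ con 0ℚ) refl (app p i)
      inside≡r : ∣ B ∩ H ∣ ≡ r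
      inside≡r = ℕ.suc-injective (trans (ℕ.+-comm 1 _) eq)
      outside≡1 : ∣ B ∩ ∁ H ∣ ≡ 1
      outside≡1 = ℕ.+-cancelʳ-≡ (∣ B ∩ H ∣) _ 1 (trans (∣∩∣+∣∩∁∣ B H) (trans size (cong suc (sym inside≡r))))
    neighbours-sum {u} (suc d) B size eq 0≤u =
      -- One copy of e_H together with e_B becomes a neighbour of `H` and the set `B -′ b +′ h`,
      -- which misses one element of `H` fewer.
      let h , h∈ , h∉ = outsider {A = H} {B} (trans ∣H∣ (sym size)) (H≢B ∘ sym)
          b , b∈ , b∉ = outsider {A = B} {H} (trans size (sym ∣H∣)) H≢B
          IH = neighbours-sum d (B -′ b +′ h) (trans (∣-′+′∣ b∈ h∉) size)
                 (trans (cong (ℕ._+ suc d) (overlap+1 h∈ h∉ b∉)) (trans (sym (ℕ.+-suc ∣ B ∩ H ∣ (suc d))) eq)) 0≤u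
      in cone-≋ ≋-refl
           (λ e → ≋-by (≋-+ (χ-exchange h∈ h∉ b∈ b∉ e) (≋-sym (χ-+ {u = suc d ⊠ u} H ≋-refl e))) λ i →
             solve 6 (λ p q s t v z → (t :+ z) :- (p :+ (q :+ v)) := (s :+ t :+ z) :- (p :+ q :+ (s :+ v))) refl
               (app (χ u (H -′ h +′ b) e) i) (app (χ u (B -′ b +′ h) e) i) (app (χ u H e) i) (app (χ u B e) i)
               (app (χ (d ⊠ u) H e) i) (app (χ (suc d ⊠ u) H e) i))
           (cone-+ (cone-single 0≤u (neighbour h∈ b∉)) IH)
      where
      H≢B : B ≢ H
      H≢B refl = ℕ.m+1+n≢m (suc r) (trans (cong (ℕ._+ suc (suc d)) (sym (trans (cong ∣_∣ (self-∩ H)) ∣H∣)))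
        (trans eq refl))
      overlap+1 : ∀ {h b} → h ∈ H → h ∉ B → b ∉ H → ∣ (B -′ b +′ h) ∩ H ∣ ≡ suc ∣ B ∩ H ∣
      overlap+1 {h} {b} h∈ h∉ b∉ = begin
        ∣ (B -′ b +′ h) ∩ H ∣        ≡⟨ cong ∣_∣ (+′-∩-∈ (B -′ b) H h h∈) ⟩
        ∣ ((B -′ b) ∩ H) +′ h ∣      ≡⟨ cong (λ A → ∣ A +′ h ∣) (trans (-′-∩ B H b) (-′-absorb (b∉ ∘ p∩q⊆q B H))) ⟩
        ∣ (B ∩ H) +′ h ∣             ≡⟨ ∣+′∣ (h∉ ∘ p∩q⊆p B H) ⟩
        suc ∣ B ∩ H ∣                ∎
        where open ≡-Reasoning

    -- The defect is the amount by which the sum over `H` falls short of its maximum `r ⊠ w` on the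
    -- cone of `Q`. Adding e_H with exactly this weight turns all terms into neighbours, and adding
    -- less of it does not lead out of the cone of `Q`.
    record Defect (w : R) (y : R^ n) : Set where
      field
        {defect} : R
        0≤defect : 𝟎 ≼ defect
        dot≋     : dot H y ⊞ defect ≋ r ⊠ w
        full     : Cone N (w ⊞ defect) (y +ⁿ χ defect H)
        absorb   : ∀ {h} → 𝟎 ≼ h → h ≼ defect → ¬¬ Cone Q (w ⊞ h) (y +ⁿ χ h H)

    zero-cone : ∀ {h} {Q : Subset n → Set} → 𝟎 ≼ h → h ≼ 𝟎 → Cone Q h (χ h H)
    zero-cone 0≤h h≤0 = let h≋0 = ≼-antisym h≤0 0≤h in nil h≋0 (χ-zero H h≋0)

    -- A term of weight `u` on a set `B` that meets `H` in `r - d` elements contributes `d ⊠ u`,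
    -- because `d` copies of e_H and one of e_B make `d + 1` neighbours.
    defect : ∀ {y} → Cone Q w y → Defect w y
    defect {w} {y} (nil w≋0 y≋0) = record
      { defect   = 𝟎
      ; 0≤defect = ≼-refl
      ; dot≋     = ≋-trans (≋-+ (dot-0 H y≋0) ≋-refl) (≋-trans (≋-sym 𝟎≋𝟎⊞𝟎) (≋-sym (≋-trans (⊠-cong r w≋0) (⊠-𝟎 r))))
      ; full     = cone-+ (nil w≋0 y≋0) (zero-cone ≼-refl ≼-refl)
      ; absorb   = λ 0≤h h≤0 → pure (cone-+ (nil w≋0 y≋0) (zero-cone 0≤h h≤0))
      }
    defect {w} {y} C₁@(cons {u = u} {w₀} {y₀} B 0≤u q eq eqs C) = record
      { defect   = d ⊠ u ⊞ D₀
      ; 0≤defect = 0≼+ (⊠-nonneg d 0≤u) 0≤D₀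
      ; dot≋     = ≋-trans (≋-+ (≋-trans (dot-cong H eqs) (≋-trans (dot-+ H (χ u B) y₀) (≋-+ (dot-χ H B) ≋-refl))) ≋-refl)
          (≋-trans (≋-by (≋-+ dot≋₀ (≋-sym r⊠u)) λ i →
            solve 6 (λ s y d D ru rw → (ru :+ rw) :- (s :+ y :+ (d :+ D)) := (rw :+ ru) :- (y :+ D :+ (s :+ d))) refl
              (app (∣ B ∩ H ∣ ⊠ u) i) (app (dot H y₀) i) (app (d ⊠ u) i) (app D₀ i) (app (r ⊠ u) i) (app (r ⊠ w₀) i))
            (≋-sym (≋-trans (⊠-cong r eq) (⊠-+ r))))
      ; full     = cone-≋
          (≋-by (≋-sym eq) λ i →
            solve 5 (λ u d w₀ D w → (w :+ (d :+ D)) :- (u :+ d :+ (w₀ :+ D)) := w :- (u :+ w₀)) refl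
              (app u i) (app (d ⊠ u) i) (app w₀ i) (app D₀ i) (app w i))
          (λ e → ≋-by (≋-+ (≋-sym (eqs e)) (≋-sym (χ-+ {u = d ⊠ u ⊞ D₀} H ≋-refl e))) λ i →
            solve 6 (λ u d w₀ D w z → (w :+ z) :- (u :+ d :+ (w₀ :+ D)) := (w :+ z) :- (u :+ w₀ :+ (d :+ D))) refl
              (app (χ u B e) i) (app (χ (d ⊠ u) H e) i) (app (y₀ e) i) (app (χ D₀ H e) i) (app (y e) i) (app (χ (d ⊠ u ⊞ D₀) H e) i))
          (cone-+ (neighbours-sum d B (Q-size B q) overlap≡ 0≤u) full₀)
      ; absorb   = λ {h} 0≤h h≤ → compare h (d ⊠ u) >>= λ
          { (inj₁ h≤d) → pure (small d overlap≡ 0≤h h≤d)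
          ; (inj₂ d≤h) → absorb₀ {h ⊟ d ⊠ u} (≼⇒0≼- d≤h)
              (≼-by h≤ λ i → solve 3 (λ h d D → D :- (h :- d) := (d :+ D) :- h) refl (app h i) (app (d ⊠ u) i) (app D₀ i)) >>= λ E →
              pure (cone-≋
                (≋-by (≋-sym eq) λ i →
                  solve 5 (λ u d w₀ h w → (w :+ h) :- (u :+ d :+ (w₀ :+ (h :- d))) := w :- (u :+ w₀)) refl
                    (app u i) (app (d ⊠ u) i) (app w₀ i) (app h i) (app w i))
                (λ e → ≋-by (≋-+ (≋-sym (eqs e)) (≋-sym (χ-+ {u = h} H (a≋x⊞[a⊟x] h (d ⊠ u)) e))) λ i →
                  solve 6 (λ u d w₀ D w z → (w :+ z) :- (u :+ d :+ (w₀ :+ D)) := (w :+ z) :- (u :+ w₀ :+ (d :+ D))) refl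
                    (app (χ u B e) i) (app (χ (d ⊠ u) H e) i) (app (y₀ e) i) (app (χ (h ⊟ d ⊠ u) H e) i) (app (y e) i) (app (χ h H e) i))
                (cone-+ (cone-map (λ {B} → N⊆Q B) (neighbours-sum d B (Q-size B q) overlap≡ 0≤u)) E)) }
      }
      where
      open Defect (defect C) renaming (defect to D₀; 0≤defect to 0≤D₀; dot≋ to dot≋₀; full to full₀; absorb to absorb₀)
      d = r ℕ.∸ ∣ B ∩ H ∣
      overlap≡ : ∣ B ∩ H ∣ ℕ.+ suc d ≡ suc r
      overlap≡ = trans (ℕ.+-suc ∣ B ∩ H ∣ d) (cong suc (ℕ.m+[n∸m]≡n (overlap-≤ q)))
      r⊠u : r ⊠ u ≋ ∣ B ∩ H ∣ ⊠ u ⊞ d ⊠ u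
      r⊠u = subst (λ j → j ⊠ u ≋ ∣ B ∩ H ∣ ⊠ u ⊞ d ⊠ u) (ℕ.m+[n∸m]≡n (overlap-≤ q)) (⊠-add ∣ B ∩ H ∣ d)
      -- Only the share `t` of the weight on `B` is turned into neighbours. It takes up `suc d ⊠ t`
      -- of e_H, which is `h`, and the rest `u ⊟ t` stays on `B`.
      split : ∀ d {h t} → ∣ B ∩ H ∣ ℕ.+ suc (suc d) ≡ suc r → 𝟎 ≼ t → t ≼ u → suc d ⊠ t ≋ h → Cone Q (w ⊞ h) (y +ⁿ χ h H)
      split d {h} {t} overlap≡ 0≤t t≤u dt≋h = cone-≋
        (≋-by (≋-+ (≋-sym eq) dt≋h) λ i →
          solve 6 (λ w u w₀ t d h → (w :+ h) :- (t :+ d :+ (u :- t :+ w₀)) := (w :+ h) :- (u :+ w₀ :+ d)) refl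
            (app w i) (app u i) (app w₀ i) (app t i) (app (suc d ⊠ t) i) (app h i))
        (λ e → ≋-by (≋-+ (≋-+ (≋-sym (eqs e)) (χ-cong H dt≋h e)) (≋-sym (χ-+ {u = u} B (a≋x⊞[a⊟x] u t) e))) λ i →
          solve 7 (λ w u w₀ t d h v → (w :+ h) :- (t :+ d :+ (v :+ w₀)) := (w :+ h :+ u) :- (u :+ w₀ :+ d :+ (t :+ v))) refl
            (app (y e) i) (app (χ u B e) i) (app (y₀ e) i) (app (χ t B e) i) (app (χ (suc d ⊠ t) H e) i) (app (χ h H e) i) (app (χ (u ⊟ t) B e) i))
        (cone-+ (cone-map (λ {B} → N⊆Q B) (neighbours-sum (suc d) B (Q-size B q) overlap≡ 0≤t))
                (cone-+ (cone-single (≼⇒0≼- t≤u) q) C))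
      small : ∀ d {h} → ∣ B ∩ H ∣ ℕ.+ suc d ≡ suc r → 𝟎 ≼ h → h ≼ d ⊠ u → Cone Q (w ⊞ h) (y +ⁿ χ h H)
      small zero    _ 0≤h h≤0 = cone-+ C₁ (zero-cone 0≤h h≤0)
      small (suc d) overlap≡ 0≤h h≤ = let t , 0≤t , t≤u , dt≋h = divide-⊠ d 0≤h h≤ in split d overlap≡ 0≤t t≤u dt≋h

    dot-N : ∀ {y} → Cone N w y → dot H y ≋ r ⊠ w
    dot-N (nil w≋0 y≋0) = ≋-trans (dot-0 H y≋0) (≋-sym (≋-trans (⊠-cong r w≋0) (⊠-𝟎 r)))
    dot-N (cons {u = u} {w₀} {y₀} B 0≤u q eq eqs C) = ≋-trans (dot-cong H eqs) (≋-trans (dot-+ H (χ u B) y₀)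
      (≋-trans (≋-+ (≋-trans (dot-χ H B) (subst (λ j → j ⊠ u ≋ r ⊠ u) (sym (N⁻ B q)) ≋-refl)) (dot-N C))
               (≋-sym (≋-trans (⊠-cong r eq) (⊠-+ r)))))

    -- In the cone of `Q` the sum over `H` is at most `r ⊠ w`, whereas a weight `h` on `H` in the
    -- cone of `T` makes it `r ⊠ w ⊞ h`. Hence `h` vanishes and only neighbours remain.
    meet : ∀ {x} → Cone Q w x → Cone T w x → Cone N w x
    meet {w} {x} C D with separate T-split D
    ... | h , w′ , y , 0≤h , w≋ , x≋ , E = cone-≋
        (≋-trans (zero-+ h≋0) (≋-sym w≋))
        (λ e → ≋-trans (zero-+ (χ-zero H h≋0 e)) (≋-sym (x≋ e))) E
      where
      open Defect (defect C) renaming (defect to D₀)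
      dot-x : dot H x ≋ suc r ⊠ h ⊞ r ⊠ w′
      dot-x = ≋-trans (dot-cong H x≋) (≋-trans (dot-+ H (χ h H) y) (≋-+
        (≋-trans (dot-χ H H) (subst (λ j → j ⊠ h ≋ suc r ⊠ h) (sym (trans (cong ∣_∣ (self-∩ H)) ∣H∣)) ≋-refl)) (dot-N E)))
      h≤0 : h ≼ 𝟎
      h≤0 = ≼-by (≼-+ (≋⇒≼ (≋-+ (≋-+ dot≋ (≋-sym dot-x)) (≋-trans (⊠-cong r w≋) (⊠-+ r)))) 0≤defect) λ i →
        solve 6 (λ h rh rw x D w → con 0ℚ :- h := (w :+ x :+ (rh :+ rw) :+ D) :- (x :+ D :+ (h :+ rh :+ rw) :+ w :+ con 0ℚ)) refl
          (app h i) (app (r ⊠ h) i) (app (r ⊠ w′) i) (app (dot H x) i) (app D₀ i) (app (r ⊠ w) i)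
      h≋0 : h ≋ 𝟎
      h≋0 = ≼-antisym h≤0 0≤h

    -- The weight `h` on `H` is compared with the defect of the other terms. If it is smaller, they
    -- absorb it; if it is larger, the defect turns them into neighbours and the surplus remains on
    -- `H`.
    covers : ∀ {x} → Cone P w x → ¬¬ (Cone Q w x ⊎ Cone T w x)
    covers {w} {x} C with separate P-split C
    ... | h , w′ , y , 0≤h , w≋ , x≋ , E = compare h D₀ >>= λ
      { (inj₁ h≤D) → absorb 0≤h h≤D >>= λ F → pure (inj₁ (cone-≋
          (≋-by (≋-sym w≋) λ i → solve 3 (λ w h v → w :- (v :+ h) := w :- (h :+ v)) refl (app w i) (app h i) (app w′ i))
          (λ e → ≋-by (≋-sym (x≋ e)) λ i → solve 3 (λ w h v → w :- (v :+ h) := w :- (h :+ v)) refl (app (x e) i) (app (χ h H e) i) (app (y e) i))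
          F))
      ; (inj₂ D≤h) → pure (inj₂ (cone-≋
          (≋-by (≋-sym w≋) λ i → solve 4 (λ w h v D → w :- (h :- D :+ (v :+ D)) := w :- (h :+ v)) refl
            (app w i) (app h i) (app w′ i) (app D₀ i))
          (λ e → ≋-by (≋-+ (≋-sym (x≋ e)) (≋-sym (χ-+ {u = h} H (a≋x⊞[a⊟x] h D₀) e))) λ i →
            solve 5 (λ w h v D g → w :- (g :+ (v :+ D)) := (w :+ h) :- (h :+ v :+ (D :+ g))) refl
              (app (x e) i) (app (χ h H e) i) (app (y e) i) (app (χ D₀ H e) i) (app (χ (h ⊟ D₀) H e) i))
          (cone-+ (cone-single (≼⇒0≼- D≤h) H∈T) (cone-map (λ {B} → N⊆T B) full)))) }
      where open Defect (defect E) renaming (defect to D₀)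

    subdivision : Subdivision (Cone P w) (Cone Q w) (Cone T w) (Cone N w)
    subdivision = record
      { part₁  = λ C → pure (cone-map (λ {B} → Q⊆P B) C)
      ; part₂  = λ C → pure (cone-map (λ {B} t → T⊆P B (T-split B t)) C)
      ; face₁  = λ C → pure (cone-map (λ {B} → N⊆Q B) C)
      ; face₂  = λ C → pure (cone-map (λ {B} → N⊆T B) C)
      ; meet   = λ C D → pure (meet C D)
      ; covers = covers
      }
      where
      T⊆P : ∀ B → B ≡ H ⊎ N B → P B
      T⊆P B (inj₁ refl) = H∈P
      T⊆P B (inj₂ b)    = Q⊆P B (N⊆Q B b)

open Relaxations

-- Matroids given by a sparse family of non-bases

module SparseMatroids where

  private variable
    m n k l : ℕ

  -- No two members are one exchange apart: this is what sparse paving means for the non-bases whose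
  -- size is the rank.
  Sparse : (Subset n → Set) → Set
  Sparse P = ∀ {R x y} → x ∉ R → y ∉ R → P (R +′ x) → P (R +′ y) → x ≡ y

  one-element : ∀ {A : Subset n} {x y} → ∣ A ∣ ≤ 1 → x ∈ A → y ∈ A → x ≡ y
  one-element {A = A} {x} {y} ≤1 x∈ y∈ with x Fin.≟ y
  ... | yes x≡y = x≡y
  ... | no x≢y  = contradiction (member-size {A = A -′ x} (∈-′ (x≢y ∘ sym) y∈))
                    (ℕ.<⇒≱ (ℕ.≤-trans (ℕ.≤-reflexive (∣-′∣ x∈)) ≤1))
    where
    member-size : ∀ {n} {A : Subset n} {x} → x ∈ A → 1 ≤ ∣ A ∣
    member-size {A = true  ∷ A} _          = s≤s z≤n
    member-size {A = false ∷ A} (there x∈) = member-size x∈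

  as-neighbour : ∀ {H B : Subset n} → ∣ B ∣ ≡ ∣ H ∣ → B ≢ H → ∣ B ∩ ∁ H ∣ ≤ 1 →
                 ∃₂ λ h b → h ∈ H × b ∉ H × B ≡ H -′ h +′ b
  as-neighbour {H = H} {B} eq B≢H ≤1 =
    let h , h∈ , h∉ = outsider (sym eq) (B≢H ∘ sym)
        b , b∈ , b∉ = outsider eq B≢H
    in h , b , h∈ , b∉ , ⊆-size (inclusion h∉ b∈ b∉) (trans eq (sym (∣-′+′∣ h∈ b∉)))
    where
    inclusion : ∀ {h b} → h ∉ B → b ∈ B → b ∉ H → B ⊆ H -′ h +′ b
    inclusion {h} {b} h∉ b∈ b∉ {z} z∈ with z ∈? H
    ... | yes z∈H = ∈+′ (λ { refl → b∉ z∈H }) (∈-′ (λ { refl → h∉ z∈ }) z∈H)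
    ... | no z∉H  = subst (_∈ H -′ h +′ b)
      (one-element ≤1 (x∈p∩q⁺ (b∈ , x∉p⇒x∈∁p b∉)) (x∈p∩q⁺ (z∈ , x∉p⇒x∈∁p z∉H))) (∈+′-here (H -′ h) b)

  sparse-≡ : ∀ {P : Subset n → Set} {H B} → Sparse P → P H → P B → ∣ B ∣ ≡ ∣ H ∣ → ∣ B ∩ ∁ H ∣ ≤ 1 → B ≡ H
  sparse-≡ {P = P} {H} {B} sparse pH pB eq ≤1 with Vec.≡-dec Bool._≟_ B H
  ... | yes B≡H = B≡H
  ... | no B≢H = let h , b , h∈ , b∉ , B≡ = as-neighbour eq B≢H ≤1 in
    contradiction (sparse {R = H -′ h} (∉-′-here H h) (∉-′ h b∉)
                    (subst P (sym (trans (Vec.[]≔-idempotent H h) (+′-absorb h∈))) pH) (subst P B≡ pB))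
                  λ h≡b → b∉ (subst (_∈ H) h≡b h∈)

  _∈ᴸ?_ : ∀ (B : Subset n) F → Dec (B ∈ᴸ F)
  _∈ᴸ?_ = DecMembership._∈?_ (Vec.≡-dec Bool._≟_)

  -- The matroid whose non-bases of size k are the members of F

  module _ (k : ℕ) (F : List (Subset n)) where

    NonMember : Subset n → Set
    NonMember B = ∣ B ∣ ≡ k × B ∉ᴸ F

    nonMember? : ∀ B → Dec (NonMember B)
    nonMember? B = (∣ B ∣ ℕ.≟ k) ×-dec ¬? (B ∈ᴸ? F)

    -- If every exchange led into `F`, sparseness would leave only one candidate `y`. Then `B₂`
    -- would lie in `B₁ -′ x +′ y` and, having the same size, would equal this member of `F`.
    sparse-exchange : Sparse (_∈ᴸ F) → ∀ {B₁ B₂} → NonMember B₁ → NonMember B₂ → ∀ {x} → x ∈ B₁ → x ∉ B₂ →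
                      ∃ λ y → y ∈ B₂ × y ∉ B₁ × NonMember (exchange B₁ x y)
    sparse-exchange sparse {B₁} {B₂} (size₁ , ∉₁) (size₂ , ∉₂) {x} x∈ x∉
      with Fin.any? (λ y → (y ∈? B₂) ×-dec ¬? (y ∈? B₁) ×-dec ¬? ((B₁ -′ x +′ y) ∈ᴸ? F))
    ... | yes (y , y∈ , y∉ , ∉F) = y , y∈ , y∉ ,
          subst NonMember (sym (exchange≡ B₁ x y)) (trans (∣-′+′∣ x∈ y∉) size₁ , ∉F)
    ... | no ∄y =
      let y , y∈ , y∉ = outsider (trans size₂ (sym size₁)) (λ { refl → x∉ x∈ })
          in-F = λ {z} (z∈ : z ∈ B₂) z∉ → decidable-stable ((B₁ -′ x +′ z) ∈ᴸ? F) λ ∉F → ∄y (z , z∈ , z∉ , ∉F)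
      in contradiction (subst (_∈ᴸ F) (sym (⊆-size (inclusion y∈ y∉ in-F)
           (trans size₂ (sym (trans (∣-′+′∣ x∈ y∉) size₁))))) (in-F y∈ y∉)) ∉₂
      where
      inclusion : ∀ {y} → y ∈ B₂ → y ∉ B₁ → (∀ {z} → z ∈ B₂ → z ∉ B₁ → B₁ -′ x +′ z ∈ᴸ F) → B₂ ⊆ B₁ -′ x +′ y
      inclusion {y} y∈ y∉ in-F {z} z∈ with z ∈? B₁
      ... | yes z∈₁ = ∈+′ (λ { refl → y∉ z∈₁ }) (∈-′ (λ { refl → x∉ z∈ }) z∈₁)
      ... | no z∉₁  = subst (_∈ B₁ -′ x +′ y) (sparse (∉-′ x y∉) (∉-′ x z∉₁) (in-F y∈ y∉) (in-F z∈ z∉₁)) (∈+′-here (B₁ -′ x) y)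

    sparseMatroid : Sparse (_∈ᴸ F) → ∃ NonMember → Matroid n
    sparseMatroid sparse nonempty .Basis          = NonMember
    sparseMatroid sparse nonempty .basis?         = nonMember?
    sparseMatroid sparse nonempty .someBasis      = nonempty
    sparseMatroid sparse nonempty .basis-exchange = sparse-exchange sparse

  module _ {H : Subset n} {F : List (Subset n)} where

    sparse-tail : Sparse (_∈ᴸ H ∷ F) → Sparse (_∈ᴸ F)
    sparse-tail sparse x∉ y∉ p q = sparse x∉ y∉ (there p) (there q)

    nonMember-tail : ∀ {B} → NonMember k (H ∷ F) B → NonMember k F B
    nonMember-tail (size , ∉) = size , ∉ ∘ there

    -- By sparseness no neighbour of `H` belongs to the family, so all neighbours are bases before
    -- as well as after the relaxation.
    relaxation : (sparse : Sparse (_∈ᴸ H ∷ F)) → H ∉ᴸ F → ∀ {r} → ∣ H ∣ ≡ suc r →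
      (2≤k : 2 ≤ ∣ H ∣) (2≤l : 2 ≤ ∣ ∁ H ∣) →
      Subdivision (Cone (NonMember (suc r) F) 𝟏) (Cone (NonMember (suc r) (H ∷ F)) 𝟏)
                  (Cone (Basis (CircuitHyperplane.T H 2≤k 2≤l)) 𝟏) (Cone (Basis (CircuitHyperplane.S H 2≤k 2≤l)) 𝟏)
    relaxation sparse H∉F {r} ∣H∣ 2≤k 2≤l = Relaxation.subdivision H ∣H∣ (Basis S) (NonMember (suc r) (H ∷ F)) (Basis T) (NonMember (suc r) F)
      S⁺ S⁻ neighbour S⊆Q (λ _ → proj₁) (λ { B (_ , ∉) refl → ∉ (here refl) })
      (λ B → nonMember-tail) (∣H∣ , H∉F) P-split S⊆T H∈T T-split
      where
      open CircuitHyperplane H 2≤k 2≤l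
      pred≡ : ℕ.pred ∣ H ∣ ≡ r
      pred≡ = cong ℕ.pred ∣H∣
      S⁺ : ∀ B → ∣ B ∩ ∁ H ∣ ≡ 1 → ∣ B ∩ H ∣ ≡ r → Basis S B
      S⁺ B out in′ = neighbours-basis⁺ H 1≤l B out (trans in′ (sym pred≡))
      S⁻ : ∀ B → Basis S B → ∣ B ∩ H ∣ ≡ r
      S⁻ B b = trans (proj₂ (neighbours-basis⁻ H 1≤l B b)) pred≡
      S⊆Q : ∀ B → Basis S B → NonMember (suc r) (H ∷ F) B
      S⊆Q B b = trans (neighbours-size B b) ∣H∣ , λ B∈ →
        B≢H (sparse-≡ sparse (here refl) B∈ (neighbours-size B b) (ℕ.≤-reflexive out))
        where
        out = proj₁ (neighbours-basis⁻ H 1≤l B b)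
        B≢H : B ≢ H
        B≢H refl = contradiction (trans (sym out) (trans (cong ∣_∣ (self-∩∁ H)) (∣⊥∣≡0 n))) λ ()
      P-split : ∀ B → NonMember (suc r) F B → B ≡ H ⊎ NonMember (suc r) (H ∷ F) B
      P-split B (size , ∉F) with Vec.≡-dec Bool._≟_ B H
      ... | yes B≡H = inj₁ B≡H
      ... | no B≢H  = inj₂ (size , λ { (here B≡H) → B≢H B≡H ; (there B∈F) → ∉F B∈F })
      T-split : ∀ B → Basis T B → B ≡ H ⊎ Basis S B
      T-split B b with thickened-basis⁻ H 1≤l B b
      ... | size , ≤1 with ∣ B ∩ ∁ H ∣ in eq | ≤1 | ∣∩∣+∣∩∁∣ B H
      ... | zero     | _       | sum = inj₁ (sym (⊆-size (λ {z} z∈ → p∩q⊆p B H (subst (z ∈_) (sym B∩H≡H) z∈)) (sym size)))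
        where
        B∩H≡H : B ∩ H ≡ H
        B∩H≡H = ⊆-size (p∩q⊆q B H) (trans sum size)
      ... | suc zero | s≤s z≤n | sum = inj₂ (S⁺ B eq (ℕ.suc-injective (trans sum (trans size ∣H∣))))

  module _ {i} {γ : Matroid (suc n) → ℤ} (C : SpeyerCoefficient i γ) where
    open SpeyerCoefficient C

    v-sparse : ∀ {r n′} → n ≡ suc n′ → r ≤ n′ → ∀ F (sparse : Sparse (_∈ᴸ F)) nonempty → Unique F →
               All (λ H → ∣ H ∣ ≡ suc r × 2 ≤ ∣ H ∣ × 2 ≤ ∣ ∁ H ∣) F →
               v (sparseMatroid (suc r) F sparse nonempty) ≡ + (length F ℕ.* (δ i 1 ℕ.+ δ i 2)) ℤ.- + words 1 r n′ i
    v-sparse {r} {n′} n≡ r≤n′ [] sparse nonempty [] [] =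
      trans (v-uniform C n≡ r≤n′ proj₁ (λ eq → eq , λ ())) (sym (ℤ.+-identityˡ (ℤ.- + words 1 r n′ i)))
    v-sparse {r} {n′} n≡ r≤n′ (H ∷ F) sparse nonempty (H∉ ∷ unique) ((∣H∣ , 2≤k , 2≤l) ∷ all) = begin
      v M₁                                          ≡⟨ ℤS.solve 3 (λ m t s → m ℤS.:= m ℤS.:+ t ℤS.:- s ℤS.:- t ℤS.:+ s) refl (v M₁) (v T) (v S) ⟩
      v M₁ ℤ.+ v T ℤ.- v S ℤ.- v T ℤ.+ v S          ≡⟨ cong (λ z → z ℤ.- v T ℤ.+ v S) (sym (valuation-union valuative {M₀} {M₁} {T} {S}
                                                         (relaxation sparse H∉F ∣H∣ 2≤k 2≤l))) ⟩
      v M₀ ℤ.- v T ℤ.+ v S                          ≡⟨ cong₂ ℤ._+_ (cong₂ ℤ._-_ (v-sparse n≡ r≤n′ F (sparse-tail sparse) nonempty′ unique all)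
                                                         (v-thickened C H 2≤k 2≤l)) (v-neighbours C H 2≤k 2≤l) ⟩
      + (length F ℕ.* (δ i 1 ℕ.+ δ i 2)) ℤ.- + words 1 r n′ i ℤ.- (ℤ.- (+ δ i 1)) ℤ.+ + δ i 2
        ≡⟨ ℤS.solve 4 (λ l w a b → l ℤS.:- w ℤS.:- (ℤS.:- a) ℤS.:+ b ℤS.:= (a ℤS.:+ b) ℤS.:+ l ℤS.:- w) refl
             (+ (length F ℕ.* (δ i 1 ℕ.+ δ i 2))) (+ words 1 r n′ i) (+ δ i 1) (+ δ i 2) ⟩
      + (length (H ∷ F) ℕ.* (δ i 1 ℕ.+ δ i 2)) ℤ.- + words 1 r n′ i ∎
      where
      open ≡-Reasoning
      open CircuitHyperplane H 2≤k 2≤l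
      nonempty′ : ∃ (NonMember (suc r) F)
      nonempty′ = let B , b = nonempty in B , nonMember-tail b
      M₀ = sparseMatroid (suc r) F (sparse-tail sparse) nonempty′
      M₁ = sparseMatroid (suc r) (H ∷ F) sparse nonempty
      H∉F : H ∉ᴸ F
      H∉F H∈ = All.lookup H∉ H∈ refl

open SparseMatroids

-- Connectedness of sparse paving matroids

module SparseConnectivity where

  private variable
    m n k l : ℕ

  record Adjacent (R R′ : Subset n) : Set where
    constructor adjacent
    field
      {common} : Subset n
      {x y}    : Fin n
      x≢y      : x ≢ y
      x∉       : x ∉ common
      y∉       : y ∉ common
      left     : R ≡ common +′ x
      right    : R′ ≡ common +′ y

  adjacent-exchange : ∀ {R : Subset n} {a b} → a ∈ R → b ∉ R → Adjacent R (R -′ a +′ b)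
  adjacent-exchange {R = R} {a} {b} a∈ b∉ = adjacent (λ { refl → b∉ a∈ }) (∉-′-here R a) (∉-′ a b∉)
    (sym (trans (Vec.[]≔-idempotent R a) (+′-absorb a∈))) refl

  adjacent-new : ∀ {R : Subset n} {a b c} → b ≢ c → b ∉ R → c ∉ R → Adjacent (R -′ a +′ b) (R -′ a +′ c)
  adjacent-new {a = a} b≢c b∉ c∉ = adjacent b≢c (∉-′ a b∉) (∉-′ a c∉) refl refl

  adjacent-old : ∀ {R : Subset n} {a a′ b} → a ≢ a′ → a ∈ R → a′ ∈ R → b ∉ R → Adjacent (R -′ a +′ b) (R -′ a′ +′ b)
  adjacent-old {R = R} {a} {a′} {b} a≢a′ a∈ a′∈ b∉ = adjacent {common = R -′ a -′ a′ +′ b} (a≢a′ ∘ sym)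
    (∉+′ a′≢b (∉-′-here (R -′ a) a′)) (∉+′ a≢b (∉-′ a′ (∉-′-here R a)))
    (sym (begin
      R -′ a -′ a′ +′ b +′ a′      ≡⟨ Vec.[]≔-commutes (R -′ a -′ a′) b a′ (a′≢b ∘ sym) ⟩
      R -′ a -′ a′ +′ a′ +′ b      ≡⟨ cong (_+′ b) (trans (Vec.[]≔-idempotent (R -′ a) a′) (+′-absorb (∈-′ (a≢a′ ∘ sym) a′∈))) ⟩
      R -′ a +′ b                  ∎))
    (sym (begin
      R -′ a -′ a′ +′ b +′ a       ≡⟨ Vec.[]≔-commutes (R -′ a -′ a′) b a (a≢b ∘ sym) ⟩
      R -′ a -′ a′ +′ a +′ b       ≡⟨ cong (λ A → A +′ a +′ b) (Vec.[]≔-commutes R a a′ a≢a′) ⟩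
      R -′ a′ -′ a +′ a +′ b       ≡⟨ cong (_+′ b) (trans (Vec.[]≔-idempotent (R -′ a′) a) (+′-absorb (∈-′ a≢a′ a∈))) ⟩
      R -′ a′ +′ b                 ∎))
    where
    open ≡-Reasoning
    a≢b : a ≢ b
    a≢b refl = b∉ a∈
    a′≢b : a′ ≢ b
    a′≢b refl = b∉ a′∈

  -- Adding the same element to adjacent sets yields sets that are one exchange apart.
  adjacent-clash : ∀ {P : Subset n → Set} {R R′ e} → Sparse P → Adjacent R R′ → e ∉ R → e ∉ R′ → P (R +′ e) → P (R′ +′ e) → Void
  adjacent-clash {P = P} {e = e} sparse (adjacent {Q} {x} {y} x≢y x∉ y∉ refl refl) e∉ e∉′ p p′ =
    x≢y (sparse {R = Q +′ e} (∉+′ x≢e x∉) (∉+′ y≢e y∉)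
      (subst P (Vec.[]≔-commutes Q x e x≢e) p) (subst P (Vec.[]≔-commutes Q y e y≢e) p′))
    where
    x≢e : x ≢ e
    x≢e refl = e∉ (∈+′-here Q x)
    y≢e : y ≢ e
    y≢e refl = e∉′ (∈+′-here Q y)

  adjacent-≢ : ∀ {R R′ : Subset n} {e f} → Adjacent R R′ → f ∉ R → R +′ e ≢ R′ +′ f
  adjacent-≢ {e = e} {f} (adjacent {Q} {x} {y} x≢y x∉ y∉ refl refl) f∉ eq =
    ∉+′ (λ { refl → f∉ (∈+′-here Q x) }) (∉+′ x≢y x∉) (subst (x ∈_) eq x∈)
    where
    x∈ : x ∈ Q +′ x +′ e
    x∈ with x Fin.≟ e
    ... | yes refl = ∈+′-here (Q +′ x) x
    ... | no x≢e   = ∈+′ x≢e (∈+′-here Q x)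

  pick : ∀ (A : Subset n) j → j ≤ ∣ A ∣ → ∃ λ R → R ⊆ A × ∣ R ∣ ≡ j
  pick []          zero    _       = [] , id , refl
  pick (true  ∷ A) zero    _       = let R , R⊆A , eq = pick A zero z≤n in outside ∷ R , (λ { (there z∈) → there (R⊆A z∈) }) , eq
  pick (true  ∷ A) (suc j) (s≤s j≤) = let R , R⊆A , eq = pick A j j≤ in
    inside ∷ R , (λ { here → here ; (there z∈) → there (R⊆A z∈) }) , cong suc eq
  pick (false ∷ A) j       j≤      = let R , R⊆A , eq = pick A j j≤ in outside ∷ R , (λ { (there z∈) → there (R⊆A z∈) }) , eq

  module Connectivity {n′ r} (F : List (Subset (suc (suc n′)))) (sparse : Sparse (_∈ᴸ F)) (nonempty : ∃ (NonMember (suc r) F)) where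

    M : Matroid (suc (suc n′))
    M = sparseMatroid (suc r) F sparse nonempty

    clash : ∀ {R R′ e} → Adjacent R R′ → e ∉ R → e ∉ R′ → R +′ e ∈ᴸ F → R′ +′ e ∈ᴸ F → Void
    clash = adjacent-clash {P = _∈ᴸ F} sparse

    link : ∀ {e f R} → e ≢ f → ∣ R ∣ ≡ r → e ∉ R → f ∉ R → R +′ e ∉ᴸ F → R +′ f ∉ᴸ F → Connected M e f
    link {e} {f} {R} e≢f size e∉ f∉ e∉F f∉F = swap⇒connected M {R +′ f} {e} {f}
      (trans (∣+′∣ f∉) (cong suc size) , f∉F) (∈+′-here R f) (∉+′ e≢f e∉)
      (subst (NonMember (suc r) F) (sym eq) (trans (∣+′∣ e∉) (cong suc size) , e∉F))
      where
      eq : exchange (R +′ f) f e ≡ R +′ e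
      eq = trans (exchange≡ (R +′ f) f e) (cong (_+′ e) (trans (Vec.[]≔-idempotent R f) (-′-absorb f∉)))

    module _ {e f : Fin (suc (suc n′))} (e≢f : e ≢ f) where

      Avoiding : Subset (suc (suc n′)) → Set
      Avoiding R = ∣ R ∣ ≡ r × e ∉ R × f ∉ R

      Bad : Subset (suc (suc n′)) → Set
      Bad R = R +′ e ∈ᴸ F ⊎ R +′ f ∈ᴸ F

      good-or-bad : ∀ R → Avoiding R → Connected M e f ⊎ Bad R
      good-or-bad R (size , e∉ , f∉) with (R +′ e) ∈ᴸ? F | (R +′ f) ∈ᴸ? F
      ... | yes e∈F | _       = inj₂ (inj₁ e∈F)
      ... | no _    | yes f∈F = inj₂ (inj₂ f∈F)
      ... | no e∉F  | no f∉F  = inj₁ (link e≢f size e∉ f∉ e∉F f∉F)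

      others : Subset (suc (suc n′))
      others = ⊤ -′ e -′ f

      ∣others∣ : ∣ others ∣ ≡ n′
      ∣others∣ = ℕ.suc-injective (ℕ.suc-injective (trans (cong suc (∣-′∣ (∈-′ (e≢f ∘ sym) ∈⊤)))
        (trans (∣-′∣ {B = ⊤} {e} ∈⊤) (∣⊤∣≡n (suc (suc n′))))))

      ∈others⇒≢e : ∀ {z} → z ∈ others → z ≢ e
      ∈others⇒≢e z∈ refl = ∉-′ f (∉-′-here ⊤ e) z∈

      ∈others⇒≢f : ∀ {z} → z ∈ others → z ≢ f
      ∈others⇒≢f z∈ refl = ∉-′-here (⊤ -′ e) f z∈

      avoiding-exchange : ∀ {R a b} → Avoiding R → a ∈ R → b ∉ R → b ∈ others → Avoiding (R -′ a +′ b)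
      avoiding-exchange {R} {a} {b} (size , e∉ , f∉) a∈ b∉ b∈ = trans (∣-′+′∣ a∈ b∉) size ,
        ∉+′ (∈others⇒≢e b∈ ∘ sym) (∉-′ a e∉) , ∉+′ (∈others⇒≢f b∈ ∘ sym) (∉-′ a f∉)

      two : ∀ {R R′} → Adjacent R R′ → Avoiding R → Avoiding R′ → Bad R → Bad R′ →
            (R +′ e ∈ᴸ F × R′ +′ f ∈ᴸ F) ⊎ (R +′ f ∈ᴸ F × R′ +′ e ∈ᴸ F)
      two adj (_ , e∉ , f∉) (_ , e∉′ , f∉′) (inj₁ p) (inj₁ q) = contradiction (clash adj e∉ e∉′ p q) λ ()
      two adj (_ , e∉ , f∉) (_ , e∉′ , f∉′) (inj₁ p) (inj₂ q) = inj₁ (p , q)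
      two adj (_ , e∉ , f∉) (_ , e∉′ , f∉′) (inj₂ p) (inj₁ q) = inj₂ (p , q)
      two adj (_ , e∉ , f∉) (_ , e∉′ , f∉′) (inj₂ p) (inj₂ q) = contradiction (clash adj f∉ f∉′ p q) λ ()

      -- Of three mutually adjacent sets two would have to be bad with the same element.
      three : ∀ {R R₁ R₂} → Avoiding R → Avoiding R₁ → Avoiding R₂ →
              Adjacent R R₁ → Adjacent R R₂ → Adjacent R₁ R₂ → Connected M e f
      three {R} {R₁} {R₂} A A₁ A₂ adj₁ adj₂ adj₁₂ with good-or-bad R A | good-or-bad R₁ A₁ | good-or-bad R₂ A₂
      ... | inj₁ c | _ | _ = c
      ... | inj₂ _ | inj₁ c | _ = c
      ... | inj₂ _ | inj₂ _ | inj₁ c = c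
      ... | inj₂ b | inj₂ b₁ | inj₂ b₂ with two adj₁ A A₁ b b₁ | two adj₂ A A₂ b b₂
      ...   | inj₁ (_ , p₁) | inj₁ (_ , p₂) = contradiction (clash adj₁₂ (proj₂ (proj₂ A₁)) (proj₂ (proj₂ A₂)) p₁ p₂) λ ()
      ...   | inj₂ (_ , p₁) | inj₂ (_ , p₂) = contradiction (clash adj₁₂ (proj₁ (proj₂ A₁)) (proj₁ (proj₂ A₂)) p₁ p₂) λ ()
      ...   | inj₁ (p , p₁) | inj₂ (_ , p₂) = contradiction (clash adj₂ (proj₁ (proj₂ A)) (proj₁ (proj₂ A₂)) p p₂) λ ()
      ...   | inj₂ (_ , p₁) | inj₁ (p , p₂) = contradiction (clash adj₁ (proj₁ (proj₂ A)) (proj₁ (proj₂ A₁)) p p₁) λ ()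

      module _ (1≤r : 1 ≤ r) (r<n′ : r < n′) (R : Subset (suc (suc n′))) (R⊆ : R ⊆ others) (∣R∣ : ∣ R ∣ ≡ r) where

        avoiding : Avoiding R
        avoiding = ∣R∣ , (λ e∈ → ∈others⇒≢e (R⊆ e∈) refl) , (λ f∈ → ∈others⇒≢f (R⊆ f∈) refl)

        new : Subset (suc (suc n′))
        new = others ∩ ∁ R

        ∣new∣ : ∣ new ∣ ℕ.+ r ≡ n′
        ∣new∣ = trans (cong (∣ new ∣ ℕ.+_) (sym (trans (cong ∣_∣ others∩R) ∣R∣))) (trans (∣∩∣+∣∩∁∣ others R) ∣others∣)
          where
          others∩R : others ∩ R ≡ R
          others∩R = ⊆-antisym (p∩q⊆q others R) (λ z∈ → x∈p∩q⁺ (R⊆ z∈ , z∈))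

        new∉ : ∀ {b} → b ∈ new → b ∉ R
        new∉ b∈ = x∈∁p⇒x∉p (proj₂ (x∈p∩q⁻ others (∁ R) b∈))

        new-others : ∀ {b} → b ∈ new → b ∈ others
        new-others = p∩q⊆p others (∁ R)

        1≤new : 1 ≤ ∣ new ∣
        1≤new = ℕ.+-cancelʳ-≤ r 1 ∣ new ∣ (ℕ.≤-trans r<n′ (ℕ.≤-reflexive (sym ∣new∣)))

        -- A third set adjacent to both others is needed. It is found by varying the element taken
        -- out if `r` is at least 2, and by varying the one put in if `r` is 1, where `3 ≤ n′`
        -- leaves two elements to choose from.
        large : 3 ≤ n′ → Connected M e f
        large 3≤n′ with 2 ℕ.≤? r
        ... | yes 2≤r =
          let a , a∈ = member (ℕ.≤-trans 1≤r (ℕ.≤-reflexive (sym ∣R∣)))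
              a′ , a′∈ , a′≢a = another (ℕ.≤-trans 2≤r (ℕ.≤-reflexive (sym ∣R∣))) a
              b , b∈ = member 1≤new
              b∉ = new∉ b∈
          in three avoiding (avoiding-exchange avoiding a∈ b∉ (new-others b∈)) (avoiding-exchange avoiding a′∈ b∉ (new-others b∈))
               (adjacent-exchange a∈ b∉) (adjacent-exchange a′∈ b∉) (adjacent-old (a′≢a ∘ sym) a∈ a′∈ b∉)
        ... | no 2≰r =
          let a , a∈ = member (ℕ.≤-trans 1≤r (ℕ.≤-reflexive (sym ∣R∣)))
              b , b∈ = member 1≤new
              c , c∈ , c≢b = another 2≤new b
          in three avoiding (avoiding-exchange avoiding a∈ (new∉ b∈) (new-others b∈)) (avoiding-exchange avoiding a∈ (new∉ c∈) (new-others c∈))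
               (adjacent-exchange a∈ (new∉ b∈)) (adjacent-exchange a∈ (new∉ c∈)) (adjacent-new (c≢b ∘ sym) (new∉ b∈) (new∉ c∈))
          where
          2≤new : 2 ≤ ∣ new ∣
          2≤new = ℕ.+-cancelʳ-≤ r 2 ∣ new ∣ (ℕ.≤-trans (ℕ.+-monoʳ-≤ 2 (ℕ.s≤s⁻¹ (ℕ.≰⇒> 2≰r)))
            (ℕ.≤-trans 3≤n′ (ℕ.≤-reflexive (sym ∣new∣))))

        -- Two adjacent sets suffice: if both were bad, their extensions would be two different
        -- members of `F`.
        few : length F ≤ 1 → Connected M e f
        few ≤1 =
          let a , a∈ = member (ℕ.≤-trans 1≤r (ℕ.≤-reflexive (sym ∣R∣)))
              b , b∈ = member 1≤new
              A₁ = avoiding-exchange avoiding a∈ (new∉ b∈) (new-others b∈)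
              adj = adjacent-exchange a∈ (new∉ b∈)
          in decide A₁ adj (good-or-bad _ avoiding) (good-or-bad _ A₁)
          where
          same : ∀ {A B F} → length F ≤ 1 → A ∈ᴸ F → B ∈ᴸ F → A ≡ B
          same {F = _ ∷ []} _ (here refl) (here refl) = refl
          same {F = _ ∷ _ ∷ _} (s≤s ()) _ _
          decide : ∀ {R₁} → Avoiding R₁ → Adjacent R R₁ → Connected M e f ⊎ Bad R → Connected M e f ⊎ Bad R₁ → Connected M e f
          decide A₁ adj (inj₁ c) _ = c
          decide A₁ adj (inj₂ _) (inj₁ c) = c
          decide A₁ adj (inj₂ b) (inj₂ b₁) with two adj avoiding A₁ b b₁
          ... | inj₁ (p , q) = contradiction (same ≤1 p q) (adjacent-≢ adj (proj₂ (proj₂ avoiding)))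
          ... | inj₂ (p , q) = contradiction (same ≤1 p q) (adjacent-≢ adj (proj₁ (proj₂ avoiding)))

    -- When `1 ≤ r` and `r < n′`, the last condition leaves out only `n′ = 2` with at least two
    -- non-bases, the case of U₁,₂ ⊕ U₁,₂.
    connected : r ≤ n′ → F ≡ [] ⊎ (1 ≤ r × r < n′ × (3 ≤ n′ ⊎ length F ≤ 1)) → ∀ e f → Connected M e f
    connected r≤n′ cases e f with e Fin.≟ f
    ... | yes e≡f = inj₁ e≡f
    ... | no e≢f =
      let R , R⊆ , ∣R∣ = pick (others e≢f) r (ℕ.≤-trans r≤n′ (ℕ.≤-reflexive (sym (∣others∣ e≢f)))) in go R R⊆ ∣R∣ cases
      where
      go : ∀ R → R ⊆ others e≢f → ∣ R ∣ ≡ r → F ≡ [] ⊎ (1 ≤ r × r < n′ × (3 ≤ n′ ⊎ length F ≤ 1)) → Connected M e f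
      go R R⊆ ∣R∣ (inj₁ F≡[]) = link e≢f ∣R∣ (λ e∈ → ∈others⇒≢e e≢f (R⊆ e∈) refl) (λ f∈ → ∈others⇒≢f e≢f (R⊆ f∈) refl) none none
        where
        none : ∀ {B} → B ∉ᴸ F
        none B∈ with subst (_ ∈ᴸ_) F≡[] B∈
        ... | ()
      go R R⊆ ∣R∣ (inj₂ (1≤r , r<n′ , inj₁ 3≤n′)) = large e≢f 1≤r r<n′ R R⊆ ∣R∣ 3≤n′
      go R R⊆ ∣R∣ (inj₂ (1≤r , r<n′ , inj₂ ≤1))   = few e≢f 1≤r r<n′ R R⊆ ∣R∣ ≤1

    colouring : r ≤ n′ → F ≡ [] ⊎ (1 ≤ r × r < n′ × (3 ≤ n′ ⊎ length F ≤ 1)) → Colouring M 1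
    colouring r≤n′ cases = connected⇒colouring M (connected r≤n′ cases)

open SparseConnectivity

-- Bounding the number of circuit-hyperplanes by words

module HyperplaneCounts where

  private variable
    m n k l : ℕ

  Disjoint : Subset n → Subset n → Set
  Disjoint A B = ∀ {x} → x ∈ A → x ∉ B

  ∣∪∣-disjoint : ∀ {A B : Subset n} → Disjoint A B → ∣ A ∪ B ∣ ≡ ∣ A ∣ ℕ.+ ∣ B ∣
  ∣∪∣-disjoint {A = []}        {[]}        disj = refl
  ∣∪∣-disjoint {A = true  ∷ A} {true  ∷ B} disj = contradiction here (disj here)
  ∣∪∣-disjoint {A = true  ∷ A} {false ∷ B} disj = cong suc (∣∪∣-disjoint λ x∈ → disj (there x∈) ∘ there)
  ∣∪∣-disjoint {A = false ∷ A} {true  ∷ B} disj = trans (cong suc (∣∪∣-disjoint λ x∈ → disj (there x∈) ∘ there)) (sym (ℕ.+-suc ∣ A ∣ ∣ B ∣))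
  ∣∪∣-disjoint {A = false ∷ A} {false ∷ B} disj = ∣∪∣-disjoint λ x∈ → disj (there x∈) ∘ there

  disjoint-⋃ : ∀ {A : Subset n} {F} → All (Disjoint A) F → Disjoint A (⋃ F)
  disjoint-⋃ [] x∈ x∈⊥ = ∉⊥ x∈⊥
  disjoint-⋃ {F = B ∷ F} (disj ∷ all) x∈ x∈⋃ = [ disj x∈ , disjoint-⋃ all x∈ ]′ (x∈p∪q⁻ B (⋃ F) x∈⋃)

  packing : ∀ {F : List (Subset n)} {j} → AllPairs Disjoint F → All (λ A → ∣ A ∣ ≡ j) F → length F ℕ.* j ≤ n
  packing {F = F} disj sizes = ℕ.≤-trans (ℕ.≤-reflexive (sym (size-⋃ disj sizes))) (∣p∣≤n (⋃ F))
    where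
    size-⋃ : ∀ {n} {F : List (Subset n)} {j} → AllPairs Disjoint F → All (λ A → ∣ A ∣ ≡ j) F → ∣ ⋃ F ∣ ≡ length F ℕ.* j
    size-⋃ {n} [] [] = ∣⊥∣≡0 n
    size-⋃ (disj ∷ pairs) (size ∷ sizes) = trans (∣∪∣-disjoint (disjoint-⋃ disj)) (cong₂ ℕ._+_ size (size-⋃ pairs sizes))

  all-pairs : ∀ {A : Set} {P : A → Set} {R : A → A → Set} → (∀ {x y} → P x → P y → x ≢ y → R x y) →
              ∀ {xs} → All P xs → Unique xs → AllPairs R xs
  all-pairs f [] [] = []
  all-pairs f (px ∷ all) (x∉ ∷ unique) = All.zipWith (λ (py , x≢y) → f px py x≢y) (all , x∉) ∷ all-pairs f all unique

  ∩-< : ∀ {A B : Subset n} {x} → x ∈ A → x ∉ B → ∣ A ∩ B ∣ < ∣ A ∣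
  ∩-< {A = A} {B} x∈ x∉ = p⊂q⇒∣p∣<∣q∣ (p∩q⊆p A B , _ , x∈ , λ x∈∩ → x∉ (p∩q⊆q A B x∈∩))

  ∩-<ʳ : ∀ {A B : Subset n} {x} → x ∉ A → x ∈ B → ∣ A ∩ B ∣ < ∣ B ∣
  ∩-<ʳ {A = A} {B} x∉ x∈ = p⊂q⇒∣p∣<∣q∣ (p∩q⊆q A B , _ , x∈ , λ x∈∩ → x∉ (p∩q⊆p A B x∈∩))

  -- Two different pairs with a common element would be one exchange apart, so the pairs are
  -- disjoint.
  pairs-bound : ∀ {P : Subset n → Set} {F} → Sparse P → (∀ {B} → P B → ∣ B ∣ ≡ 2) → All P F → Unique F → length F ℕ.* 2 ≤ n
  pairs-bound sparse size all unique = packing (all-pairs disjoint all unique) (All.map size all)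
    where
    disjoint : ∀ {A B} → _ → _ → A ≢ B → Disjoint A B
    disjoint {A} {B} pA pB A≢B x∈A x∈B = A≢B (sparse-≡ sparse pB pA (trans (size pA) (sym (size pB)))
      (ℕ.s≤s⁻¹ (ℕ.<-≤-trans (∩-< x∈A (x∈p⇒x∉∁p x∈B)) (ℕ.≤-reflexive (size pA)))))

  copairs-bound : ∀ {P : Subset n → Set} {F} → Sparse P → (∀ {B} → P B → ∣ ∁ B ∣ ≡ 2) → (∀ {A B} → P A → P B → ∣ A ∣ ≡ ∣ B ∣) →
                  All P F → Unique F → length F ℕ.* 2 ≤ n
  copairs-bound {n} {P} {F} sparse cosize size all unique = subst (λ j → j ℕ.* 2 ≤ n) (List.length-map ∁ F)
    (packing (AllPairs.map⁺ (all-pairs disjoint all unique)) (All.map⁺ (All.map cosize all)))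
    where
    disjoint : ∀ {A B} → P A → P B → A ≢ B → Disjoint (∁ A) (∁ B)
    disjoint {A} {B} pA pB A≢B x∈A x∈B = A≢B (sparse-≡ sparse pB pA (size pA pB)
      (ℕ.s≤s⁻¹ (ℕ.<-≤-trans (∩-<ʳ (x∈∁p⇒x∉p x∈A) x∈B) (ℕ.≤-reflexive (cosize pB)))))

  enumerate : ∀ n {P : Subset n → Set} → (∀ B → Dec (P B)) → List (Subset n)
  enumerate zero P? with P? []
  ... | yes _ = [] ∷ []
  ... | no _  = []
  enumerate (suc n) P? = map (outside ∷_) (enumerate n (P? ∘ (outside ∷_))) ++ map (inside ∷_) (enumerate n (P? ∘ (inside ∷_)))

  ∈-enumerate⁺ : ∀ n {P : Subset n → Set} (P? : ∀ B → Dec (P B)) {B} → P B → B ∈ᴸ enumerate n P?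
  ∈-enumerate⁺ zero P? {[]} p with P? []
  ... | yes _ = here refl
  ... | no ¬p = contradiction p ¬p
  ∈-enumerate⁺ (suc n) P? {false ∷ B} p = List∈.∈-++⁺ˡ (List∈.∈-map⁺ (outside ∷_) (∈-enumerate⁺ n (P? ∘ (outside ∷_)) p))
  ∈-enumerate⁺ (suc n) P? {true ∷ B}  p = List∈.∈-++⁺ʳ _ (List∈.∈-map⁺ (inside ∷_) (∈-enumerate⁺ n (P? ∘ (inside ∷_)) p))

  ∈-enumerate⁻ : ∀ n {P : Subset n → Set} (P? : ∀ B → Dec (P B)) {B} → B ∈ᴸ enumerate n P? → P B
  ∈-enumerate⁻ zero P? {[]} B∈ with P? []
  ... | yes p = p
  ∈-enumerate⁻ (suc n) {P} P? B∈ = [ from outside , from inside ]′ (List∈.∈-++⁻ (map (outside ∷_) (enumerate n (P? ∘ (outside ∷_)))) B∈)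
    where
    from : ∀ s {B} → B ∈ᴸ map (s ∷_) (enumerate n (P? ∘ (s ∷_))) → P B
    from s B∈ with List∈.∈-map⁻ (s ∷_) B∈
    ... | _ , A∈ , refl = ∈-enumerate⁻ n (P? ∘ (s ∷_)) A∈

  enumerate-unique : ∀ n {P : Subset n → Set} (P? : ∀ B → Dec (P B)) → Unique (enumerate n P?)
  enumerate-unique zero P? with P? []
  ... | yes _ = [] ∷ []
  ... | no _  = []
  enumerate-unique (suc n) P? = Unique.++⁺
    (Unique.map⁺ Vec.∷-injectiveʳ (enumerate-unique n (P? ∘ (outside ∷_))))
    (Unique.map⁺ Vec.∷-injectiveʳ (enumerate-unique n (P? ∘ (inside ∷_))))
    λ (B∈ , B∈′) → different (List∈.∈-map⁻ (outside ∷_) B∈) (List∈.∈-map⁻ (inside ∷_) B∈′)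
    where
    different : ∀ {B : Subset (suc n)} {xs ys} → (∃ λ A → A ∈ᴸ xs × B ≡ outside ∷ A) → (∃ λ A → A ∈ᴸ ys × B ≡ inside ∷ A) → Void
    different (_ , _ , refl) (_ , _ , ())

  enumerate-all : ∀ n {P : Subset n → Set} (P? : ∀ B → Dec (P B)) → All P (enumerate n P?)
  enumerate-all n P? = All.tabulate (∈-enumerate⁻ n P?)

  δ-≡ : ∀ d → δ d d ≡ 1
  δ-≡ d = cong (λ b → if b then 1 else 0) (dec-true (d ℕ.≟ d) refl)

  δ-≢ : ∀ {i d} → i ≢ d → δ i d ≡ 0
  δ-≢ {i} {d} i≢d = cong (λ b → if b then 1 else 0) (dec-false (i ℕ.≟ d) i≢d)

  words-0 : ∀ d n i → words d 0 n i ≡ δ i d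
  words-0 d zero    i = refl
  words-0 d (suc n) i = words-0 d n i

  words-diagonal : ∀ d n i → words d n n i ≡ δ i d
  words-diagonal d zero i = refl
  words-diagonal d (suc zero) i = refl
  words-diagonal d (suc (suc n)) i = trans
    (cong₂ ℕ._+_ (cong₂ ℕ._+_ (words-zero {d} {suc (suc n)} {suc n} {i} (ℕ.n<1+n _)) (words-diagonal d (suc n) i))
                 (words-zero {suc d} {suc n} {n} {i} (ℕ.n<1+n _)))
    (ℕ.+-identityʳ (δ i d))

  -- Without cuts a single `ser` stands in one of `n` places among the `par`. In `words-1-cut` a
  -- single `cut` takes the place of two letters.
  words-1 : ∀ d n → words d 1 n d ≡ n
  words-1 d zero = refl
  words-1 d (suc zero) = δ-≡ d
  words-1 d (suc (suc n))
    rewrite words-1 d (suc n) | words-0 d n d | words-0 (suc d) n d | δ-≡ d | δ-≢ {d} {suc d} (ℕ.1+n≢n ∘ sym)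
          = trans (ℕ.+-identityʳ _) (ℕ.+-comm (suc n) 1)

  words-1-cut : ∀ d n → words d 1 (suc n) (suc d) ≡ n
  words-1-cut d zero = δ-≢ {suc d} {d} ℕ.1+n≢n
  words-1-cut d (suc n)
    rewrite words-1-cut d n | words-0 d n (suc d) | words-0 (suc d) n (suc d) | δ-≡ (suc d) | δ-≢ {suc d} {d} ℕ.1+n≢n
          = trans (cong (ℕ._+ 1) (ℕ.+-identityʳ n)) (ℕ.+-comm n 1)

  -- The dual count: without cuts a single `par` stands among `n` letters `ser`; with one `cut` the
  -- others are `n - 1` letters `ser`.
  words-top : ∀ d n → words d n (suc n) d ≡ suc n
  words-top d zero = δ-≡ d
  words-top d (suc n)
    rewrite words-diagonal d (suc n) d | words-top d n | words-diagonal (suc d) n d | δ-≡ d | δ-≢ {d} {suc d} (ℕ.1+n≢n ∘ sym)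
          = ℕ.+-identityʳ _

  words-top-cut : ∀ d n → words d n (suc n) (suc d) ≡ n
  words-top-cut d zero = δ-≢ {suc d} {d} ℕ.1+n≢n
  words-top-cut d (suc n)
    rewrite words-diagonal d (suc n) (suc d) | words-top-cut d n | words-diagonal (suc d) n (suc d) | δ-≡ (suc d) | δ-≢ {suc d} {d} ℕ.1+n≢n
          = ℕ.+-comm n 1

  half-bound : ∀ {λ′ n} → 2 ≤ n → λ′ ℕ.* 2 ≤ suc (suc n) → λ′ ≤ n
  half-bound {λ′} {n} 2≤n ≤ with λ′ ℕ.≤? n
  ... | yes λ≤n = λ≤n
  ... | no λ≰n  = contradiction (ℕ.≤-trans (ℕ.*-monoˡ-≤ 2 (ℕ.≰⇒> λ≰n)) ≤)
    (ℕ.<⇒≱ (s≤s (s≤s (ℕ.<-≤-trans (ℕ.m<m*n n 2 {{ℕ.>-nonZero (ℕ.<⇒≤ 2≤n)}} (s≤s (s≤s z≤n))) ℕ.≤-refl))))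

  half-bound′ : ∀ {λ′ n} → 2 ≤ n → λ′ ℕ.* 2 ≤ suc (suc (suc n)) → λ′ ≤ n
  half-bound′ {λ′} {n} 2≤n ≤ with λ′ ℕ.≤? n
  ... | yes λ≤n = λ≤n
  ... | no λ≰n  = contradiction (ℕ.≤-trans (ℕ.*-monoˡ-≤ 2 (ℕ.≰⇒> λ≰n)) ≤)
    (ℕ.<⇒≱ (s≤s (s≤s (ℕ.≤-trans (ℕ.+-monoˡ-≤ n 2≤n) (ℕ.≤-reflexive (double n))))))
    where
    double : ∀ n → n ℕ.+ n ≡ n ℕ.* 2
    double n = trans (cong (n ℕ.+_) (sym (ℕ.+-identityʳ n))) (ℕ.*-comm 2 n)

  words-≥ : ∀ d m n i → words d (suc m) (suc n) i ℕ.+ words d m (suc n) i ≤ words d (suc m) (suc (suc n)) i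
  words-≥ d m n i = ℕ.m≤m+n _ (words (suc d) m n i)

  -- Deleting and contracting the element 0 follows the recursion of words; the
  -- remaining cases are packings by pairs or, dually, by complements of pairs.
  hyperplanes-bound : ∀ n r {P : Subset (suc (suc n)) → Set} (P? : ∀ B → Dec (P B)) → Sparse P → (∀ {B} → P B → ∣ B ∣ ≡ suc r) →
    1 ≤ r → r < n → ∀ d i → i ≡ d ⊎ (i ≡ suc d × (3 ≤ n ⊎ length (enumerate _ P?) ≤ 1)) →
    length (enumerate _ P?) ≤ words d r n i
  hyperplanes-bound n (suc zero) P? sparse size 1≤r r<n d i (inj₁ refl) =
    ℕ.≤-trans (half-bound r<n (pairs-bound sparse size (enumerate-all _ P?) (enumerate-unique _ P?))) (ℕ.≤-reflexive (sym (words-1 d n)))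
  -- On four elements there is one word with a cut but there may be two disjoint pairs. The side
  -- condition removes this case.
  hyperplanes-bound (suc n) (suc zero) P? sparse size 1≤r (s≤s 1≤n) d i (inj₂ (refl , h)) = ℕ.≤-trans (bound h) (ℕ.≤-reflexive (sym (words-1-cut d n)))
    where
    bound : _ ⊎ _ → _
    bound (inj₁ (s≤s 2≤n)) = half-bound′ 2≤n (pairs-bound sparse size (enumerate-all _ P?) (enumerate-unique _ P?))
    bound (inj₂ ≤1) = ℕ.≤-trans ≤1 1≤n
  hyperplanes-bound (suc n) (suc (suc r)) P? sparse size 1≤r (s≤s r<n) d i c with ℕ.m≤n⇒m<n∨m≡n r<n
  hyperplanes-bound (suc (suc n)) (suc (suc r)) {P} P? sparse size 1≤r (s≤s r<n) d i c | inj₁ (s≤s r<n′) = begin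
    length (enumerate _ P?)
      ≡⟨ List.length-++ (map (outside ∷_) (enumerate _ (P? ∘ (outside ∷_)))) ⟩
    length (map (outside ∷_) (enumerate _ (P? ∘ (outside ∷_)))) ℕ.+ length (map (inside ∷_) (enumerate _ (P? ∘ (inside ∷_))))
      ≡⟨ cong₂ ℕ._+_ (List.length-map (outside ∷_) (enumerate _ (P? ∘ (outside ∷_)))) (List.length-map (inside ∷_) (enumerate _ (P? ∘ (inside ∷_)))) ⟩
    length (enumerate _ (P? ∘ (outside ∷_))) ℕ.+ length (enumerate _ (P? ∘ (inside ∷_)))
      ≤⟨ ℕ.+-mono-≤
        (hyperplanes-bound (suc n) (suc (suc r)) (P? ∘ (outside ∷_)) (section outside) size 1≤r (s≤s r<n′) d i (smaller c))
        (hyperplanes-bound (suc n) (suc r) (P? ∘ (inside ∷_)) (section inside) (ℕ.suc-injective ∘ size) (s≤s z≤n) (ℕ.m≤n⇒m≤1+n r<n′) d i (smaller c)) ⟩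
    words d (suc (suc r)) (suc n) i ℕ.+ words d (suc r) (suc n) i
      ≤⟨ words-≥ d (suc r) n i ⟩
    words d (suc (suc r)) (suc (suc n)) i ∎
    where
    open ℕ.≤-Reasoning
    section : ∀ s → Sparse (P ∘ (s ∷_))
    section s {R} x∉ y∉ p q = Fin.suc-injective (sparse {s ∷ R} (λ { (there x∈) → x∉ x∈ }) (λ { (there y∈) → y∉ y∈ }) p q)
    -- In this branch the rank is at least 3 and the corank exceeds 2, so the smaller ground sets
    -- satisfy the bound `3 ≤ suc n` of themselves.
    smaller : ∀ {X : Set} {L} → i ≡ d ⊎ (i ≡ suc d × X) → i ≡ d ⊎ (i ≡ suc d × (3 ≤ suc n ⊎ L ≤ 1))
    smaller (inj₁ eq)       = inj₁ eq
    smaller (inj₂ (eq , _)) = inj₂ (eq , inj₁ (s≤s (ℕ.≤-trans (s≤s (s≤s z≤n)) r<n′)))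
  hyperplanes-bound (suc n) (suc (suc r)) P? sparse size 1≤r (s≤s r<n) d i c | inj₂ refl = top i c
    where
    two : length (enumerate _ P?) ℕ.* 2 ≤ suc (suc (suc (suc (suc r))))
    two = copairs-bound sparse (λ {B} p → trans (∣∁p∣≡n∸∣p∣ B) (trans (cong (suc (suc (suc (suc (suc r)))) ℕ.∸_) (size p)) (ℕ.m+n∸n≡m 2 r)))
            (λ p q → trans (size p) (sym (size q))) (enumerate-all _ P?) (enumerate-unique _ P?)
    top : ∀ {X : Set} i → i ≡ d ⊎ (i ≡ suc d × X) → length (enumerate _ P?) ≤ words d (suc (suc r)) (suc (suc (suc r))) i
    top i (inj₁ refl) = ℕ.≤-trans (half-bound (s≤s (s≤s z≤n)) two) (ℕ.≤-reflexive (sym (words-top d (suc (suc r)))))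
    top i (inj₂ (refl , _)) = ℕ.≤-trans (half-bound′ (s≤s (s≤s z≤n)) two) (ℕ.≤-reflexive (sym (words-top-cut d (suc (suc r)))))

open HyperplaneCounts

-- The non-bases of a sparse paving matroid

module NonBases where

  private variable
    m n k l : ℕ

  -- Each exchange keeps the size of `B₁` and enlarges its overlap with `B₂`. Were `B₁` larger, this
  -- could be repeated until the overlap exceeded `B₂`; `fuel` bounds the number of steps left.
  bases-size : ∀ (M : Matroid n) {B₁ B₂} → Basis M B₁ → Basis M B₂ → ∣ B₁ ∣ ≡ ∣ B₂ ∣
  bases-size M {B₁} {B₂} b₁ b₂ = ℕ.≤-antisym (ℕ.≮⇒≥ (not-larger b₁ b₂ ∣ B₂ ∣ (ℕ.m≤m+n _ _)))
                                             (ℕ.≮⇒≥ (not-larger b₂ b₁ ∣ B₁ ∣ (ℕ.m≤m+n _ _)))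
    where
    not-larger : ∀ {B₁ B₂} → Basis M B₁ → Basis M B₂ → ∀ fuel → ∣ B₂ ∣ ≤ fuel ℕ.+ ∣ B₁ ∩ B₂ ∣ → ¬ ∣ B₂ ∣ < ∣ B₁ ∣
    not-larger {B₁} {B₂} b₁ b₂ fuel ≤fuel lt =
      let x , x∈ , x∉ = larger B₁ B₂ lt
          y , y∈ , y∉ , b = basis-exchange M b₁ b₂ x∈ x∉
      in step fuel ≤fuel x∈ x∉ y∈ y∉ (subst (Basis M) (exchange≡ B₁ x y) b)
      where
      grown : ∀ {x y} → x ∉ B₂ → y ∈ B₂ → y ∉ B₁ → ∣ (B₁ -′ x +′ y) ∩ B₂ ∣ ≡ suc ∣ B₁ ∩ B₂ ∣
      grown {x} {y} x∉ y∈ y∉ = begin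
        ∣ (B₁ -′ x +′ y) ∩ B₂ ∣        ≡⟨ cong ∣_∣ (+′-∩-∈ (B₁ -′ x) B₂ y y∈) ⟩
        ∣ ((B₁ -′ x) ∩ B₂) +′ y ∣      ≡⟨ cong (λ A → ∣ A +′ y ∣) (trans (-′-∩ B₁ B₂ x) (-′-absorb (x∉ ∘ p∩q⊆q B₁ B₂))) ⟩
        ∣ (B₁ ∩ B₂) +′ y ∣             ≡⟨ ∣+′∣ (y∉ ∘ p∩q⊆p B₁ B₂) ⟩
        suc ∣ B₁ ∩ B₂ ∣                ∎
        where open ≡-Reasoning
      step : ∀ fuel → ∣ B₂ ∣ ≤ fuel ℕ.+ ∣ B₁ ∩ B₂ ∣ → ∀ {x y} → x ∈ B₁ → x ∉ B₂ → y ∈ B₂ → y ∉ B₁ → Basis M (B₁ -′ x +′ y) → Void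
      step zero ≤fuel {x} {y} x∈ x∉ y∈ y∉ b = ℕ.<⇒≱ (ℕ.≤-reflexive (sym (grown x∉ y∈ y∉)))
        (ℕ.≤-trans (∣p∩q∣≤∣q∣ (B₁ -′ x +′ y) B₂) ≤fuel)
      step (suc fuel) ≤fuel x∈ x∉ y∈ y∉ b = not-larger b b₂ fuel
        (ℕ.≤-trans ≤fuel (ℕ.≤-reflexive (trans (sym (ℕ.+-suc fuel _)) (cong (fuel ℕ.+_) (sym (grown x∉ y∈ y∉))))))
        (ℕ.<-≤-trans lt (ℕ.≤-reflexive (sym (∣-′+′∣ x∈ y∉))))

  module _ (M : Matroid n) where

    NonBasis : Subset n → Set
    NonBasis B = ∣ B ∣ ≡ rank M × ¬ Basis M B

    nonBasis? : ∀ B → Dec (NonBasis B)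
    nonBasis? B = (∣ B ∣ ℕ.≟ rank M) ×-dec ¬? (basis? M B)

    basis-rank : ∀ {B} → Basis M B → ∣ B ∣ ≡ rank M
    basis-rank b = bases-size M b (proj₂ (someBasis M))

    -- Paving makes `R` independent, so `R +′ z` is a basis for some `z`, distinct from `x` and `y`.
    -- Paving of the dual makes `R +′ x +′ y` contain a basis. Exchanging `z` against it must bring
    -- in `x` or `y`, which turns one of the two non-bases into a basis.
    nonBasis-sparse : SparsePaving M → Sparse NonBasis
    nonBasis-sparse (paving , dual-paving) {R} {x} {y} x∉ y∉ (size , ¬bx) (_ , ¬by) with x Fin.≟ y
    ... | yes x≡y = x≡y
    ... | no x≢y =
      let B , b , R⊆B = decidable-stable (independent? M R) λ dep →
            ℕ.<⇒≱ (ℕ.≤-reflexive (trans (sym (∣+′∣ x∉)) size)) (paving R dep)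
          C , b′ , ∁S⊆C = decidable-stable (independent? (dual M) (∁ S)) λ dep →
            ℕ.<⇒≱ small (dual-paving (∁ S) dep)
          z , z∈ , z∉ = larger B R (ℕ.≤-reflexive (trans (sym (∣+′∣ x∉)) (trans size (sym (basis-rank b)))))
          B≡ = ⊆-size (grow z∈ R⊆B) (trans (∣+′∣ z∉) (trans (sym (∣+′∣ x∉)) (trans size (sym (basis-rank b)))))
          z≢x = λ z≡x → ¬bx (subst (Basis M) (trans (sym B≡) (cong (R +′_) z≡x)) b)
          z≢y = λ z≡y → ¬by (subst (Basis M) (trans (sym B≡) (cong (R +′_) z≡y)) b)
          ⊆S = λ {w} (w∈ : w ∈ ∁ C) → x∉∁p⇒x∈p λ w∈∁S → x∈∁p⇒x∉p w∈ (∁S⊆C w∈∁S)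
          w , w∈ , w∉ , b″ = basis-exchange M b b′ z∈ (λ z∈′ → cases (⊆S z∈′) z≢y z≢x z∉)
          final = subst (Basis M) (trans (exchange≡ B z w) (cong (_+′ w) (trans (cong (_-′ z) (sym B≡))
                    (trans (Vec.[]≔-idempotent R z) (-′-absorb z∉))))) b″
          w≢y = λ w≡y → ¬by (subst (λ w → Basis M (R +′ w)) w≡y final)
          w≢x = λ w≡x → ¬bx (subst (λ w → Basis M (R +′ w)) w≡x final)
      in contradiction (cases (⊆S w∈) w≢y w≢x (w∉ ∘ R⊆B)) λ ()
      where
      S : Subset n
      S = R +′ x +′ y
      ∣S∣ : ∣ S ∣ ≡ suc (rank M)
      ∣S∣ = trans (∣+′∣ (∉+′ (x≢y ∘ sym) y∉)) (cong suc size)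
      small : ∣ ∁ S ∣ < rank (dual M)
      small = ℕ.≤-trans (ℕ.≤-reflexive (cong suc (trans (∣∁p∣≡n∸∣p∣ S) (cong (n ℕ.∸_) ∣S∣))))
        (ℕ.≤-trans (ℕ.≤-reflexive (sym (ℕ.+-∸-assoc 1 (ℕ.≤-trans (ℕ.≤-reflexive (sym ∣S∣)) (∣p∣≤n S)))))
                   (ℕ.≤-reflexive (sym (∣∁p∣≡n∸∣p∣ (proj₁ (someBasis M))))))
      cases : ∀ {w} → w ∈ S → w ≢ y → w ≢ x → w ∉ R → Void
      cases w∈ w≢y w≢x w∉ = ∉+′ w≢y (∉+′ w≢x w∉) w∈
      grow : ∀ {B z} → z ∈ B → R ⊆ B → R +′ z ⊆ B
      grow {B} {z} z∈ R⊆B {w} w∈ with w Fin.≟ z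
      ... | yes refl = z∈
      ... | no w≢z   = R⊆B (decidable-stable (w ∈? R) λ w∉ → ∉+′ w≢z w∉ w∈)

  module _ {n′ i} {γ : Matroid (suc (suc n′)) → ℤ} (C : SpeyerCoefficient i γ) (M : Matroid (suc (suc n′))) (paving : SparsePaving M)
           {r} (rank≡ : rank M ≡ suc r) (r≤n′ : r ≤ n′) where
    open SpeyerCoefficient C

    private
      F : List (Subset (suc (suc n′)))
      F = enumerate _ (nonBasis? M)

      nonBasis : All (NonBasis M) F
      nonBasis = enumerate-all _ (nonBasis? M)

      unique : Unique F
      unique = enumerate-unique _ (nonBasis? M)

      member-size : ∀ {B} → NonBasis M B → ∣ B ∣ ≡ suc r
      member-size (size , _) = trans size rank≡

      sparse : Sparse (_∈ᴸ F)
      sparse x∉ y∉ p q = nonBasis-sparse M paving x∉ y∉ (∈-enumerate⁻ _ (nonBasis? M) p) (∈-enumerate⁻ _ (nonBasis? M) q)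

      to : ∀ {B} → Basis M B → NonMember (suc r) F B
      to b = trans (basis-rank M b) rank≡ , λ B∈ → proj₂ (∈-enumerate⁻ _ (nonBasis? M) B∈) b

      from : ∀ {B} → NonMember (suc r) F B → Basis M B
      from {B} (size , ∉) = decidable-stable (basis? M B) λ ¬b → ∉ (∈-enumerate⁺ _ (nonBasis? M) (trans size (sym rank≡) , ¬b))

      nonempty : ∃ (NonMember (suc r) F)
      nonempty = let B , b = someBasis M in B , to b

      N : Matroid (suc (suc n′))
      N = sparseMatroid (suc r) F sparse nonempty

      γ≡ : γ M ≡ γ N
      γ≡ = ≅-cong (≐⇒≅ {M = M} {N} (to , from))

    γ-connected : F ≡ [] ⊎ (1 ≤ r × r < n′ × (3 ≤ n′ ⊎ length F ≤ 1)) → 0ℤ ℤ.≤ γ M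
    γ-connected cases = subst (0ℤ ℤ.≤_) (sym γ-value) (ℤ.i≤j⇒0≤j-i (ℤ.+≤+ (bound cases)))
      where
      sizes : F ≡ [] ⊎ (1 ≤ r × r < n′ × (3 ≤ n′ ⊎ length F ≤ 1)) → All (λ H → ∣ H ∣ ≡ suc r × 2 ≤ ∣ H ∣ × 2 ≤ ∣ ∁ H ∣) F
      sizes (inj₁ F≡[]) = subst (All _) (sym F≡[]) []
      sizes (inj₂ (1≤r , r<n′ , _)) = All.map (λ {H} p →
        member-size p , ℕ.≤-trans (s≤s 1≤r) (ℕ.≤-reflexive (sym (member-size p))) ,
        ℕ.≤-trans (ℕ.m+n≤o⇒m≤o∸n 2 (s≤s (s≤s r<n′)))
          (ℕ.≤-reflexive (sym (trans (∣∁p∣≡n∸∣p∣ H) (cong (suc (suc n′) ℕ.∸_) (member-size p)))))) nonBasis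
      γ-value : γ M ≡ + words 1 r n′ i ℤ.- + (length F ℕ.* (δ i 1 ℕ.+ δ i 2))
      γ-value = begin
        γ M                      ≡⟨ γ≡ ⟩
        γ N                      ≡⟨ ℤ.neg-involutive (γ N) ⟨
        ℤ.- (ℤ.- γ N)            ≡⟨ cong ℤ.-_ (trans (sym (ℤ.-1*i≡-i (γ N))) (sym (trans (v≡ N) (cong (λ c → sign c ℤ.* γ N)
                                      (components≡ N (Connectivity.colouring F sparse nonempty r≤n′ cases)))))) ⟩
        ℤ.- v N                  ≡⟨ cong ℤ.-_ (v-sparse C refl r≤n′ F sparse nonempty unique (sizes cases)) ⟩
        ℤ.- (+ (length F ℕ.* (δ i 1 ℕ.+ δ i 2)) ℤ.- + words 1 r n′ i)
                                 ≡⟨ ℤS.solve 2 (λ l w → ℤS.:- (l ℤS.:- w) ℤS.:= w ℤS.:- l) refl (+ (length F ℕ.* (δ i 1 ℕ.+ δ i 2))) (+ words 1 r n′ i) ⟩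
        + words 1 r n′ i ℤ.- + (length F ℕ.* (δ i 1 ℕ.+ δ i 2)) ∎
        where open ≡-Reasoning
      nonBasis-sparse′ : Sparse (NonBasis M)
      nonBasis-sparse′ = nonBasis-sparse M paving
      bound : F ≡ [] ⊎ (1 ≤ r × r < n′ × (3 ≤ n′ ⊎ length F ≤ 1)) → length F ℕ.* (δ i 1 ℕ.+ δ i 2) ≤ words 1 r n′ i
      bound (inj₁ F≡[]) = ℕ.≤-trans (ℕ.≤-reflexive (cong (λ F → length F ℕ.* (δ i 1 ℕ.+ δ i 2)) F≡[])) z≤n
      -- The subtracted term lives in degrees 1 and 2, matched by words without cuts and with one
      -- cut; in all other degrees it is zero.
      bound (inj₂ (1≤r , r<n′ , large)) with i ℕ.≟ 1 | i ℕ.≟ 2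
      ... | yes refl | _ = ℕ.≤-trans (ℕ.≤-reflexive (ℕ.*-identityʳ (length F)))
        (hyperplanes-bound n′ r (nonBasis? M) nonBasis-sparse′ member-size 1≤r r<n′ 1 1 (inj₁ refl))
      ... | no _ | yes refl = ℕ.≤-trans (ℕ.≤-reflexive (ℕ.*-identityʳ (length F)))
        (hyperplanes-bound n′ r (nonBasis? M) nonBasis-sparse′ member-size 1≤r r<n′ 1 2 (inj₂ (refl , large)))
      ... | no i≢1 | no i≢2 = ℕ.≤-trans (ℕ.≤-reflexive (trans (cong (length F ℕ.*_) (cong₂ ℕ._+_ (δ-≢ i≢1) (δ-≢ i≢2))) (ℕ.*-zeroʳ (length F)))) z≤n

open NonBases

-- Degenerate cases and non-negativity of all coefficients

private variable
  m n k l : ℕ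

loop-or-coloop : ∀ {i} {γ : Matroid n → ℤ} → SpeyerCoefficient i γ → ∀ {M} → ∃ (Loop M) ⊎ ∃ (Coloop M) → 0ℤ ℤ.≤ γ M
loop-or-coloop C h = ℤ.≤-reflexive (sym (SpeyerCoefficient.degenerate C h))

rank-zero : ∀ (M : Matroid (suc n)) → rank M ≡ 0 → Loop M zero
rank-zero M eq B b 0∈ = ℕ.<⇒≱ (∩-< {B = ⊥} 0∈ ∉⊥) (ℕ.≤-trans (ℕ.≤-reflexive (trans (basis-rank M b) eq)) z≤n)

rank-full : ∀ (M : Matroid (suc n)) → rank M ≡ suc n → Coloop M zero
rank-full M eq B b = subst (zero ∈_) (sym (∣p∣≡n⇒p≡⊤ (trans (basis-rank M b) eq))) here

module _ {n′ i} {γ : Matroid (suc (suc n′)) → ℤ} (C : SpeyerCoefficient i γ) (M : Matroid (suc (suc n′))) where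
  open SpeyerCoefficient C

  singleton-loop : ∀ {H} → NonBasis M H → ∣ H ∣ ≡ 1 → ∃ (Loop M)
  singleton-loop {H} (size , ¬b) one with member {A = H} (ℕ.≤-reflexive (sym one))
  ... | e , e∈ = e , λ B b e∈B → ¬b (subst (Basis M) (sym (⊆-size
    (λ {z} z∈ → subst (_∈ B) (one-element (ℕ.≤-reflexive one) e∈ z∈) e∈B) (trans size (sym (basis-rank M b))))) b)

  cosingleton-coloop : ∀ {H} → NonBasis M H → ∣ ∁ H ∣ ≡ 1 → ∃ (Coloop M)
  cosingleton-coloop {H} (size , ¬b) one with member {A = ∁ H} (ℕ.≤-reflexive (sym one))
  ... | e , e∈ = e , λ B b → decidable-stable (e ∈? B) λ e∉ → ¬b (subst (Basis M) (⊆-size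
    (λ {z} z∈ → decidable-stable (z ∈? H) λ z∉ →
      e∉ (subst (_∈ B) (one-element (ℕ.≤-reflexive one) (x∉p⇒x∈∁p z∉) e∈) z∈))
    (trans (basis-rank M b) (sym size))) b)

-- The only disconnected case without loops and coloops is U₁,₂ ⊕ U₁,₂.
two-pairs : ∀ {i} {γ : Matroid 4 → ℤ} → SpeyerCoefficient i γ → ∀ (M : Matroid 4) → SparsePaving M → rank M ≡ 2 →
            ∀ {H₁ H₂} → NonBasis M H₁ → NonBasis M H₂ → H₁ ≢ H₂ → 0ℤ ℤ.≤ γ M
two-pairs C M paving rank≡ {H₁} {H₂} p₁@(size₁ , ¬b₁) p₂@(size₂ , ¬b₂) H₁≢H₂ = subst (0ℤ ℤ.≤_) (sym
  (trans (≅-cong (≐⇒≅ {M = M} {S} ((λ {B} → to B) , λ {B} → from B))) (γ-decomposition C S-free S-decomposition))) (ℤ.+≤+ z≤n)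
  where
  open SpeyerCoefficient C
  ∣H₁∣ : ∣ H₁ ∣ ≡ 2
  ∣H₁∣ = trans size₁ rank≡
  ∣∁H₁∣ : ∣ ∁ H₁ ∣ ≡ 2
  ∣∁H₁∣ = trans (∣∁p∣≡n∸∣p∣ H₁) (cong (4 ℕ.∸_) ∣H₁∣)
  open CircuitHyperplane H₁ (ℕ.≤-reflexive (sym ∣H₁∣)) (ℕ.≤-reflexive (sym ∣∁H₁∣))
  sparse : ∀ {A B} → NonBasis M A → NonBasis M B → ∣ B ∩ ∁ A ∣ ≤ 1 → B ≡ A
  sparse pA pB = sparse-≡ (nonBasis-sparse M paving) pA pB (trans (proj₁ pB) (sym (proj₁ pA)))
  complement : ∀ {B} → ∣ B ∣ ≡ 2 → 2 ≤ ∣ B ∩ ∁ H₁ ∣ → B ≡ ∁ H₁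
  complement {B} size 2≤ = trans (sym (⊆-size (p∩q⊆p B (∁ H₁)) (trans eq (sym size)))) (⊆-size (p∩q⊆q B (∁ H₁)) (trans eq (sym ∣∁H₁∣)))
    where
    eq : ∣ B ∩ ∁ H₁ ∣ ≡ 2
    eq = ℕ.≤-antisym (ℕ.≤-trans (∣p∩q∣≤∣q∣ B (∁ H₁)) (ℕ.≤-reflexive ∣∁H₁∣)) 2≤
  H₂≡ : H₂ ≡ ∁ H₁
  H₂≡ = complement (trans size₂ rank≡) (ℕ.≰⇒> λ ≤1 → H₁≢H₂ (sym (sparse p₁ p₂ ≤1)))
  to : ∀ B → Basis M B → Basis S B
  -- The number of elements of `B` outside `H₁` decides: none means `B` is `H₁`, two mean `B` is its
  -- complement `H₂`, and one means that `B` is a neighbour.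
  to B b with ∣ B ∩ ∁ H₁ ∣ in eq | ∣∩∣+∣∩∁∣ B H₁
  ... | zero | sum = contradiction (subst (Basis M) (trans (sym (⊆-size (p∩q⊆p B H₁) sum))
          (⊆-size (p∩q⊆q B H₁) (trans sum (trans (basis-rank M b) (sym size₁))))) b) ¬b₁
  ... | suc zero | sum = neighbours-basis⁺ H₁ 1≤l B eq
          (trans (ℕ.suc-injective (trans sum (trans (basis-rank M b) rank≡))) (cong ℕ.pred (sym ∣H₁∣)))
  ... | suc (suc j) | sum = contradiction (subst (Basis M) (trans (complement (trans (basis-rank M b) rank≡)
          (ℕ.≤-trans (s≤s (s≤s z≤n)) (ℕ.≤-reflexive (sym eq)))) (sym H₂≡)) b) ¬b₂
  from : ∀ B → Basis S B → Basis M B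
  from B b = decidable-stable (basis? M B) λ ¬b → different (sparse p₁ (trans (neighbours-size B b) size₁ , ¬b) (ℕ.≤-reflexive out))
    where
    out = proj₁ (neighbours-basis⁻ H₁ 1≤l B b)
    different : B ≢ H₁
    different refl = contradiction (trans (sym out) (trans (cong ∣_∣ (self-∩∁ H₁)) (∣⊥∣≡0 4))) λ ()

-- The counting argument covers matroids without non-bases and, apart from two pairs in four
-- elements, ranks from 2 to `n - 2`. In rank 1 or `n - 1` a non-basis exhibits a loop or a coloop,
-- and ranks 0 and `n` do so when `n` is positive. The empty matroid is the sum of no summands.
coefficient-nonneg : ∀ n {i} {γ : Matroid n → ℤ} → SpeyerCoefficient i γ → ∀ M → SparsePaving M → 0ℤ ℤ.≤ γ M
coefficient-nonneg zero {i} C M paving = subst (0ℤ ℤ.≤_) (sym (γ-decomposition C {M = M} (λ ()) decomposition)) (ℤ.+≤+ z≤n)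
  where
  to : ∀ {B} → Basis M B → ∣ B ∣ ≡ 0
  to {[]} _ = refl
  from : ∀ {B} → ∣ B ∣ ≡ 0 → Basis M B
  from {[]} _ with someBasis M
  ... | [] , b = b
  decomposition : Decomposition M 0
  decomposition = record { summands = [] ; all-sp = [] ; count = refl ; iso = ≐⇒≅ {M = M} {U 0 0 z≤n} ((λ {B} → to {B}) , λ {B} → from {B}) }
coefficient-nonneg (suc zero) C M paving with rank M in eq | ∣p∣≤n (proj₁ (someBasis M))
... | zero     | _       = loop-or-coloop C (inj₁ (zero , rank-zero M eq))
... | suc zero | s≤s z≤n = loop-or-coloop C (inj₂ (zero , rank-full M eq))
coefficient-nonneg (suc (suc n′)) {i} {γ} C M paving = by-rank (rank M) refl (∣p∣≤n (proj₁ (someBasis M)))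
  where
  by-family : ∀ {r} → rank M ≡ suc r → r ≤ n′ → ∀ F → enumerate _ (nonBasis? M) ≡ F → 0ℤ ℤ.≤ γ M
  by-family rank≡ r≤n′ [] eq = γ-connected C M paving rank≡ r≤n′ (inj₁ eq)
  by-family {zero} rank≡ r≤n′ (H ∷ F) eq =
    let p = ∈-enumerate⁻ _ (nonBasis? M) (subst (H ∈ᴸ_) (sym eq) (here refl)) in
    loop-or-coloop C (inj₁ (singleton-loop C M p (trans (proj₁ p) rank≡)))
  by-family {suc r} rank≡ r≤n′ (H ∷ F) eq with ℕ.m≤n⇒m<n∨m≡n r≤n′
  ... | inj₂ refl =
    let p = ∈-enumerate⁻ _ (nonBasis? M) (subst (H ∈ᴸ_) (sym eq) (here refl)) in
    loop-or-coloop C (inj₂ (cosingleton-coloop C M p (trans (∣∁p∣≡n∸∣p∣ H)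
      (trans (cong (suc (suc n′) ℕ.∸_) (trans (proj₁ p) rank≡)) (ℕ.m+n∸n≡m 1 (suc r))))))
  ... | inj₁ r<n′ with 3 ℕ.≤? n′
  ...   | yes 3≤n′ = γ-connected C M paving rank≡ r≤n′ (inj₂ (s≤s z≤n , r<n′ , inj₁ 3≤n′))
  ...   | no 3≰n′ = small F eq (ℕ.≤-antisym (ℕ.s≤s⁻¹ (ℕ.≰⇒> 3≰n′)) (ℕ.≤-trans (s≤s (s≤s z≤n)) r<n′))
    where
    -- Here `n′` is 2, so the rank is 2 on four elements: a single non-basis still leaves the
    -- matroid connected, a second one makes it U₁,₂ ⊕ U₁,₂.
    small : ∀ F → enumerate _ (nonBasis? M) ≡ H ∷ F → n′ ≡ 2 → 0ℤ ℤ.≤ γ M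
    small [] eq n′≡2 = γ-connected C M paving rank≡ r≤n′
      (inj₂ (s≤s z≤n , r<n′ , inj₂ (ℕ.≤-reflexive (cong length eq))))
    small (H′ ∷ F) eq refl = two-pairs C M paving (trans rank≡ (cong (ℕ.suc ∘ ℕ.suc) (ℕ.n≤0⇒n≡0 (ℕ.s≤s⁻¹ (ℕ.s≤s⁻¹ r<n′)))))
      (member-of (here refl)) (member-of (there (here refl))) (distinct (subst Unique eq (enumerate-unique _ (nonBasis? M))))
      where
      member-of : ∀ {A} → A ∈ᴸ H ∷ H′ ∷ F → NonBasis M A
      member-of A∈ = ∈-enumerate⁻ _ (nonBasis? M) (subst (_ ∈ᴸ_) (sym eq) A∈)
      distinct : Unique (H ∷ H′ ∷ F) → H ≢ H′
      distinct ((H≢H′ ∷ _) ∷ _) = H≢H′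
  by-rank : ∀ r → rank M ≡ r → r ≤ suc (suc n′) → 0ℤ ℤ.≤ γ M
  by-rank zero eq _ = loop-or-coloop C (inj₁ (zero , rank-zero M eq))
  by-rank (suc r) eq (s≤s r≤) with ℕ.m≤n⇒m<n∨m≡n r≤
  ... | inj₁ (s≤s r≤n′) = by-family eq r≤n′ _ refl
  ... | inj₂ refl       = loop-or-coloop C (inj₂ (zero , rank-full M eq))

open AbelianGroup ℤ[t]-abelianGroup using (rawMonoid)
open RawMonoidDefinitions rawMonoid using () renaming (_×_ to _·ℕ_; sum to ∑ₜ)
open RawMonoidDefinitions ℤ.+-0-rawMonoid using () renaming (sum to ∑ℤ)

coeff-·ℕ : ∀ k p i → coeff (k ·ℕ p) i ≡ + k ℤ.* coeff p i
coeff-·ℕ zero    p i = sym (ℤ.*-zeroˡ (coeff p i))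
coeff-·ℕ (suc k) p i = trans (cong (λ z → coeff p i ℤ.+ z) (coeff-·ℕ k p i)) (sym (ℤ.suc-* (+ k) (coeff p i)))

coeff-· : ∀ z p i → coeff (_·_ ℤ[t]-abelianGroup z p) i ≡ z ℤ.* coeff p i
coeff-· (+ k)        p i = coeff-·ℕ k p i
coeff-· (ℤ.-[1+ k ]) p i = trans (cong ℤ.-_ (coeff-·ℕ (suc k) p i)) (ℤ.neg-distribˡ-* (+ suc k) (coeff p i))

coeff-∑ : ∀ {s} (p : Fin s → ℤ[t]) i → coeff (∑ₜ p) i ≡ ∑ℤ (λ j → coeff (p j) i)
coeff-∑ {zero}  p i = refl
coeff-∑ {suc s} p i = cong (λ z → coeff (p zero) i ℤ.+ z) (coeff-∑ (p ∘ suc) i)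

∑ℤ-cong : ∀ {s} {p q : Fin s → ℤ} → (∀ j → p j ≡ q j) → ∑ℤ p ≡ ∑ℤ q
∑ℤ-cong {zero}  eq = refl
∑ℤ-cong {suc s} eq = cong₂ ℤ._+_ (eq zero) (∑ℤ-cong (eq ∘ suc))

-- Taking a coefficient is additive, so the covaluation with values in polynomials yields an integer
-- valuation in each degree.
speyer-coefficient : ∀ {g} → IsSpeyerPolynomial g → ∀ E i → SpeyerCoefficient {size E} i (λ M → coeff (g E M) i)
speyer-coefficient {g} G E i = record
  { v               = λ M → sign (components M) ℤ.* coeff (g E M) i
  ; v≡              = λ _ → refl
  ; valuative       = record { valuative = valuative }
  ; ≅-cong          = λ {M} {N} M≅N → invariant E E M N M≅N i
  ; degenerate      = λ {M} h → G.loop-or-coloop E M h i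
  ; series-parallel = λ {M} ¬loop ¬coloop Ms all iso → trans (G.series-parallel E M ¬loop ¬coloop Ms all iso i) (power (length Ms))
  }
  where
  module G = IsSpeyerPolynomial G
  open G using (invariant; covaluative)
  power : ∀ k → coeff (t^ k) i ≡ + δ i k
  power k with i ℕ.≟ k
  ... | yes refl = trans (cong (λ b → if b then 1ℤ else 0ℤ) (dec-true (i ℕ.≟ i) refl)) (cong +_ (sym (δ-≡ i)))
  ... | no i≢k   = trans (cong (λ b → if b then 1ℤ else 0ℤ) (dec-false (i ℕ.≟ k) i≢k)) (cong +_ (sym (δ-≢ i≢k)))
  valuative : ∀ {s} (a : Fin s → ℤ) (M : Fin s → MatroidOn E) → PolytopeRelation a M →
              ∑ℤ (λ j → a j ℤ.* (sign (components (M j)) ℤ.* coeff (g E (M j)) i)) ≡ 0ℤ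
  valuative a M relation = trans (sym (trans (coeff-∑ term i) (∑ℤ-cong eq))) (covaluative E a M relation i)
    where
    term : Fin _ → ℤ[t]
    term j = _·_ ℤ[t]-abelianGroup (a j) (_·_ ℤ[t]-abelianGroup (sign (components (M j))) (g E (M j)))
    eq : ∀ j → coeff (term j) i ≡ a j ℤ.* (sign (components (M j)) ℤ.* coeff (g E (M j)) i)
    eq j = trans (coeff-· (a j) _ i) (cong (λ z → a j ℤ.* z) (coeff-· (sign (components (M j))) (g E (M j)) i))

theorem9p20 : (g : MatroidMap ℤ[t]-abelianGroup) → IsSpeyerPolynomial g →
    (E : GroundSet) (M : MatroidOn E) → SparsePaving M →
    NonNegativeCoefficients (g E M)
theorem9p20 g G E M paving i = coefficient-nonneg (size E) (speyer-coefficient G E i) M paving
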